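{- The Minimum Liar's VE-Domination Problem can be solved in linear time for trees; that is, there is an algorithm which, given a tree $T$, outputs a minimum-cardinality liar's ve-dominating set of $T$ in time linear in the size of $T$.
   Context: Graphs are finite, simple and undirected. For a graph $G=(V,E)$ and $v\in V$, $N_G(v)=\{u\in V : uv\in E\}$ and $N_G[v]=N_G(v)\cup\{v\}$. For an edge $e=xy\in E$, $N_G[e]=N_G[x]\cup N_G[y]$. A set $L\subseteq V$ is a liar's ve-dominating (vertex-edge dominating) set of $G$ if (i) for every $e\in E$, $|N_G[e]\cap L|\ge 2$, and (ii) for every pair of distinct edges $e,e'\in E$, $|(N_G[e]\cup N_G[e'])\cap L|\ge 3$. Minimum Liar's VE-Domination Problem: given a graph $G$, output a liar's ve-dominating set of $G$ of minimum cardinality. -}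

module Defs where

open import Data.Bool using (if_then_else_; _∧_)
open import Data.Empty using (⊥)
open import Data.Fin using (Fin; toℕ; _≟_)
open import Data.Fin.Subset using (Subset; ⁅_⁆; _∪_; _∩_; ∣_∣)
open import Data.List using (List; []; _∷_; _++_; concat; length; map; take)
open import Data.List.Membership.Propositional using (_∈_)
open import Data.List.Relation.Unary.Linked using (Linked)
open import Data.List.Relation.Unary.Unique.Propositional using (Unique)
open import Data.Nat using (ℕ; zero; suc; _+_; _∸_; _≤_; _<_; _≡ᵇ_)
open import Data.Nat.ListAction using (sum)
open import Data.Product using (_×_)
open import Data.Sum using (_⊎_)
open import Data.Vec as Vec using (Vec; lookup; tabulate; toList)
open import Function.Bundles using (_⇔_)
open import Level using (0ℓ)
open import Relation.Binary using (Rel; Symmetric; Irreflexive; Decidable)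
open import Relation.Binary.Construct.Closure.ReflexiveTransitive using (Star)
open import Relation.Binary.PropositionalEquality using (_≡_; _≢_)
open import Relation.Nullary using (¬_; does)

------------------------------------------------------------------------
-- Graphs and trees

record Graph (n : ℕ) : Set₁ where
  field
    Adj    : Rel (Fin n) 0ℓ
    adj?   : Decidable Adj
    sym    : Symmetric Adj
    irrefl : Irreflexive _≡_ Adj

module _ {n : ℕ} (G : Graph n) where
  open Graph G

  Connected : Set
  Connected = ∀ u v → Star Adj u v

  -- x ∷ xs is a cycle if its vertices are distinct, there are at least
  -- three of them, and the closed walk x ∷ xs ++ x ∷ [] follows edges.
  IsCycle : List (Fin n) → Set
  IsCycle []       = ⊥
  IsCycle (x ∷ xs) =
    Unique (x ∷ xs) × 3 ≤ length (x ∷ xs) × Linked Adj (x ∷ xs ++ x ∷ [])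

  Acyclic : Set
  Acyclic = ∀ xs → ¬ IsCycle xs

  record IsTree : Set where
    field
      nonempty  : 0 < n
      connected : Connected
      acyclic   : Acyclic

  ----------------------------------------------------------------------
  -- Liar's vertex-edge domination

  -- An edge is given by an ordered pair of endpoints; each undirected
  -- edge therefore occurs in both orientations, which SameEdge identifies.
  record Edge : Set where
    constructor edge
    field
      source   : Fin n
      target   : Fin n
      adjacent : Adj source target
  open Edge

  SameEdge : Rel Edge 0ℓ
  SameEdge e e′ =
    (source e ≡ source e′ × target e ≡ target e′) ⊎
    (source e ≡ target e′ × target e ≡ source e′)

  N⟨_⟩ : Fin n → Subset n
  N⟨ v ⟩ = tabulate λ u → does (adj? u v)

  N[_] : Fin n → Subset n
  N[ v ] = N⟨ v ⟩ ∪ ⁅ v ⁆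

  Nₑ[_] : Edge → Subset n
  Nₑ[ e ] = N[ source e ] ∪ N[ target e ]

  record IsLiarsVEDominating (L : Subset n) : Set where
    field
      double : ∀ e → 2 ≤ ∣ Nₑ[ e ] ∩ L ∣
      triple : ∀ e e′ → ¬ SameEdge e e′ → 3 ≤ ∣ (Nₑ[ e ] ∪ Nₑ[ e′ ]) ∩ L ∣

  record IsMinimumLiarsVEDominating (L : Subset n) : Set where
    field
      dominating : IsLiarsVEDominating L
      minimum    : ∀ L′ → IsLiarsVEDominating L′ → ∣ L ∣ ≤ ∣ L′ ∣

  ----------------------------------------------------------------------
  -- Adjacency lists, with the neighbours of each vertex in any order

  record IsAdjacencyLists (adj : Vec (List (Fin n)) n) : Set where
    field
      unique   : ∀ v → Unique (lookup adj v)
      complete : ∀ v u → (u ∈ lookup adj v) ⇔ Adj v u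

------------------------------------------------------------------------
-- A word RAM, programmed in structured code.
--
-- Memory consists of arrays of unbounded length; a program names finitely
-- many of them by literals. (Interleaving them gives a single memory.)
-- The only arithmetic is addition and truncated subtraction.

Memory : Set
Memory = ℕ → ℕ → ℕ

_[_,_↦_] : Memory → ℕ → ℕ → ℕ → Memory
(m [ a , i ↦ x ]) b j = if (a ≡ᵇ b) ∧ (i ≡ᵇ j) then x else m b j

infixl 7 _⊕_ _⊖_
infix  8 _!_
infix  5 _!_≔_
infixr 4 _⨟_

data Expr : Set where
  lit     : ℕ → Expr
  _!_     : ℕ → Expr → Expr
  _⊕_ _⊖_ : Expr → Expr → Expr

data Stmt : Set where
  skip  : Stmt
  _!_≔_ : ℕ → Expr → Expr → Stmt
  _⨟_   : Stmt → Stmt → Stmt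
  cond  : Expr → Stmt → Stmt → Stmt
  while : Expr → Stmt → Stmt

⟦_⟧ : Expr → Memory → ℕ
⟦ lit k ⟧ m = k
⟦ a ! e ⟧ m = m a (⟦ e ⟧ m)
⟦ d ⊕ e ⟧ m = ⟦ d ⟧ m + ⟦ e ⟧ m
⟦ d ⊖ e ⟧ m = ⟦ d ⟧ m ∸ ⟦ e ⟧ m

cost : Expr → ℕ
cost (lit k) = 1
cost (a ! e) = 1 + cost e
cost (d ⊕ e) = 1 + (cost d + cost e)
cost (d ⊖ e) = 1 + (cost d + cost e)

-- w ⊢ p , m ⇓ m′ , t : started in memory m, the program p halts in memory
-- m′ after t steps, never storing a value exceeding w. Bounding the words
-- keeps unit-cost arithmetic from being applied to huge numbers;
-- intermediate values and addresses are then within a factor, depending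
-- only on p, of the largest of w, the input words and the literals of p.
-- Zero is false in conditions.
infix 3 _⊢_,_⇓_,_

data _⊢_,_⇓_,_ (w : ℕ) : Stmt → Memory → Memory → ℕ → Set where
  ⇓skip   : ∀ {m} → w ⊢ skip , m ⇓ m , 1
  ⇓assign : ∀ {a d e m} → ⟦ e ⟧ m ≤ w →
            w ⊢ a ! d ≔ e , m ⇓ m [ a , ⟦ d ⟧ m ↦ ⟦ e ⟧ m ] , 1 + (cost d + cost e)
  ⇓seq    : ∀ {p q m m′ m″ t u} →
            w ⊢ p , m ⇓ m′ , t → w ⊢ q , m′ ⇓ m″ , u →
            w ⊢ p ⨟ q , m ⇓ m″ , t + u
  ⇓then   : ∀ {e p q m m′ t} → ⟦ e ⟧ m ≢ 0 →
            w ⊢ p , m ⇓ m′ , t → w ⊢ cond e p q , m ⇓ m′ , 1 + (cost e + t)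
  ⇓else   : ∀ {e p q m m′ t} → ⟦ e ⟧ m ≡ 0 →
            w ⊢ q , m ⇓ m′ , t → w ⊢ cond e p q , m ⇓ m′ , 1 + (cost e + t)
  ⇓loop   : ∀ {e p m m′ m″ t u} → ⟦ e ⟧ m ≢ 0 →
            w ⊢ p , m ⇓ m′ , t → w ⊢ while e p , m′ ⇓ m″ , u →
            w ⊢ while e p , m ⇓ m″ , 1 + (cost e + (t + u))
  ⇓exit   : ∀ {e p m} → ⟦ e ⟧ m ≡ 0 →
            w ⊢ while e p , m ⇓ m , 1 + cost e

------------------------------------------------------------------------
-- Input and output

cells : List ℕ → ℕ → ℕ
cells []       _       = 0
cells (x ∷ xs) zero    = x
cells (x ∷ xs) (suc i) = cells xs i

-- Array 0 holds n. The neighbours of vertex v are the entries of array 2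
-- at positions k with offset v ≤ k < offset (v + 1), where array 1 holds
-- the offsets. All other memory is initially zero.
input : ∀ {n} → Vec (List (Fin n)) n → Memory
input {n} adj 0 = cells (n ∷ [])
input {n} adj 1 = λ i → sum (take i (map length (toList adj)))
input {n} adj 2 = cells (map toℕ (concat (toList adj)))
input {n} adj _ = λ _ → 0

-- Array 3 holds the characteristic vector of the answer.
Outputs : ∀ {n} → Memory → Subset n → Set
Outputs m L = ∀ v → m 3 (toℕ v) ≡ (if lookup L v then 1 else 0)

{-# OPTIONS --safe #-}
-- A breadth-first search orders the vertices so that each vertex has exactly
-- one earlier neighbour, its parent: a second one would close a cycle. Let S v
-- be the number of elements of L in N[v] and C v the number of children of v
-- in L. If N[e] ∩ L and N[e′] ∩ L are the same pair, then e and e′ are at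
-- distance at most one, because edges further apart share at most one vertex
-- of N[e] and N[e′]; hence L is liar's dominating iff 2 ≤ S v + C w for every
-- child w of v, and 3 ≤ S v + C w + C y whenever w is a child of v and y is
-- another child of v or a child of w. A rooted tree grows by grafting a tree
-- onto the root of another one, and these constraints only depend on finitely
-- many states of the two roots, so the least weight for every root state is
-- found by grafting the vertices onto their parents in reverse order of
-- discovery. Undoing the grafts in order of discovery recovers an optimal set.
module Submission where

open import Defs
open import Data.Bool using (Bool; true; false; if_then_else_; _∧_)
open import Data.Empty using (⊥; ⊥-elim)
open import Data.Fin using (Fin; zero; suc; toℕ; fromℕ<; _≟_; combine; remQuot; opposite)
open import Data.Fin.Properties using (toℕ-injective; toℕ<n; toℕ-fromℕ<; toℕ-combine; combine-injective; remQuot-combine; opposite-involutive)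
open import Data.Fin.Subset using (Subset; _∩_; _∪_; _-_; ∣_∣; ⁅_⁆; _⊆_) renaming (_∈_ to _∈ₛ_; _∉_ to _∉ₛ_; ⊤ to ⊤ₛ)
open import Data.Fin.Subset.Properties using (_∈?_; nonempty?; Empty-unique; ∈⊤; ∣⊤∣≡n; ∣⊥∣≡0; p─⊥≡p; p─q⊆p; x∈p∧x≢y⇒x∈p-y; x∈p⇒∣p-x∣<∣p∣; p⊂q⇒∣p∣<∣q∣; x∈p∪q⁺; x∈p∪q⁻; x∈p∩q⁺; x∈p∩q⁻; x∈⁅x⁆; x∈⁅y⁆⇒x≡y; ∪-comm)
open import Data.List using (List; []; _∷_; _++_; _ʳ++_; length; map; take; concat; allFin; cartesianProduct)
open import Data.List.Membership.Propositional using (_∈_; _∉_)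
open import Data.List.Membership.Propositional.Properties using (∈-++⁺ˡ; ∈-++⁺ʳ; ∈-++⁻; ∈-allFin; ∈-cartesianProduct⁺)
open import Data.List.Properties using (++-assoc; length-++; length-map; map-++)
open import Data.List.Relation.Binary.Disjoint.Propositional using (Disjoint)
open import Data.List.Relation.Unary.All as All using (All; []; _∷_)
open import Data.List.Relation.Unary.All.Properties using (++⁺; ¬Any⇒All¬)
open import Data.List.Relation.Unary.AllPairs using (AllPairs; []; _∷_)
open import Data.List.Relation.Unary.Any using (here; there)
open import Data.List.Relation.Unary.Any.Properties using (reverse⁺; reverse⁻)
open import Data.List.Relation.Unary.Linked using (Linked; []; [-]; _∷_)
open import Data.List.Relation.Unary.Unique.Propositional using (Unique)
import Data.List.Relation.Unary.Unique.Propositional.Properties as Unique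
open import Data.Maybe as Maybe using (Maybe; just; nothing; _>>=_)
open import Data.Maybe.Properties using (just-injective)
open import Data.Nat as ℕ hiding (_≟_; zero; suc; ∣_-_∣)
open import Data.Nat using (zero; suc)
open import Data.Nat.ListAction using (sum)
open import Data.Nat.ListAction.Properties using (sum-++)
open import Data.Nat.Properties hiding (_≟_)
open import Data.Product as Product using (Σ-syntax; _×_; _,_; proj₁; proj₂)
open import Data.Sum using (_⊎_; inj₁; inj₂; [_,_]′)
open import Data.Unit using (⊤; tt)
open import Data.Vec using (Vec; []; _∷_; there; lookup; tabulate; toList)
open import Data.Vec.Properties using (lookup∘tabulate; []=⇒lookup; lookup⇒[]=)
open import Function.Bundles using (Equivalence)
open import Relation.Binary.Construct.Closure.ReflexiveTransitive using (Star; ε; _◅_)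
open import Relation.Binary.PropositionalEquality
open import Relation.Nullary using (¬_; Dec; does; yes; no; contradiction)
open import Relation.Nullary.Decidable using (dec-true; _×-dec_; _⊎-dec_)

-- Running programs

-- The exact counts at a vertex are unbounded, but no constraint asks for more than 3, and cutting
-- off at 3 is compatible with the sums and minima involved. So domination is characterised with
-- exact numbers first, and a homomorphism carries the result over to 512 codes. Loops over states
-- and over pairs of states are unrolled into the program text; the constant becomes huge, but it is
-- independent of the tree. The constraints centred at a vertex are tested when it is grafted onto
-- its parent: all its children have been attached by then, and the parent enters only through its
-- own membership. Every vertex except the root is grafted once, so one row of recorded choices per
-- vertex is enough to trace the optimum back. The search keeps no visited marks: in a tree it
-- suffices to compare each neighbour with the parent of the head. The weight n + 1 serves as
-- infinity, and the set of all vertices, which is always dominating, shows that the optimum lies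
-- below it.

≡ᵇ-refl : ∀ i → (i ≡ᵇ i) ≡ true
≡ᵇ-refl zero    = refl
≡ᵇ-refl (suc i) = ≡ᵇ-refl i

≢⇒≡ᵇ : ∀ {i j} → i ≢ j → (i ≡ᵇ j) ≡ false
≢⇒≡ᵇ {zero}  {zero}  i≢j = contradiction refl i≢j
≢⇒≡ᵇ {zero}  {suc j} i≢j = refl
≢⇒≡ᵇ {suc i} {zero}  i≢j = refl
≢⇒≡ᵇ {suc i} {suc j} i≢j = ≢⇒≡ᵇ (λ i≡j → i≢j (cong suc i≡j))

write-same : ∀ {i j x y : ℕ} → i ≡ j → (if i ≡ᵇ j then x else y) ≡ x
write-same {i} refl rewrite ≡ᵇ-refl i = refl

write-other : ∀ {i j x y : ℕ} → i ≢ j → (if i ≡ᵇ j then x else y) ≡ y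
write-other i≢j rewrite ≢⇒≡ᵇ i≢j = refl

-- Multiplication is not an instruction, but the factor will be the number of states, a constant of
-- the program, so repeated addition takes constant time.
times : ℕ → Expr → Expr
times zero    e = lit 0
times (suc k) e = e ⊕ times k e

⟦times⟧ : ∀ k e m → ⟦ times k e ⟧ m ≡ k * ⟦ e ⟧ m
⟦times⟧ zero    e m = refl
⟦times⟧ (suc k) e m = cong (⟦ e ⟧ m +_) (⟦times⟧ k e m)

infix 7 _≠_

-- At least one of the two truncated differences vanishes, so the sum is the distance, which is zero
-- exactly for equal values.
_≠_ : Expr → Expr → Expr
d ≠ e = (d ⊖ e) ⊕ (e ⊖ d)

≠-zero⇒≡ : ∀ d e {m} → ⟦ d ≠ e ⟧ m ≡ 0 → ⟦ d ⟧ m ≡ ⟦ e ⟧ m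
≠-zero⇒≡ d e {m} eq = ≤-antisym
  (m∸n≡0⇒m≤n (m+n≡0⇒m≡0 _ eq))
  (m∸n≡0⇒m≤n (m+n≡0⇒n≡0 (⟦ d ⟧ m ∸ ⟦ e ⟧ m) eq))

≡⇒≠-zero : ∀ d e {m} → ⟦ d ⟧ m ≡ ⟦ e ⟧ m → ⟦ d ≠ e ⟧ m ≡ 0
≡⇒≠-zero d e {m} eq rewrite eq = cong₂ _+_ (n∸n≡0 (⟦ e ⟧ m)) (n∸n≡0 (⟦ e ⟧ m))

opaque
  -- A bound read off the text alone, which is why both branches of a conditional are charged. Loops
  -- are accounted for by `loop-time`, and none is nested in another. Being opaque, it is never
  -- computed for the unrolled program.
  duration : Stmt → ℕ
  duration skip         = 1
  duration (a ! d ≔ e)  = 1 + (cost d + cost e)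
  duration (p ⨟ q)      = duration p + duration q
  duration (cond e p q) = 1 + (cost e + (duration p + duration q))
  duration (while e p)  = 0

-- The round beyond the `k` passes pays for the final test.
loop-time : Expr → Stmt → ℕ → ℕ
loop-time e p k = suc k * (1 + (cost e + duration p))

-- A syntactic criterion: for a concrete program and a literal array it computes to equations proved
-- by `refl`.
Keeps : ℕ → Stmt → Set
Keeps a skip         = ⊤
Keeps a (b ! d ≔ e)  = (b ≡ᵇ a) ≡ false
Keeps a (p ⨟ q)      = Keeps a p × Keeps a q
Keeps a (cond e p q) = Keeps a p × Keeps a q
Keeps a (while e p)  = Keeps a p

module _ (w : ℕ) where

  record Runs (p : Stmt) (m : Memory) (T : ℕ) (Q : Memory → Set) : Set where
    constructor runs
    field
      {final} : Memory
      {time}  : ℕ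
      exec    : w ⊢ p , m ⇓ final , time
      bound   : time ≤ T
      post    : Q final

  runs-seq : ∀ {p q m T U Q R} → Runs p m T Q →
             (∀ {m′} → Q m′ → Runs q m′ U R) → Runs (p ⨟ q) m (T + U) R
  runs-seq (runs e b q) k with k q
  ... | runs e′ b′ r = runs (⇓seq e e′) (+-mono-≤ b b′) r

  runs-mono : ∀ {p m T U Q R} → T ≤ U → (∀ {m′} → Q m′ → R m′) →
              Runs p m T Q → Runs p m U R
  runs-mono T≤U f (runs e b q) = runs e (≤-trans b T≤U) (f q)

  -- Loops have no rule here: wp is meant for straight-line code.
  wp : Stmt → (Memory → Set) → Memory → Set
  wp skip         Q m = Q m
  wp (a ! d ≔ e)  Q m = ⟦ e ⟧ m ≤ w × Q (m [ a , ⟦ d ⟧ m ↦ ⟦ e ⟧ m ])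
  wp (p ⨟ q)      Q m = wp p (wp q Q) m
  wp (cond e p q) Q m = (⟦ e ⟧ m ≢ 0 → wp p Q m) × (⟦ e ⟧ m ≡ 0 → wp q Q m)
  wp (while e p)  Q m = ⊥

  wp-mono : ∀ p {Q R m} → (∀ {m′} → Q m′ → R m′) → wp p Q m → wp p R m
  wp-mono skip         f h         = f h
  wp-mono (a ! d ≔ e)  f (b , h)   = b , f h
  wp-mono (p ⨟ q)      f h         = wp-mono p (wp-mono q f) h
  wp-mono (cond e p q) f (h₁ , h₂) =
    (λ nz → wp-mono p f (h₁ nz)) , λ z → wp-mono q f (h₂ z)

  opaque
    unfolding duration

    wp-sound : ∀ p {Q m} → wp p Q m → Runs p m (duration p) Q
    wp-sound skip         h         = runs ⇓skip ≤-refl h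
    wp-sound (a ! d ≔ e)  (b , h)   = runs (⇓assign b) ≤-refl h
    wp-sound (p ⨟ q)      h         = runs-seq (wp-sound p h) (wp-sound q)
    wp-sound (cond e p q) {m = m} (h₁ , h₂) with ⟦ e ⟧ m ℕ.≟ 0
    ... | yes z with wp-sound q (h₂ z)
    ...   | runs x b r = runs (⇓else z x) (s≤s (+-monoʳ-≤ (cost e) (m≤n⇒m≤o+n (duration p) b))) r
    wp-sound (cond e p q) {m = m} (h₁ , h₂) | no nz with wp-sound p (h₁ nz)
    ...   | runs x b r = runs (⇓then nz x) (s≤s (+-monoʳ-≤ (cost e) (m≤n⇒m≤n+o (duration q) b))) r

  -- The measure indexes the invariant, while the recursion runs on its bound `b`. A pass may thus
  -- lower the measure by more than one, and the time remains that of `b` passes.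
  while-rule : ∀ {e p} (I : ℕ → Memory → Set) →
    (∀ {k m} → I k m → ⟦ e ⟧ m ≢ 0 → wp p (λ m′ → Σ[ j ∈ ℕ ] j < k × I j m′) m) →
    ∀ b k {m} → k ≤ b → I k m →
    Runs (while e p) m (loop-time e p b) (λ m′ → Σ[ j ∈ ℕ ] I j m′ × ⟦ e ⟧ m′ ≡ 0)
  while-rule {e} {p} I step b k {m} k≤b h with ⟦ e ⟧ m ℕ.≟ 0
  ... | yes z = runs (⇓exit z) (m≤n⇒m≤n+o _ (s≤s (m≤m+n (cost e) _))) (k , h , z)
  ... | no nz with wp-sound p (step h nz)
  while-rule {e} {p} I step zero k k≤0 h | no nz | runs x t (j , j<k , h′) =
    contradiction (<-≤-trans j<k k≤0) λ ()
  while-rule {e} {p} I step (suc b) k k≤b h | no nz | runs {time = t} x tb (j , j<k , h′)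
    with while-rule {e} {p} I step b j (s≤s⁻¹ (<-≤-trans j<k k≤b)) h′
  ... | runs {time = u} x′ t′ r = runs (⇓loop nz x x′) le r
    where
    open ≤-Reasoning
    le : 1 + (cost e + (t + u)) ≤ loop-time e p (suc b)
    le = begin
      1 + (cost e + (t + u))                        ≡⟨ cong suc (sym (+-assoc (cost e) t u)) ⟩
      1 + (cost e + t) + u                          ≤⟨ +-mono-≤ (s≤s (+-monoʳ-≤ (cost e) tb)) t′ ⟩
      1 + (cost e + duration p) + loop-time e p b   ∎

  frame : ∀ {a p m m′ t} → w ⊢ p , m ⇓ m′ , t → Keeps a p → ∀ i → m′ a i ≡ m a i
  frame ⇓skip         k         i = refl
  frame (⇓assign _)   k         i rewrite k = refl
  frame (⇓seq x y)    (k₁ , k₂) i = trans (frame y k₂ i) (frame x k₁ i)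
  frame (⇓then _ x)   (k₁ , k₂) i = frame x k₁ i
  frame (⇓else _ x)   (k₁ , k₂) i = frame x k₂ i
  frame (⇓loop _ x y) k         i = trans (frame y k i) (frame x k i)
  frame (⇓exit _)     k         i = refl

  runs-frame : ∀ {p m T Q} → Runs p m T Q →
    Runs p m T (λ m′ → Q m′ × (∀ a → Keeps a p → ∀ i → m′ a i ≡ m a i))
  runs-frame (runs x b q) = runs x b (q , λ a k → frame x k)

  wp-frame : ∀ p {Q m} → wp p Q m → wp p (λ m′ → Q m′ × (∀ a → Keeps a p → ∀ i → m′ a i ≡ m a i)) m
  wp-frame skip         h         = h , λ _ _ _ → refl
  wp-frame (a ! d ≔ e)  (b , h)   = b , h , λ _ k i → aux k
    where
    aux : ∀ {c j} {x y : ℕ} → (a ≡ᵇ c) ≡ false → (if (a ≡ᵇ c) ∧ j then x else y) ≡ y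
    aux k rewrite k = refl
  wp-frame (p ⨟ q)      h         = wp-mono p (λ (h′ , f) →
    wp-mono q (λ (h″ , g) → h″ , λ a (k₁ , k₂) i → trans (g a k₂ i) (f a k₁ i)) (wp-frame q h′)) (wp-frame p h)
  wp-frame (cond e p q) (h₁ , h₂) =
    (λ nz → wp-mono p (λ (h , f) → h , λ a (k₁ , _) → f a k₁) (wp-frame p (h₁ nz))) ,
    (λ z → wp-mono q (λ (h , f) → h , λ a (_ , k₂) → f a k₂) (wp-frame q (h₂ z)))

-- The iteration takes place while the program is written, not while it runs, so the result is still
-- straight-line code to which `wp` applies.
each : ∀ {A : Set} → (A → Stmt) → List A → Stmt
each f []       = skip
each f (x ∷ xs) = f x ⨟ each f xs

Keeps-each : ∀ {A : Set} a (f : A → Stmt) → (∀ x → Keeps a (f x)) → ∀ xs → Keeps a (each f xs)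
Keeps-each a f h []       = tt
Keeps-each a f h (x ∷ xs) = h x , Keeps-each a f h xs

fill : ∀ {A : Set} → ℕ → (A → Expr) → (A → Expr) → A → Stmt
fill a d e x = a ! d x ≔ e x

module _ {A : Set} (w a : ℕ) (d e : A → Expr) where

  -- The expressions are evaluated in any memory that agrees with `m` outside array `a`, so entries
  -- already written cannot disturb later ones. The second half of the postcondition lets a caller
  -- show that cells at foreign addresses survive.
  wp-fill : ∀ m (addr val : A → ℕ) → (∀ {x y} → addr x ≡ addr y → x ≡ y) → (∀ x → val x ≤ w) →
    (∀ {m′} → (∀ b → (a ≡ᵇ b) ≡ false → ∀ i → m′ b i ≡ m b i) →
      ∀ x → ⟦ d x ⟧ m′ ≡ addr x × ⟦ e x ⟧ m′ ≡ val x) →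
    ∀ xs → wp w (each (fill a d e) xs) (λ m′ → (∀ {x} → x ∈ xs → m′ a (addr x) ≡ val x) ×
      (∀ i → m′ a i ≡ m a i ⊎ Σ[ x ∈ A ] addr x ≡ i × m′ a i ≡ val x)) m
  wp-fill m addr val inj val≤ evals xs = go xs λ _ _ _ → refl
    where
    aux : ∀ {b c j} {x y z : ℕ} → (b ≡ᵇ c) ≡ false → y ≡ z → (if (b ≡ᵇ c) ∧ j then x else y) ≡ z
    aux k eq rewrite k = eq
    at : ∀ {i j} {x y : ℕ} → i ≡ j → (if (a ≡ᵇ a) ∧ (i ≡ᵇ j) then x else y) ≡ x
    at {i} refl rewrite ≡ᵇ-refl a | ≡ᵇ-refl i = refl
    off : ∀ {i j} {x y : ℕ} → i ≢ j → (if (a ≡ᵇ a) ∧ (i ≡ᵇ j) then x else y) ≡ y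
    off i≢j rewrite ≡ᵇ-refl a | ≢⇒≡ᵇ i≢j = refl
    go : ∀ xs {m″} → (∀ b → (a ≡ᵇ b) ≡ false → ∀ i → m″ b i ≡ m b i) →
      wp w (each (fill a d e) xs) (λ m′ → (∀ {x} → x ∈ xs → m′ a (addr x) ≡ val x) ×
        (∀ i → m′ a i ≡ m″ a i ⊎ Σ[ x ∈ A ] addr x ≡ i × m′ a i ≡ val x)) m″
    go []       agree = (λ ()) , λ _ → inj₁ refl
    go (x ∷ xs) {m″} agree with evals agree x
    ... | dx , ex = subst (_≤ w) (sym ex) (val≤ x) ,
      wp-mono w (each (fill a d e) xs) (λ {m′} (hit , rest) → (λ { (here refl) → head m′ hit rest ; (there y∈) → hit y∈ }) , miss m′ rest)
        (go xs {m″ [ a , ⟦ d x ⟧ m″ ↦ ⟦ e x ⟧ m″ ]} λ b k i → aux {a} {b} {⟦ d x ⟧ m″ ≡ᵇ i} {⟦ e x ⟧ m″} k (agree b k i))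
      where
      head : ∀ m′ → (∀ {y} → y ∈ xs → m′ a (addr y) ≡ val y) →
        (∀ i → m′ a i ≡ (m″ [ a , ⟦ d x ⟧ m″ ↦ ⟦ e x ⟧ m″ ]) a i ⊎ Σ[ y ∈ A ] addr y ≡ i × m′ a i ≡ val y) →
        m′ a (addr x) ≡ val x
      head m′ hit rest with rest (addr x)
      ... | inj₁ eq = trans eq (trans (at dx) ex)
      ... | inj₂ (y , yx , eq) with inj yx
      ...   | refl = eq
      miss : ∀ m′ →
        (∀ i → m′ a i ≡ (m″ [ a , ⟦ d x ⟧ m″ ↦ ⟦ e x ⟧ m″ ]) a i ⊎ Σ[ y ∈ A ] addr y ≡ i × m′ a i ≡ val y) →
        ∀ i → m′ a i ≡ m″ a i ⊎ Σ[ y ∈ A ] addr y ≡ i × m′ a i ≡ val y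
      miss m′ rest i with rest i
      ... | inj₂ r = inj₂ r
      ... | inj₁ eq with addr x ℕ.≟ i
      ...   | yes refl = inj₂ (x , refl , trans eq (trans (at dx) ex))
      ...   | no  x≢i  = inj₁ (trans eq (off λ dx≡i → x≢i (trans (sym dx) dx≡i)))

-- Counting

⟨_⟩ : Bool → ℕ
⟨ b ⟩ = if b then 1 else 0

tally : ∀ {n} → (Fin n → Bool) → List (Fin n) → ℕ
tally L xs = sum (map (λ u → ⟨ L u ⟩) xs)

∣p∣≤1+∣p-x∣ : ∀ {n} (p : Subset n) x → ∣ p ∣ ≤ suc ∣ p - x ∣
∣p∣≤1+∣p-x∣ p x = go p x
  where
  go : ∀ {n} (p : Subset n) x → ∣ p ∣ ≤ suc ∣ p - x ∣
  go (false ∷ p) Fin.zero    = subst (λ q → ∣ p ∣ ≤ suc ∣ q ∣) (sym (p─⊥≡p p)) (n≤1+n _)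
  go (true ∷ p)  Fin.zero    = subst (λ q → suc ∣ p ∣ ≤ suc ∣ q ∣) (sym (p─⊥≡p p)) ≤-refl
  go (false ∷ p) (Fin.suc x) = go p x
  go (true ∷ p)  (Fin.suc x) = s≤s (go p x)

x∉p-x : ∀ {n} (p : Subset n) x → x ∉ₛ p - x
x∉p-x (_     ∷ p) (Fin.suc x) (there x∈) = x∉p-x p x x∈
x∉p-x (true  ∷ p) Fin.zero    ()
x∉p-x (false ∷ p) Fin.zero    ()

-- Counting is done along lists, while domination speaks of subsets; this inequality and `∣∣≤tally`
-- connect the two. Distinctness prevents a repeated entry from being tallied twice.
tally≤∣∣ : ∀ {n} (L : Fin n → Bool) (p : Subset n) {xs} → Unique xs →
           (∀ {u} → u ∈ xs → L u ≡ true → u ∈ₛ p) → tally L xs ≤ ∣ p ∣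
tally≤∣∣ L p [] xs⊆ = z≤n
tally≤∣∣ L p {x ∷ xs} (x∉ ∷ u) xs⊆ with L x in Lx
... | false = tally≤∣∣ L p u (λ y∈ → xs⊆ (there y∈))
... | true  = ≤-trans
  (s≤s (tally≤∣∣ L (p - x) u
     (λ y∈ Ly → x∈p∧x≢y⇒x∈p-y (xs⊆ (there y∈) Ly) (λ y≡x → All.lookup x∉ y∈ (sym y≡x)))))
  (x∈p⇒∣p-x∣<∣p∣ (xs⊆ (here refl) Lx))

∣∣≤tally : ∀ {n} (L : Fin n → Bool) (p : Subset n) xs →
           (∀ {u} → u ∈ₛ p → u ∈ xs × L u ≡ true) → ∣ p ∣ ≤ tally L xs
∣∣≤tally {n} L p [] p⊆ with nonempty? p
... | yes (x , x∈p) = contradiction (proj₁ (p⊆ x∈p)) λ ()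
... | no  empty     = ≤-reflexive (trans (cong ∣_∣ (Empty-unique empty)) (∣⊥∣≡0 n))
∣∣≤tally L p (x ∷ xs) p⊆ with L x in Lx
... | true = ≤-trans (∣p∣≤1+∣p-x∣ p x) (s≤s (∣∣≤tally L (p - x) xs rest))
  where
  rest : ∀ {u} → u ∈ₛ p - x → u ∈ xs × L u ≡ true
  rest {u} u∈ with p⊆ (p─q⊆p p _ u∈)
  ... | here refl , _ = contradiction u∈ (x∉p-x p x)
  ... | there u∈xs , Lu = u∈xs , Lu
... | false = ∣∣≤tally L p xs rest
  where
  rest : ∀ {u} → u ∈ₛ p → u ∈ xs × L u ≡ true
  rest u∈ with p⊆ u∈
  ... | here refl , Lu = contradiction (trans (sym Lx) Lu) λ ()
  ... | there u∈xs , Lu = u∈xs , Lu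

unique⇒length≤n : ∀ {n} {xs : List (Fin n)} → Unique xs → length xs ≤ n
unique⇒length≤n {n} {xs} u = begin
  length xs                ≡⟨ sym (all xs) ⟩
  tally (λ _ → true) xs    ≤⟨ tally≤∣∣ _ ⊤ₛ u (λ _ _ → ∈⊤) ⟩
  ∣ ⊤ₛ {n} ∣                ≡⟨ ∣⊤∣≡n n ⟩
  n                        ∎
  where
  open ≤-Reasoning
  all : ∀ (xs : List (Fin n)) → tally (λ _ → true) xs ≡ length xs
  all []       = refl
  all (x ∷ xs) = cong suc (all xs)

-- Rooted trees in order of discovery

-- A rooted tree is given by the list of its pairs (parent , child), latest
-- child first.
module _ {n : ℕ} (root : Fin n) where

  verts : List (Fin n × Fin n) → List (Fin n)
  verts []            = root ∷ []
  verts ((p , v) ∷ h) = v ∷ verts h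

  -- At h i (q , x): x is the i-th vertex from the root on and has parent q,
  -- where the root counts as a child of n.
  data At : List (Fin n × Fin n) → ℕ → ℕ × Fin n → Set where
    first : At [] 0 (n , root)
    last  : ∀ {p v h} → At ((p , v) ∷ h) (suc (length h)) (toℕ p , v)
    older : ∀ {e h i x} → At h i x → At (e ∷ h) i x

  At⇒≤ : ∀ {h i x} → At h i x → i ≤ length h
  At⇒≤ first     = z≤n
  At⇒≤ last      = ≤-refl
  At⇒≤ (older a) = m≤n⇒m≤1+n (At⇒≤ a)

  At⇒∈ : ∀ {h i q x} → At h i (q , x) → x ∈ verts h
  At⇒∈ first     = here refl
  At⇒∈ last      = here refl
  At⇒∈ (older a) = there (At⇒∈ a)

  ∈⇒At : ∀ {x} h → x ∈ verts h → Σ[ i ∈ ℕ ] Σ[ q ∈ ℕ ] At h i (q , x)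
  ∈⇒At []      (here refl) = _ , _ , first
  ∈⇒At (e ∷ h) (here refl) = _ , _ , last
  ∈⇒At (e ∷ h) (there x∈h) with ∈⇒At h x∈h
  ... | _ , _ , a = _ , _ , older a

  ≤⇒At : ∀ h {i} → i ≤ length h → Σ[ x ∈ ℕ × Fin n ] At h i x
  ≤⇒At []      z≤n = _ , first
  ≤⇒At (e ∷ h) i≤ with m≤n⇒m<n∨m≡n i≤
  ... | inj₂ refl       = _ , last
  ... | inj₁ (s≤s i≤h) with ≤⇒At h i≤h
  ...   | x , a = x , older a

  At-index : ∀ {h i x y} → At h i x → At h i y → x ≡ y
  At-index first     first     = refl
  At-index last      last      = refl
  At-index last      (older b) = contradiction (At⇒≤ b) (<-irrefl refl)
  At-index (older a) last      = contradiction (At⇒≤ a) (<-irrefl refl)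
  At-index (older a) (older b) = At-index a b

  At⇒edge : ∀ {h i q x} → At h i (q , x) → q ≡ n ⊎ Σ[ p ∈ Fin n ] q ≡ toℕ p × (p , x) ∈ h
  At⇒edge first = inj₁ refl
  At⇒edge last  = inj₂ (_ , refl , here refl)
  At⇒edge (older a) with At⇒edge a
  ... | inj₁ q≡n           = inj₁ q≡n
  ... | inj₂ (p , q≡p , e) = inj₂ (p , q≡p , there e)

  edge⇒At : ∀ {p v} h → (p , v) ∈ h → Σ[ i ∈ ℕ ] At h i (toℕ p , v)
  edge⇒At (e ∷ h) (here refl) = _ , last
  edge⇒At (e ∷ h) (there pv∈) with edge⇒At h pv∈
  ... | i , a = i , older a

  edge⇒∈ : ∀ {p v} h → (p , v) ∈ h → v ∈ verts h
  edge⇒∈ h pv∈ = At⇒∈ (proj₂ (edge⇒At h pv∈))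

  module _ (Adj : Fin n → Fin n → Set) where

    data Grown : List (Fin n × Fin n) → Set where
      []  : Grown []
      add : ∀ {p v h} → Adj p v → p ∈ verts h → v ∉ verts h → Grown h →
            Grown ((p , v) ∷ h)

    grown-unique : ∀ {h} → Grown h → Unique (verts h)
    grown-unique []            = [] ∷ []
    grown-unique (add _ _ v∉ g) = ¬Any⇒All¬ _ v∉ ∷ grown-unique g

    edge⇒parent∈ : ∀ {p v h} → Grown h → (p , v) ∈ h → p ∈ verts h
    edge⇒parent∈ (add _ p∈ _ _) (here refl) = there p∈
    edge⇒parent∈ (add _ _ _ g)  (there pv∈) = there (edge⇒parent∈ g pv∈)

    edge⇒adj : ∀ {p v h} → Grown h → (p , v) ∈ h → Adj p v
    edge⇒adj (add pv _ _ _) (here refl) = pv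
    edge⇒adj (add _ _ _ g)  (there pv∈) = edge⇒adj g pv∈

    At-functional : ∀ {h i j q r x} → Grown h → At h i (q , x) → At h j (r , x) → i ≡ j × q ≡ r
    At-functional g              first     first     = refl , refl
    At-functional g              last      last      = refl , refl
    At-functional (add _ _ v∉ _) last      (older a) = contradiction (At⇒∈ a) v∉
    At-functional (add _ _ v∉ _) (older a) last      = contradiction (At⇒∈ a) v∉
    At-functional (add _ _ _ g)  (older a) (older b) = At-functional g a b

-- Paths in the discovered tree and the cycles they would close

module _ {n : ℕ} (G : Graph n) where
  open Graph G renaming (sym to adj-sym)

  data Walk : Fin n → Fin n → List (Fin n) → Set where
    stop : ∀ {a} → Walk a a (a ∷ [])
    step : ∀ {a b c xs} → Adj a b → Walk b c xs → Walk a c (a ∷ xs)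

  walk-snoc : ∀ {a b c xs} → Walk a b xs → Adj b c → Walk a c (xs ++ c ∷ [])
  walk-snoc stop        bc = step bc stop
  walk-snoc (step ab w) bc = step ab (walk-snoc w bc)

  walk-linked : ∀ {a b c v xs} → Adj v a → Walk a b xs → Adj b c → Linked Adj (v ∷ xs ++ c ∷ [])
  walk-linked va stop        bc = va ∷ bc ∷ [-]
  walk-linked va (step ab w) bc = va ∷ walk-linked ab w bc

  walk-long : ∀ {a b xs} → a ≢ b → Walk a b xs → 2 ≤ length xs
  walk-long a≢b stop                 = contradiction refl a≢b
  walk-long a≢b (step _ stop)        = s≤s (s≤s z≤n)
  walk-long a≢b (step _ (step _ _))  = s≤s (s≤s z≤n)

  module _ (root : Fin n) where

    -- The newest vertex is a leaf: a path that ends there is a path to its parent and one more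
    -- edge. The older part stays among the older vertices, which keeps the entries distinct.
    path : ∀ {h a b} → Grown root Adj h → a ∈ verts root h → b ∈ verts root h →
           Σ[ xs ∈ List (Fin n) ] Walk a b xs × Unique xs × All (_∈ verts root h) xs
    path []              (here refl) (here refl) = _ , stop , [] ∷ [] , here refl ∷ []
    path (add _ _ _ _)   (here refl) (here refl) = _ , stop , [] ∷ [] , here refl ∷ []
    path (add pv p∈ v∉ g) (here refl) (there b∈) with path g p∈ b∈
    ... | xs , w , u , xs⊆ =
      _ , step (adj-sym pv) w , All.map (λ x∈ v≡x → v∉ (subst (_∈ _) (sym v≡x) x∈)) xs⊆ ∷ u
        , here refl ∷ All.map there xs⊆
    path (add pv p∈ v∉ g) (there a∈) (here refl) with path g a∈ p∈
    ... | xs , w , u , xs⊆ =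
      _ , walk-snoc w pv
        , Unique.++⁺ u ([] ∷ []) (λ { (x∈xs , here refl) → v∉ (All.lookup xs⊆ x∈xs) })
        , ++⁺ (All.map there xs⊆) (here refl ∷ [])
    path (add _ _ _ g)   (there a∈) (there b∈) with path g a∈ b∈
    ... | xs , w , u , xs⊆ = xs , w , u , All.map there xs⊆

    -- A second earlier neighbour would close a cycle.
    earlier-neighbour : Acyclic G → ∀ {p v h u} → Grown root Adj ((p , v) ∷ h) →
                        u ∈ verts root h → Adj v u → u ≡ p
    earlier-neighbour acyclic {p} {v} {h} {u} (add pv p∈ v∉ g) u∈ vu with u ≟ p
    ... | yes u≡p = u≡p
    ... | no  u≢p with path g u∈ p∈
    ...   | xs , w , uniq , xs⊆ = ⊥-elim (acyclic (v ∷ xs)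
      ( All.map (λ x∈ v≡x → v∉ (subst (_∈ _) (sym v≡x) x∈)) xs⊆ ∷ uniq
      , s≤s (walk-long u≢p w)
      , walk-linked vu w pv))

    -- Whichever end was discovered later has the other one as an earlier neighbour, hence as its
    -- parent.
    adj⇒edge : Acyclic G → ∀ {h x y} → Grown root Adj h → x ∈ verts root h → y ∈ verts root h →
               Adj x y → (x , y) ∈ h ⊎ (y , x) ∈ h
    adj⇒edge ac []              (here refl) (here refl) xy = contradiction xy (irrefl refl)
    adj⇒edge ac (add _ _ _ _)   (here refl) (here refl) xy = contradiction xy (irrefl refl)
    adj⇒edge ac g@(add _ _ _ _) (here refl) (there y∈)  xy with earlier-neighbour ac g y∈ xy
    ... | refl = inj₂ (here refl)
    adj⇒edge ac g@(add _ _ _ _) (there x∈) (here refl)  xy with earlier-neighbour ac g x∈ (adj-sym xy)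
    ... | refl = inj₁ (here refl)
    adj⇒edge ac (add _ _ _ g)   (there x∈) (there y∈)   xy with adj⇒edge ac g x∈ y∈ xy
    ... | inj₁ e = inj₁ (there e)
    ... | inj₂ e = inj₂ (there e)

-- Breadth-first search

offset : ∀ {A : Set} {m} → Vec (List A) m → ℕ → ℕ
offset xss i = sum (take i (map length (toList xss)))

offset-suc : ∀ {A : Set} {m} (xss : Vec (List A) m) v →
             offset xss (suc (toℕ v)) ≡ offset xss (toℕ v) + length (lookup xss v)
offset-suc (xs ∷ xss) zero    = +-identityʳ _
offset-suc (xs ∷ xss) (suc v) =
  trans (cong (length xs +_) (offset-suc xss v)) (sym (+-assoc (length xs) _ _))

cells-++ : ∀ xs {ys} i → cells (xs ++ ys) (length xs + i) ≡ cells ys i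
cells-++ []       i = refl
cells-++ (x ∷ xs) i = cells-++ xs i

cells-concat : ∀ {A : Set} {m} (f : A → ℕ) (xss : Vec (List A) m) v xs {y ys} →
               lookup xss v ≡ xs ++ y ∷ ys →
               cells (map f (concat (toList xss))) (offset xss (toℕ v) + length xs) ≡ f y
cells-concat f (zs ∷ xss) zero xs {y} {ys} refl = begin
  cells (map f ((xs ++ y ∷ ys) ++ rest)) (length xs)   ≡⟨ cong₂ (λ l i → cells (map f l) i) (++-assoc xs _ _) (sym (trans (+-identityʳ _) (length-map f xs))) ⟩
  cells (map f (xs ++ y ∷ ys ++ rest)) (length (map f xs) + 0)   ≡⟨ cong (λ l → cells l _) (map-++ f xs _) ⟩
  cells (map f xs ++ map f (y ∷ ys ++ rest)) (length (map f xs) + 0)   ≡⟨ cells-++ (map f xs) 0 ⟩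
  f y ∎
  where
  open ≡-Reasoning
  rest = concat (toList xss)
cells-concat f (zs ∷ xss) (suc v) xs {y} eq = begin
  cells (map f (zs ++ rest)) (length zs + offset xss (toℕ v) + length xs)        ≡⟨ cong₂ cells (map-++ f zs rest) (trans (+-assoc (length zs) _ _) (cong (_+ (offset xss (toℕ v) + length xs)) (sym (length-map f zs)))) ⟩
  cells (map f zs ++ map f rest) (length (map f zs) + (offset xss (toℕ v) + length xs))    ≡⟨ cells-++ (map f zs) _ ⟩
  cells (map f rest) (offset xss (toℕ v) + length xs)    ≡⟨ cells-concat f xss v xs eq ⟩
  f y ∎
  where
  open ≡-Reasoning
  rest = concat (toList xss)

-- Array 4 is the queue, array 5 holds the parent of each queue entry, and
-- cells 6, 7 and 8 hold the head, the tail and the number of neighbours of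
-- the head that have been scanned.
#n head tail scanned current neighbour : Expr
#n        = 0 ! lit 0
head      = 6 ! lit 0
tail      = 7 ! lit 0
scanned   = 8 ! lit 0
current   = 4 ! head
neighbour = 2 ! (1 ! current ⊕ scanned)

remaining : Expr
remaining = 1 ! (current ⊕ lit 1) ⊖ (1 ! current ⊕ scanned)

-- In a tree, every neighbour except the parent is new.
bfs-body bfs-init bfs : Stmt
bfs-body =
  cond remaining
    (cond (neighbour ≠ (5 ! head))
       (5 ! tail ≔ current ⨟ 4 ! tail ≔ neighbour ⨟ 7 ! lit 0 ≔ tail ⊕ lit 1)
       skip
     ⨟ 8 ! lit 0 ≔ scanned ⊕ lit 1)
    (6 ! lit 0 ≔ head ⊕ lit 1 ⨟ 8 ! lit 0 ≔ lit 0)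
-- The root gets n as its parent. No vertex has this number, so none of the root's neighbours is
-- skipped.
bfs-init =
  4 ! lit 0 ≔ lit 0 ⨟ 5 ! lit 0 ≔ #n ⨟ 6 ! lit 0 ≔ lit 0 ⨟ 7 ! lit 0 ≔ lit 1 ⨟ 8 ! lit 0 ≔ lit 0
bfs = bfs-init ⨟ while (tail ⊖ head) bfs-body

record IsInput {n} (adj : Vec (List (Fin n)) n) (m : Memory) : Set where
  field
    size       : m 0 0 ≡ n
    offsets    : ∀ i → m 1 i ≡ offset adj i
    neighbours : ∀ i → m 2 i ≡ cells (map toℕ (concat (toList adj))) i

∸-suc : ∀ {i n} → i < n → n ∸ i ≡ suc (n ∸ suc i)
∸-suc {zero}  {suc n} _       = refl
∸-suc {suc i} {suc n} (s≤s p) = ∸-suc p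

-- The measure when the head moves on: the vertex leaving the queue releases two units, and only one
-- is spent on the flag of its successor.
twice< : ∀ {a d} f → d ≡ suc a → a + a + 1 < d + d + f
twice< {a} f refl = begin-strict
  a + a + 1          ≡⟨ +-assoc a a 1 ⟩
  a + (a + 1)        ≡⟨ cong (a +_) (+-comm a 1) ⟩
  a + suc a          <⟨ n<1+n _ ⟩
  suc a + suc a      ≤⟨ m≤m+n _ f ⟩
  suc a + suc a + f  ∎
  where open ≤-Reasoning

module _ {A : Set} where

  unique-suffix : ∀ (xs : List A) {ys} → Unique (xs ++ ys) → Unique ys
  unique-suffix []       u       = u
  unique-suffix (x ∷ xs) (_ ∷ u) = unique-suffix xs u

  first-apart : ∀ {x} {xs : List A} → Unique (x ∷ xs) → All (x ≢_) xs
  first-apart (x∉ ∷ _) = x∉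

  unique-prefix : ∀ (xs : List A) {ys} → Unique (xs ++ ys) → ∀ {x} → x ∈ xs → All (x ≢_) ys
  unique-prefix (x ∷ xs) (x∉ ∷ _) (here refl) = All.tabulate λ y∈ → All.lookup x∉ (∈-++⁺ʳ xs y∈)
  unique-prefix (x ∷ xs) (_ ∷ u)  (there x∈)  = unique-prefix xs u x∈

module _ {k : ℕ} (G : Graph (suc k)) (tree : IsTree G)
         (adj : Vec (List (Fin (suc k))) (suc k)) (lists : IsAdjacencyLists G adj)
         (w : ℕ) (n<w : suc k < w) where
  open Graph G renaming (sym to adj-sym)
  open IsTree tree
  open IsAdjacencyLists lists

  private
    V : Set
    V = Fin (suc k)

    n : ℕ
    n = suc k

    ≤w : ∀ {x} → x ≤ n → x ≤ w
    ≤w x≤n = ≤-trans x≤n (<⇒≤ n<w)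

  Queue : List (V × V) → Memory → Set
  Queue h m = ∀ {i q x} → At zero h i (q , x) → m 4 i ≡ toℕ x × m 5 i ≡ q

  -- The measure counts the vertices still to be discovered, twice those still
  -- to leave the queue, and whether the parent of the head may still be skipped.
  record Searching (μ : ℕ) (m : Memory) : Set where
    field
      isInput  : IsInput adj m
      h        : List (V × V)
      hd       : ℕ
      done     : List V
      flag     : ℕ
      measure  : (n ∸ suc (length h)) + ((n ∸ hd) + (n ∸ hd) + flag) ≡ μ
      grown    : Grown zero Adj h
      queue    : Queue h m
      head≡    : m 6 0 ≡ hd
      tail≡    : m 7 0 ≡ suc (length h)
      scanned≡ : m 8 0 ≡ length done
      hd≤      : hd ≤ suc (length h)
      closed   : ∀ {i q x u} → At zero h i (q , x) → i < hd → Adj x u → u ∈ verts zero h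
      done⊆    : All (_∈ verts zero h) done
      -- A child of the current head has been scanned already, so a neighbour still to be scanned
      -- cannot be one.
      parents  : ∀ {p v} → (p , v) ∈ h →
                 Σ[ i ∈ ℕ ] Σ[ q ∈ ℕ ] At zero h i (q , p) × (i < hd ⊎ i ≡ hd × v ∈ done)
      -- With the flag at 0 the parent is behind the cursor; it cannot be met again, so the flag
      -- pays for its only occurrence.
      cursor   : ∀ {q x} → At zero h hd (q , x) →
                 Σ[ rem ∈ List V ] lookup adj x ≡ done ++ rem × (flag ≡ 0 → All (λ u → toℕ u ≢ q) rem)

  record Searched (m : Memory) : Set where
    field
      h        : List (V × V)
      grown    : Grown zero Adj h
      queue    : Queue h m
      tail≡    : m 7 0 ≡ suc (length h)
      complete : ∀ v → v ∈ verts zero h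

  length-verts : ∀ h → length (verts {n} zero h) ≡ suc (length h)
  length-verts []      = refl
  length-verts (e ∷ h) = cong suc (length-verts h)

  grown-length : ∀ {h} → Grown zero Adj h → suc (length h) ≤ n
  grown-length {h} g = subst (_≤ n) (length-verts h) (unique⇒length≤n (grown-unique zero Adj g))

  module _ {μ : ℕ} {m : Memory} (s : Searching μ m) where
    open Searching s
    open IsInput isInput

    private
      Next : Memory → Set
      Next m′ = Σ[ j ∈ ℕ ] j < μ × Searching j m′

    module _ {q : ℕ} {x : V} (a : At zero h hd (q , x)) where

      private
        hd≤h : hd ≤ length h
        hd≤h = At⇒≤ zero a

        h<n : length h < n
        h<n = grown-length grown

      current≡ : ⟦ current ⟧ m ≡ toℕ x
      current≡ = trans (cong (m 4) head≡) (proj₁ (queue a))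

      address≡ : ⟦ 1 ! current ⊕ scanned ⟧ m ≡ offset adj (toℕ x) + length done
      address≡ = cong₂ _+_ (trans (offsets _) (cong (offset adj) current≡)) scanned≡

      neighbour≡ : ∀ {u rem} → lookup adj x ≡ done ++ u ∷ rem → ⟦ neighbour ⟧ m ≡ toℕ u
      neighbour≡ eq = trans (neighbours _)
        (trans (cong (cells (map toℕ (concat (toList adj)))) address≡) (cells-concat toℕ adj x done eq))

      remaining≡ : ∀ {rem} → lookup adj x ≡ done ++ rem → ⟦ remaining ⟧ m ≡ length rem
      remaining≡ {rem} eq = begin
        ⟦ remaining ⟧ m
          ≡⟨ cong₂ _∸_ (trans (offsets _) (cong (offset adj) (trans (cong (_+ 1) current≡) (+-comm (toℕ x) 1)))) address≡ ⟩
        offset adj (suc (toℕ x)) ∸ (o + length done)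
          ≡⟨ cong (_∸ (o + length done)) (trans (offset-suc adj x) (cong (λ l → o + length l) eq)) ⟩
        o + length (done ++ rem) ∸ (o + length done)
          ≡⟨ [m+n]∸[m+o]≡n∸o o _ _ ⟩
        length (done ++ rem) ∸ length done
          ≡⟨ cong (_∸ length done) (length-++ done) ⟩
        length done + length rem ∸ length done
          ≡⟨ m+n∸m≡n (length done) _ ⟩
        length rem ∎
        where
        open ≡-Reasoning
        o = offset adj (toℕ x)

      scanned<n : ∀ {u rem} → lookup adj x ≡ done ++ u ∷ rem → length done < n
      scanned<n {u} {rem} eq = begin-strict
        length done                     <⟨ m<m+n (length done) (s≤s z≤n) ⟩
        length done + length (u ∷ rem)  ≡⟨ sym (trans (cong length eq) (length-++ done)) ⟩
        length (lookup adj x)           ≤⟨ unique⇒length≤n (unique x) ⟩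
        n                               ∎
        where open ≤-Reasoning

      scanned+1≡ : ∀ {u} → m 8 0 + 1 ≡ length (done ++ u ∷ [])
      scanned+1≡ = trans (cong (_+ 1) scanned≡) (sym (length-++ done))

      scanned+1≤w : ∀ {u rem} → lookup adj x ≡ done ++ u ∷ rem → m 8 0 + 1 ≤ w
      scanned+1≤w eq = subst (_≤ w) (sym (trans (cong (_+ 1) scanned≡) (+-comm _ 1))) (≤w (scanned<n eq))

      advance : lookup adj x ≡ done ++ [] → wp w (6 ! lit 0 ≔ head ⊕ lit 1 ⨟ 8 ! lit 0 ≔ lit 0) Next m
      advance eq = subst (_≤ w) (sym head+1≡) (≤w (≤-trans (s≤s hd≤h) h<n)) , z≤n , _ , smaller , record
        { isInput = record { size = size ; offsets = offsets ; neighbours = neighbours }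
        ; h = h ; hd = suc hd ; done = [] ; flag = 1 ; measure = refl
        ; grown = grown ; queue = queue
        ; head≡ = head+1≡ ; tail≡ = tail≡ ; scanned≡ = refl ; hd≤ = s≤s hd≤h
        ; closed = closed′ ; done⊆ = [] ; parents = parents′
        ; cursor = λ {_} {x′} _ → lookup adj x′ , refl , λ ()
        }
        where
        head+1≡ : m 6 0 + 1 ≡ suc hd
        head+1≡ = trans (+-comm (m 6 0) 1) (cong suc head≡)
        smaller : (n ∸ suc (length h)) + ((n ∸ suc hd) + (n ∸ suc hd) + 1) < μ
        smaller = subst (_ <_) measure (+-monoʳ-< (n ∸ suc (length h)) (twice< flag (∸-suc (≤-trans (s≤s hd≤h) h<n))))
        closed′ : ∀ {i q x u} → At zero h i (q , x) → i < suc hd → Adj x u → u ∈ verts zero h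
        closed′ b (s≤s i≤hd) xu with m≤n⇒m<n∨m≡n i≤hd
        ... | inj₁ i<hd = closed b i<hd xu
        ... | inj₂ refl with At-index zero a b
        ...   | refl with ∈-++⁻ done (subst (_ ∈_) eq (Equivalence.from (complete x _) xu))
        ...     | inj₁ u∈done = All.lookup done⊆ u∈done
        parents′ : ∀ {p v} → (p , v) ∈ h →
          Σ[ i ∈ ℕ ] Σ[ q ∈ ℕ ] At zero h i (q , p) × (i < suc hd ⊎ i ≡ suc hd × v ∈ [])
        parents′ e with parents e
        ... | i , q , b , inj₁ i<hd       = i , q , b , inj₁ (m<n⇒m<1+n i<hd)
        ... | i , q , b , inj₂ (refl , _) = i , q , b , inj₁ ≤-refl

      skip-parent : ∀ {u rem} → lookup adj x ≡ done ++ u ∷ rem →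
        (flag ≡ 0 → All (λ u → toℕ u ≢ q) (u ∷ rem)) → toℕ u ≡ q →
        wp w (8 ! lit 0 ≔ scanned ⊕ lit 1) Next m
      skip-parent {u} {rem} eq fresh refl = scanned+1≤w eq , _ , smaller , record
        { isInput = record { size = size ; offsets = offsets ; neighbours = neighbours }
        ; h = h ; hd = hd ; done = done ++ u ∷ [] ; flag = 0 ; measure = refl
        ; grown = grown ; queue = queue
        ; head≡ = head≡ ; tail≡ = tail≡ ; scanned≡ = scanned+1≡ ; hd≤ = hd≤
        ; closed = closed ; done⊆ = ++⁺ done⊆ (u∈ ∷ []) ; parents = parents′
        ; cursor = cursor′
        }
        where
        flag≢0 : 0 < flag
        flag≢0 = n≢0⇒n>0 λ { f≡0 → contradiction refl (All.head (fresh f≡0)) }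
        smaller : (n ∸ suc (length h)) + ((n ∸ hd) + (n ∸ hd) + 0) < μ
        smaller = subst (_ <_) measure (+-monoʳ-< (n ∸ suc (length h)) (+-monoʳ-< ((n ∸ hd) + (n ∸ hd)) flag≢0))
        u∈ : u ∈ verts zero h
        u∈ with At⇒edge zero a
        ... | inj₁ u≡n           = contradiction u≡n (<⇒≢ (toℕ<n u))
        ... | inj₂ (p , u≡p , e) with toℕ-injective u≡p
        ...   | refl = edge⇒parent∈ zero Adj grown e
        parents′ : ∀ {p v} → (p , v) ∈ h →
          Σ[ i ∈ ℕ ] Σ[ q ∈ ℕ ] At zero h i (q , p) × (i < hd ⊎ i ≡ hd × v ∈ done ++ u ∷ [])
        parents′ e with parents e
        ... | i , q , b , inj₁ i<hd       = i , q , b , inj₁ i<hd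
        ... | i , q , b , inj₂ (i≡hd , v∈) = i , q , b , inj₂ (i≡hd , ∈-++⁺ˡ v∈)
        cursor′ : ∀ {q′ x′} → At zero h hd (q′ , x′) → Σ[ rem ∈ List V ]
          lookup adj x′ ≡ (done ++ u ∷ []) ++ rem × (0 ≡ 0 → All (λ u → toℕ u ≢ q′) rem)
        cursor′ b with At-index zero a b
        ... | refl = rem , trans eq (sym (++-assoc done _ _)) , λ _ →
          All.map (λ u≢y y≡u → u≢y (sym (toℕ-injective y≡u)))
            (first-apart (unique-suffix done (subst Unique eq (unique x))))

      discover : ∀ {u rem} → lookup adj x ≡ done ++ u ∷ rem →
        (flag ≡ 0 → All (λ u → toℕ u ≢ q) (u ∷ rem)) → toℕ u ≢ q →
        wp w ((5 ! tail ≔ current ⨟ 4 ! tail ≔ neighbour ⨟ 7 ! lit 0 ≔ tail ⊕ lit 1) ⨟ 8 ! lit 0 ≔ scanned ⊕ lit 1) Next m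
      discover {u} {rem} eq fresh u≢q =
        subst (_≤ w) (sym current≡) (≤w (<⇒≤ (toℕ<n x))) ,
        subst (_≤ w) (sym (neighbour≡ eq)) (≤w (<⇒≤ (toℕ<n u))) ,
        subst (_≤ w) (sym tail+1≡) (≤w (grown-length grown′)) ,
        scanned+1≤w eq , _ , smaller , record
        { isInput = record { size = size ; offsets = offsets ; neighbours = neighbours }
        ; h = (x , u) ∷ h ; hd = hd ; done = done ++ u ∷ [] ; flag = flag ; measure = refl
        ; grown = grown′ ; queue = queue′
        ; head≡ = head≡ ; tail≡ = tail+1≡ ; scanned≡ = scanned+1≡ ; hd≤ = m≤n⇒m≤1+n hd≤
        ; closed = closed′ ; done⊆ = ++⁺ (All.map there done⊆) (here refl ∷ []) ; parents = parents′
        ; cursor = cursor′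
        }
        where
        x∈ : x ∈ verts zero h
        x∈ = At⇒∈ zero a
        xu : Adj x u
        xu = Equivalence.to (complete x u) (subst (u ∈_) (sym eq) (∈-++⁺ʳ done (here refl)))
        u∉done : u ∉ done
        u∉done u∈ = All.lookup (unique-prefix done (subst Unique eq (unique x)) u∈) (here refl) refl
        -- The reason why no visited marks are kept: if `u` were present, the edge to `x` would
        -- belong to the tree. The test excludes that `u` is the parent of `x`, and a child of `x`
        -- would be in `done`, whereas adjacency lists have no repetitions.
        u∉ : u ∉ verts zero h
        u∉ u∈ with adj⇒edge G zero acyclic grown x∈ u∈ xu
        ... | inj₂ e with edge⇒At zero h e
        ...   | _ , b = u≢q (proj₂ (At-functional zero Adj grown b a))
        u∉ u∈ | inj₁ e with parents e
        ... | i , q′ , b , inj₁ i<hd        = <-irrefl (proj₁ (At-functional zero Adj grown b a)) i<hd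
        ... | i , q′ , b , inj₂ (_ , u∈done) = u∉done u∈done
        grown′ : Grown zero Adj ((x , u) ∷ h)
        grown′ = add xu x∈ u∉ grown
        tail+1≡ : m 7 0 + 1 ≡ suc (suc (length h))
        tail+1≡ = trans (+-comm (m 7 0) 1) (cong suc tail≡)
        smaller : (n ∸ suc (suc (length h))) + ((n ∸ hd) + (n ∸ hd) + flag) < μ
        smaller = subst (_ <_) measure (+-monoˡ-< ((n ∸ hd) + (n ∸ hd) + flag)
          (≤-reflexive (sym (∸-suc (grown-length grown′)))))
        m′ : Memory
        m′ = m [ 5 , m 7 0 ↦ ⟦ current ⟧ m ] [ 4 , m 7 0 ↦ ⟦ neighbour ⟧ m ]
        queue′ : Queue ((x , u) ∷ h) m′
        queue′ last      = trans (write-same tail≡) (neighbour≡ eq) , trans (write-same tail≡) current≡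
        queue′ (older b) = trans (write-other tail≢) (proj₁ (queue b)) , trans (write-other tail≢) (proj₂ (queue b))
          where
          tail≢ : m 7 0 ≢ _
          tail≢ eq = <-irrefl (trans (sym eq) tail≡) (s≤s (At⇒≤ zero b))
        closed′ : ∀ {i q y v} → At zero ((x , u) ∷ h) i (q , y) → i < hd → Adj y v → v ∈ verts zero ((x , u) ∷ h)
        closed′ last      i<hd = contradiction (<-≤-trans i<hd hd≤h) (<-asym ≤-refl)
        closed′ (older b) i<hd yv = there (closed b i<hd yv)
        parents′ : ∀ {p v} → (p , v) ∈ (x , u) ∷ h →
          Σ[ i ∈ ℕ ] Σ[ q ∈ ℕ ] At zero ((x , u) ∷ h) i (q , p) × (i < hd ⊎ i ≡ hd × v ∈ done ++ u ∷ [])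
        parents′ (here refl) = hd , q , older a , inj₂ (refl , ∈-++⁺ʳ done (here refl))
        parents′ (there e) with parents e
        ... | i , q , b , inj₁ i<hd        = i , q , older b , inj₁ i<hd
        ... | i , q , b , inj₂ (i≡hd , v∈) = i , q , older b , inj₂ (i≡hd , ∈-++⁺ˡ v∈)
        cursor′ : ∀ {q′ x′} → At zero ((x , u) ∷ h) hd (q′ , x′) → Σ[ rem ∈ List V ]
          lookup adj x′ ≡ (done ++ u ∷ []) ++ rem × (flag ≡ 0 → All (λ u → toℕ u ≢ q′) rem)
        cursor′ b with At-index zero (older a) b
        ... | refl = rem , trans eq (sym (++-assoc done _ _)) , λ f≡0 → All.tail (fresh f≡0)

  search-step : ∀ {μ m} → Searching μ m → ⟦ tail ⊖ head ⟧ m ≢ 0 →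
                wp w bfs-body (λ m′ → Σ[ j ∈ ℕ ] j < μ × Searching j m′) m
  search-step {μ} {m} s nz with ≤⇒At zero h hd≤h
    where
    open Searching s
    hd≤h : hd ≤ length h
    hd≤h = s≤s⁻¹ (subst₂ _<_ head≡ tail≡ (m∸n≢0⇒n<m nz))
  ... | (q , x) , a with Searching.cursor s a
  ...   | [] , eq , _ = (λ r≢0 → contradiction (remaining≡ s a eq) r≢0) , λ _ → advance s a eq
  ...   | u ∷ rem , eq , fresh =
    (λ _ → (λ ne → discover s a eq fresh λ u≡q → ne (≡⇒≠-zero neighbour (5 ! head) {m} (trans (neighbour≡ s a eq) (trans u≡q (sym parent≡)))))
         , λ e → skip-parent s a eq fresh (trans (sym (neighbour≡ s a eq)) (trans (≠-zero⇒≡ neighbour (5 ! head) {m} e) parent≡)))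
    , λ r≡0 → contradiction (trans (sym (remaining≡ s a eq)) r≡0) λ ()
    where
    open Searching s
    parent≡ : m 5 (m 6 0) ≡ q
    parent≡ = trans (cong (m 5) head≡) (proj₂ (queue a))

  bfs-time : ℕ
  -- Initially n - 1 vertices are undiscovered, n are still to leave the queue and count twice, and
  -- the flag is 1; this adds up to 3n.
  bfs-time = duration bfs-init + loop-time (tail ⊖ head) bfs-body (n + (n + n))

  bfs-runs : ∀ {m} → IsInput adj m → Runs w bfs m bfs-time Searched
  bfs-runs {m} inp = runs-mono w ≤-refl finish (runs-seq w (wp-sound w bfs-init start)
      (while-rule w Searching search-step (n + (n + n)) _ ≤-refl))
    where
    open IsInput inp
    start : wp w bfs-init (Searching (n + (n + n))) m
    start = z≤n , subst (_≤ w) (sym size) (≤w ≤-refl) , z≤n , ≤-trans (s≤s z≤n) n<w , z≤n , record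
      { isInput = record { size = size ; offsets = offsets ; neighbours = neighbours }
      ; h = [] ; hd = 0 ; done = [] ; flag = 1
      ; measure = trans (cong ((n ∸ 1) +_) (+-comm (n + n) 1)) (+-suc (n ∸ 1) (n + n))
      ; grown = []
      ; queue = λ { first → refl , size }
      ; head≡ = refl ; tail≡ = refl ; scanned≡ = refl ; hd≤ = z≤n
      ; closed = λ _ () ; done⊆ = [] ; parents = λ ()
      ; cursor = λ {_} {x} _ → lookup adj x , refl , λ ()
      }
    finish : ∀ {m′} → Σ[ j ∈ ℕ ] Searching j m′ × ⟦ tail ⊖ head ⟧ m′ ≡ 0 → Searched m′
    finish {m′} (_ , s , z) = record
      { h = h ; grown = grown ; queue = queue ; tail≡ = tail≡
      ; complete = λ v → reach (connected zero v) (root∈ h) }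
      where
      open Searching s
      root∈ : ∀ h → zero ∈ verts zero h
      root∈ []      = here refl
      root∈ (e ∷ h) = there (root∈ h)
      all< : ∀ {i q x} → At zero h i (q , x) → i < hd
      all< a = ≤-<-trans (At⇒≤ zero a) (subst₂ _≤_ tail≡ head≡ (m∸n≡0⇒m≤n z))
      -- Once the queue is exhausted, the discovered set is closed under adjacency and contains
      -- every walk that starts at the root.
      reach : ∀ {u v} → Star Adj u v → u ∈ verts zero h → v ∈ verts zero h
      reach ε         u∈ = u∈
      reach (ux ◅ xv) u∈ with ∈⇒At zero h u∈
      ... | _ , _ , a = reach xv (closed a (all< a) ux)

-- Dynamic programming

data Tree (n : ℕ) : Set where
  leaf  : Fin n → Tree n
  -- The root of the second tree becomes a child of the root of the first.
  graft : Tree n → Tree n → Tree n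

weight : ∀ {n} → Tree n → (Fin n → Bool) → ℕ
weight (leaf v)    L = ⟨ L v ⟩
weight (graft t u) L = weight t L + weight u L

module _ {S : Set} (ini : Bool → S) (join : S → S → Maybe S) where

  -- The algebra of states is a parameter because it occurs twice: with exact numbers, to be
  -- compared with domination, and with codes, on which the machine works. A labelling that the
  -- constraints rule out has the state `nothing`.
  state : ∀ {n} → Tree n → (Fin n → Bool) → Maybe S
  state (leaf v)    L = just (ini (L v))
  state (graft t u) L = state t L >>= λ a → state u L >>= join a

  graft⁻ : ∀ {n} (t u : Tree n) L {s} → state (graft t u) L ≡ just s →
           Σ[ a ∈ S ] Σ[ b ∈ S ] state t L ≡ just a × state u L ≡ just b × join a b ≡ just s
  graft⁻ t u L eq with state t L | state u L
  ... | just a | just b = a , b , refl , refl , eq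

  graft⁺ : ∀ {n} (t u : Tree n) L {a b s} → state t L ≡ just a → state u L ≡ just b →
           join a b ≡ just s → state (graft t u) L ≡ just s
  graft⁺ t u L ta ub ab rewrite ta | ub = ab

-- The passage from exact numbers to codes: it is enough that `f` commutes with a single graft.
state-map : ∀ {S R : Set} (ini : Bool → S) (join : S → S → Maybe S) (join′ : R → R → Maybe R) (f : S → R) →
            (∀ a b → join′ (f a) (f b) ≡ Maybe.map f (join a b)) →
            ∀ {n} (t : Tree n) L → state (λ b → f (ini b)) join′ t L ≡ Maybe.map f (state ini join t L)
state-map ini join join′ f hom (leaf v)    L = refl
state-map ini join join′ f hom (graft t u) L
  rewrite state-map ini join join′ f hom t L | state-map ini join join′ f hom u L
  with state ini join t L | state ini join u L
... | nothing | _       = refl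
... | just a  | nothing = refl
... | just a  | just b  = hom a b

pairs : ∀ K → List (Fin K × Fin K)
pairs K = cartesianProduct (allFin K) (allFin K)

-- ∞ will be n + 1, which exceeds every weight.
module Optimise {K : ℕ} (ini : Bool → Fin K) (join : Fin K → Fin K → Maybe (Fin K))
                (∞ : ℕ) where

  private
    S : Set
    S = Fin K

  Entry : Set
  Entry = ℕ × Maybe (S × S)

  put : S → ℕ → S × S → (S → Entry) → S → Entry
  put c x ab h s with c ≟ s | x <? proj₁ (h c)
  ... | yes _ | yes _ = x , just ab
  ... | yes _ | no  _ = h s
  ... | no  _ | _     = h s

  relax : (f g : S → ℕ) → S × S → (S → Entry) → S → Entry
  relax f g (a , b) h with join a b
  ... | nothing = h
  ... | just c  = put c (f a + g b) (a , b) h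

  sweep : (f g : S → ℕ) → List (S × S) → (S → Entry) → S → Entry
  sweep f g []       h = h
  sweep f g (ab ∷ l) h = sweep f g l (relax f g ab h)

  fresh : S → Entry
  fresh s = ∞ , nothing

  optimum : (f g : S → ℕ) → S → Entry
  optimum f g = sweep f g (pairs K) fresh

  leaf-value : S → ℕ
  leaf-value s = if does (s ≟ ini true) then 1 else if does (s ≟ ini false) then 0 else ∞

  value : ∀ {n} → Tree n → S → ℕ
  value (leaf v)    s = leaf-value s
  value (graft t u) s = proj₁ (optimum (value t) (value u) s)

  choice : ∀ {n} → Tree n → Tree n → S → Maybe (S × S)
  choice t u s = proj₂ (optimum (value t) (value u) s)

  module _ (f g : S → ℕ) where

    put-≤ : ∀ c x ab h s → proj₁ (put c x ab h s) ≤ proj₁ (h s)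
    put-≤ c x ab h s with c ≟ s | x <? proj₁ (h c)
    ... | yes refl | yes lt = <⇒≤ lt
    ... | yes _    | no  _  = ≤-refl
    ... | no  _    | _      = ≤-refl

    put-hit : ∀ c x ab h → proj₁ (put c x ab h c) ≤ x
    put-hit c x ab h with c ≟ c | x <? proj₁ (h c)
    ... | yes _ | yes _ = ≤-refl
    ... | yes _ | no ≮  = ≮⇒≥ ≮
    ... | no ≢  | _     = contradiction refl ≢

    relax-≤ : ∀ ab h s → proj₁ (relax f g ab h s) ≤ proj₁ (h s)
    relax-≤ (a , b) h s with join a b
    ... | nothing = ≤-refl
    ... | just c  = put-≤ c _ _ h s

    relax-hit : ∀ {a b c} h → join a b ≡ just c → proj₁ (relax f g (a , b) h c) ≤ f a + g b
    relax-hit {a} {b} {c} h eq rewrite eq = put-hit c _ _ h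

    sweep-≤ : ∀ l h s → proj₁ (sweep f g l h s) ≤ proj₁ (h s)
    sweep-≤ []       h s = ≤-refl
    sweep-≤ (ab ∷ l) h s = ≤-trans (sweep-≤ l _ s) (relax-≤ ab h s)

    sweep-hit : ∀ {a b c} l h → (a , b) ∈ l → join a b ≡ just c → proj₁ (sweep f g l h c) ≤ f a + g b
    sweep-hit (_ ∷ l) h (here refl) eq = ≤-trans (sweep-≤ l _ _) (relax-hit h eq)
    sweep-hit (_ ∷ l) h (there ab∈) eq = sweep-hit l _ ab∈ eq

    -- `sound` makes a recorded choice attain its weight. `found` is needed for tracing back, which
    -- must never reach a finite entry without a choice.
    record Justified (h : S → Entry) : Set where
      field
        sound : ∀ s {a b} → proj₂ (h s) ≡ just (a , b) → join a b ≡ just s × proj₁ (h s) ≡ f a + g b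
        found : ∀ s → proj₁ (h s) < ∞ → Σ[ a ∈ S ] Σ[ b ∈ S ] proj₂ (h s) ≡ just (a , b)
    open Justified

    relax-justified : ∀ ab h → Justified h → Justified (relax f g ab h)
    relax-justified (a , b) h j with join a b in eq
    ... | nothing = j
    ... | just c  = record { sound = sound′ ; found = found′ }
      where
      sound′ : ∀ s {a′ b′} → proj₂ (put c (f a + g b) (a , b) h s) ≡ just (a′ , b′) →
               join a′ b′ ≡ just s × proj₁ (put c (f a + g b) (a , b) h s) ≡ f a′ + g b′
      sound′ s e with c ≟ s | f a + g b <? proj₁ (h c)
      sound′ s refl | yes refl | yes _ = eq , refl
      ... | yes _ | no _ = sound j s e
      ... | no _  | _    = sound j s e
      found′ : ∀ s → proj₁ (put c (f a + g b) (a , b) h s) < ∞ →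
               Σ[ a′ ∈ S ] Σ[ b′ ∈ S ] proj₂ (put c (f a + g b) (a , b) h s) ≡ just (a′ , b′)
      found′ s lt with c ≟ s | f a + g b <? proj₁ (h c)
      ... | yes _ | yes _ = a , b , refl
      ... | yes _ | no _  = found j s lt
      ... | no _  | _     = found j s lt

    sweep-justified : ∀ l h → Justified h → Justified (sweep f g l h)
    sweep-justified []       h j = j
    sweep-justified (ab ∷ l) h j = sweep-justified l _ (relax-justified ab h j)

    optimum-justified : Justified (optimum f g)
    optimum-justified = sweep-justified (pairs K) fresh record
      { sound = λ s () ; found = λ s lt → contradiction lt (<-irrefl refl) }

    optimum-≤ : ∀ {a b c} → join a b ≡ just c → proj₁ (optimum f g c) ≤ f a + g b
    optimum-≤ {a} {b} = sweep-hit (pairs K) fresh (∈-cartesianProduct⁺ (∈-allFin a) (∈-allFin b))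

  open Justified

  -- Following the recorded choices down from root state `s` leads to the labels of `L`. It is a
  -- relation because an entry need not have a choice.
  Traced : ∀ {n} → Tree n → S → (Fin n → Bool) → Set
  Traced (leaf v)    s L = s ≡ ini (L v)
  Traced (graft t u) s L =
    Σ[ a ∈ S ] Σ[ b ∈ S ] choice t u s ≡ just (a , b) × Traced t a L × Traced u b L

  module _ (ini-injective : ini true ≢ ini false) where

    leaf-value-ini : ∀ b → leaf-value (ini b) ≡ ⟨ b ⟩
    leaf-value-ini true with ini true ≟ ini true
    ... | yes _ = refl
    ... | no ≢  = contradiction refl ≢
    leaf-value-ini false with ini false ≟ ini true | ini false ≟ ini false
    ... | yes e | _     = contradiction (sym e) ini-injective
    ... | no _  | yes _ = refl
    ... | no _  | no ≢  = contradiction refl ≢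

    value-≤ : ∀ {n} (t : Tree n) L {s} → state ini join t L ≡ just s → value t s ≤ weight t L
    value-≤ (leaf v)    L refl = ≤-reflexive (leaf-value-ini (L v))
    value-≤ (graft t u) L eq with graft⁻ ini join t u L eq
    ... | a , b , ta , ub , ab =
      ≤-trans (optimum-≤ (value t) (value u) ab) (+-mono-≤ (value-≤ t L ta) (value-≤ u L ub))

    -- The other half of optimality: traced labellings attain the lower bound of `value-≤`.
    traced : ∀ {n} (t : Tree n) L {s} → Traced t s L →
             state ini join t L ≡ just s × weight t L ≡ value t s
    traced (leaf v)    L refl = refl , sym (leaf-value-ini (L v))
    traced (graft t u) L (a , b , ch , ta , ub)
      with sound (optimum-justified (value t) (value u)) _ ch | traced t L ta | traced u L ub
    ... | ab , eq | st , wt | su , wu = graft⁺ ini join t u L st su ab , trans (cong₂ _+_ wt wu) (sym eq)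

    leaf-value<∞ : ∀ s → leaf-value s < ∞ → Σ[ b ∈ Bool ] s ≡ ini b
    leaf-value<∞ s lt with s ≟ ini true | s ≟ ini false
    ... | yes e | _     = true , e
    ... | no _  | yes e = false , e
    ... | no _  | no _  = contradiction lt (<-irrefl refl)

module _ {n : ℕ} where

  -- The head of the list is the most recent graft. The entry of a grafted child is left as it was,
  -- since tracing back returns to it.
  forest : List (Fin n × Fin n) → Fin n → Tree n
  forest []            x = leaf x
  forest ((p , v) ∷ r) x with x ≟ p
  ... | yes _ = graft (forest r p) (forest r v)
  ... | no  _ = forest r x

  forest-parent : ∀ p v r → forest ((p , v) ∷ r) p ≡ graft (forest r p) (forest r v)
  forest-parent p v r with p ≟ p
  ... | yes _ = refl
  ... | no ≢  = contradiction refl ≢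

  forest-other : ∀ {p v x} r → x ≢ p → forest ((p , v) ∷ r) x ≡ forest r x
  forest-other {p} {v} {x} r x≢p with x ≟ p
  ... | yes e = contradiction e x≢p
  ... | no _  = refl

-- The dynamic program on the machine

-- Array 10 holds the tables of all vertices, array 11 the table under
-- construction, and arrays 12 and 13 the choices made at the graft of each
-- vertex; the entry of vertex v and state s is at position K v + s. Array 3
-- holds the states found when tracing the choices back.
module Program {K : ℕ} (ini : Bool → Fin K) (join : Fin K → Fin K → Maybe (Fin K))
               (accept : Fin K → Bool) where

  index child parent ∞ₑ : Expr
  index  = 9 ! lit 0
  child  = 4 ! index
  parent = 5 ! index
  ∞ₑ     = #n ⊕ lit 1

  slot : Expr → Fin K → Expr
  slot e s = times K e ⊕ lit (toℕ s)

  leafₑ : Fin K → Expr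
  leafₑ s = if does (s ≟ ini true) then lit 1 else if does (s ≟ ini false) then lit 0 else ∞ₑ

  init-body init-all : Stmt
  init-body = each (fill 10 (slot index) leafₑ) (allFin K) ⨟ 9 ! lit 0 ≔ index ⊕ lit 1
  init-all  = 9 ! lit 0 ≔ lit 0 ⨟ while (#n ⊖ index) init-body

  -- Which states are compatible is settled while the program is written; only the comparison of
  -- weights is left to the machine.
  relaxₚ : Fin K × Fin K → Stmt
  relaxₚ (a , b) with join a b
  ... | nothing = skip
  ... | just c  = cond (11 ! lit (toℕ c) ⊖ (10 ! slot parent a ⊕ 10 ! slot child b))
    ( 11 ! lit (toℕ c) ≔ 10 ! slot parent a ⊕ 10 ! slot child b
    ⨟ 12 ! slot child c ≔ lit (toℕ a) ⨟ 13 ! slot child c ≔ lit (toℕ b))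
    skip

  reset save : Fin K → Stmt
  reset = fill 11 (λ s → lit (toℕ s)) (λ _ → ∞ₑ)
  save  = fill 10 (slot parent) (λ s → 11 ! lit (toℕ s))

  graft-body graft-all : Stmt
  -- The index stands one above the next entry to graft, so the loop ends at 1 and leaves out the
  -- root. The parent's new table is built apart and saved last, because every relaxation still
  -- reads the old one.
  graft-body = 9 ! lit 0 ≔ index ⊖ lit 1 ⨟ each reset (allFin K) ⨟ each relaxₚ (pairs K) ⨟ each save (allFin K)
  graft-all  = 9 ! lit 0 ≔ tail ⨟ while (index ⊖ lit 1) graft-body

  selectₚ : Fin K → Stmt
  selectₚ s = if accept s
    then cond (11 ! lit 0 ⊖ 10 ! slot (lit 0) s)
      (11 ! lit 0 ≔ 10 ! slot (lit 0) s ⨟ 3 ! lit 0 ≔ lit (toℕ s)) skip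
    else skip

  select : Stmt
  select = 11 ! lit 0 ≔ ∞ₑ ⨟ each selectₚ (allFin K)

  trace-body trace-all : Stmt
  -- The child comes first: both reads are addressed by the state of the parent, which the second
  -- assignment replaces by its state before this graft.
  trace-body = 3 ! child ≔ 13 ! (times K child ⊕ 3 ! parent)
             ⨟ 3 ! parent ≔ 12 ! (times K child ⊕ 3 ! parent)
             ⨟ 9 ! lit 0 ≔ index ⊕ lit 1
  trace-all  = 9 ! lit 0 ≔ lit 1 ⨟ while (tail ⊖ index) trace-body

  program : Stmt
  program = init-all ⨟ bfs ⨟ graft-all ⨟ select ⨟ trace-all

  Accepted : ∀ {k} → List (Fin (suc k) × Fin (suc k)) → (Fin (suc k) → Bool) → Set
  Accepted full L = Σ[ s ∈ Fin K ] state ini join (forest full zero) L ≡ just s × accept s ≡ true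

  slot-value : ∀ e s m → ⟦ slot e s ⟧ m ≡ K * ⟦ e ⟧ m + toℕ s
  slot-value e s m = cong (_+ toℕ s) (⟦times⟧ K e m)

  slot-injective : ∀ {n} {x y : Fin n} {s t : Fin K} →
                   K * toℕ x + toℕ s ≡ K * toℕ y + toℕ t → x ≡ y × s ≡ t
  slot-injective {x = x} {y} {s} {t} eq = combine-injective x s y t
    (toℕ-injective (trans (toℕ-combine x s) (trans eq (sym (toℕ-combine y t)))))

  keeps-init : ∀ a → (9 ≡ᵇ a) ≡ false → (10 ≡ᵇ a) ≡ false → Keeps a init-all
  keeps-init a k₉ k₁₀ = k₉ , Keeps-each a (fill 10 (slot index) leafₑ) (λ _ → k₁₀) (allFin K) , k₉

  keeps-relax : ∀ a → (11 ≡ᵇ a) ≡ false → (12 ≡ᵇ a) ≡ false → (13 ≡ᵇ a) ≡ false → ∀ ab → Keeps a (relaxₚ ab)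
  keeps-relax a k₁₁ k₁₂ k₁₃ (x , y) with join x y
  ... | nothing = tt
  ... | just c  = (k₁₁ , k₁₂ , k₁₃) , tt

  keeps-select : ∀ a → (3 ≡ᵇ a) ≡ false → (11 ≡ᵇ a) ≡ false → Keeps a select
  keeps-select a k₃ k₁₁ = k₁₁ , Keeps-each a selectₚ keep (allFin K)
    where
    keep : ∀ s → Keeps a (selectₚ s)
    keep s with accept s
    ... | true  = (k₁₁ , k₃) , tt
    ... | false = tt

module _ {n : ℕ} where

  -- `r ʳ++ h` is a zipper: the pairs of `r` were discovered after those of `h`, so `h` is the tree
  -- at an earlier moment of the search.
  grown-suffix : ∀ {root : Fin n} {Adj} r {h} → Grown root Adj (r ʳ++ h) → Grown root Adj h
  grown-suffix []      g = g
  grown-suffix (e ∷ r) g with grown-suffix r g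
  ... | add _ _ _ g′ = g′

  child-fresh : ∀ {root : Fin n} {Adj} r {h p v} → Grown root Adj (r ʳ++ h) → (p , v) ∈ r → v ∉ verts root h
  child-fresh (_ ∷ r) g (here refl) with grown-suffix r g
  ... | add _ _ v∉ _ = v∉
  child-fresh (_ ∷ r) g (there e)   = λ v∈ → child-fresh r g e (there v∈)

  At-ʳ++ : ∀ {root : Fin n} r {h i x} → At root h i x → At root (r ʳ++ h) i x
  At-ʳ++ []      a = a
  At-ʳ++ (e ∷ r) a = At-ʳ++ r (older a)

-- Correctness of the passes over the tables

module Correct {K k : ℕ} (ini : Bool → Fin K) (join : Fin K → Fin K → Maybe (Fin K))
               (accept : Fin K → Bool) (w : ℕ) (n<w : suc k < w) (K≤w : K ≤ w) where
  open Program ini join accept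

  private
    V S : Set
    V = Fin (suc k)
    S = Fin K

    n : ℕ
    n = suc k

  open Optimise ini join (suc n)

  state≤w : ∀ (s : S) → toℕ s ≤ w
  state≤w s = ≤-trans (<⇒≤ (toℕ<n s)) K≤w

  Tables : (V → Tree n) → Memory → Set
  Tables F m = ∀ x s → m 10 (K * toℕ x + toℕ s) ≡ value (F x) s

  leaf-value-≤ : ∀ s → leaf-value s ≤ suc n
  leaf-value-≤ s with does (s ≟ ini true) | does (s ≟ ini false)
  ... | true  | _     = s≤s z≤n
  ... | false | true  = z≤n
  ... | false | false = ≤-refl

  value-≤∞ : ∀ (t : Tree n) s → value t s ≤ suc n
  value-≤∞ (leaf v)    s = leaf-value-≤ s
  value-≤∞ (graft t u) s = sweep-≤ (value t) (value u) (pairs K) fresh s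

  ⟦leafₑ⟧ : ∀ s {m} → m 0 0 ≡ n → ⟦ leafₑ s ⟧ m ≡ leaf-value s
  ⟦leafₑ⟧ s {m} size with does (s ≟ ini true) | does (s ≟ ini false)
  ... | true  | _     = refl
  ... | false | true  = refl
  ... | false | false = trans (cong (_+ 1) size) (+-comm n 1)

  record Initialising (μ : ℕ) (m : Memory) : Set where
    field
      i       : ℕ
      measure : n ∸ i ≡ μ
      i≤n     : i ≤ n
      index≡  : m 9 0 ≡ i
      size    : m 0 0 ≡ n
      tables  : ∀ (x : V) s → toℕ x < i → m 10 (K * toℕ x + toℕ s) ≡ leaf-value s

  init-step : ∀ {μ m} → Initialising μ m → ⟦ #n ⊖ index ⟧ m ≢ 0 →
              wp w init-body (λ m′ → Σ[ j ∈ ℕ ] j < μ × Initialising j m′) m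
  init-step {μ} {m} I nz = wp-mono w (each (fill 10 (slot index) leafₑ) (allFin K)) next
    (wp-frame w (each (fill 10 (slot index) leafₑ) (allFin K))
      (wp-fill w 10 (slot index) leafₑ m (λ s → K * i + toℕ s) leaf-value
        (λ {s} {t} eq → toℕ-injective (+-cancelˡ-≡ (K * i) (toℕ s) (toℕ t) eq))
        (λ s → ≤-trans (leaf-value-≤ s) n<w)
        (λ {m′} same s →
          trans (slot-value index s m′) (cong (λ j → K * j + toℕ s) (trans (same 9 refl 0) index≡)) ,
          ⟦leafₑ⟧ s (trans (same 0 refl 0) size))
        (allFin K)))
    where
    open Initialising I
    i<n : i < n
    i<n = subst₂ _<_ index≡ size (m∸n≢0⇒n<m nz)
    x₀ : V
    x₀ = fromℕ< i<n
    next : ∀ {m′} → ((∀ {s} → s ∈ allFin K → m′ 10 (K * i + toℕ s) ≡ leaf-value s) ×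
             (∀ j → m′ 10 j ≡ m 10 j ⊎ Σ[ s ∈ S ] K * i + toℕ s ≡ j × m′ 10 j ≡ leaf-value s)) ×
             (∀ a → Keeps a (each (fill 10 (slot index) leafₑ) (allFin K)) → ∀ j → m′ a j ≡ m a j) →
           wp w (9 ! lit 0 ≔ index ⊕ lit 1) (λ m′ → Σ[ j ∈ ℕ ] j < μ × Initialising j m′) m′
    next {m′} ((hit , rest) , same) = subst (_≤ w) (sym index+1≡) (≤-trans i<n (<⇒≤ n<w)) , n ∸ suc i ,
      subst (_ <_) measure (≤-reflexive (sym (∸-suc i<n))) , record
      { i = suc i ; measure = refl ; i≤n = i<n ; index≡ = index+1≡
      ; size = trans (same 0 (keep 0 refl) 0) size
      ; tables = tables′ }
      where
      keep : ∀ a → (10 ≡ᵇ a) ≡ false → Keeps a (each (fill 10 (slot index) leafₑ) (allFin K))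
      keep a k = Keeps-each a (fill 10 (slot index) leafₑ) (λ _ → k) (allFin K)
      index+1≡ : m′ 9 0 + 1 ≡ suc i
      index+1≡ = trans (+-comm _ 1) (cong suc (trans (same 9 (keep 9 refl) 0) index≡))
      tables′ : ∀ (x : V) s → toℕ x < suc i → m′ 10 (K * toℕ x + toℕ s) ≡ leaf-value s
      tables′ x s x<1+i with m≤n⇒m<n∨m≡n (s≤s⁻¹ x<1+i)
      ... | inj₂ x≡i rewrite x≡i = hit (∈-allFin s)
      ... | inj₁ x<i with rest (K * toℕ x + toℕ s)
      ...   | inj₁ eq = trans eq (tables x s x<i)
      ...   | inj₂ (t , eq , _) = contradiction (proj₁ (slot-injective {x = x₀} {x} {t} {s}
              (trans (cong (λ j → K * j + toℕ t) (toℕ-fromℕ< i<n)) eq)))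
              λ { refl → <-irrefl (toℕ-fromℕ< i<n) x<i }

  init-time : ℕ
  init-time = duration (9 ! lit 0 ≔ lit 0) + loop-time (#n ⊖ index) init-body n

  init-runs : ∀ {m} → m 0 0 ≡ n → Runs w init-all m init-time (Tables leaf)
  init-runs {m} size₀ = runs-mono w ≤-refl finish (runs-seq w {Q = Initialising n} (wp-sound w (9 ! lit 0 ≔ lit 0) (z≤n , record
      { i = 0 ; measure = refl ; i≤n = z≤n ; index≡ = refl ; size = size₀ ; tables = λ _ _ () }))
    (while-rule w Initialising init-step n n ≤-refl))
    where
    finish : ∀ {m′} → Σ[ j ∈ ℕ ] Initialising j m′ × ⟦ #n ⊖ index ⟧ m′ ≡ 0 → Tables leaf m′
    finish (_ , I , z) x s = tables x s (<-≤-trans (toℕ<n x) (subst₂ _≤_ size index≡ (m∸n≡0⇒m≤n z)))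
      where open Initialising I

  module _ (f g : S → ℕ) (p v : V) (m₀ : Memory) where

    -- Under this invariant the unrolled relaxations simulate `sweep`. `others` protects the choices
    -- of previous grafts, which lie in the rows of other vertices.
    record Relaxing (h : S → Entry) (m : Memory) : Set where
      field
        bounded : ∀ s → proj₁ (h s) ≤ suc n
        scratch : ∀ s → m 11 (toℕ s) ≡ proj₁ (h s)
        choices : ∀ s {a b} → proj₂ (h s) ≡ just (a , b) →
                  m 12 (K * toℕ v + toℕ s) ≡ toℕ a × m 13 (K * toℕ v + toℕ s) ≡ toℕ b
        ftable  : ∀ s → m 10 (K * toℕ p + toℕ s) ≡ f s
        gtable  : ∀ s → m 10 (K * toℕ v + toℕ s) ≡ g s
        child≡  : m 4 (m 9 0) ≡ toℕ v
        parent≡ : m 5 (m 9 0) ≡ toℕ p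
        others  : ∀ i → (∀ (s : S) → K * toℕ v + toℕ s ≢ i) → m 12 i ≡ m₀ 12 i × m 13 i ≡ m₀ 13 i

    relax-step : ∀ ab h {m} → Relaxing h m → wp w (relaxₚ ab) (Relaxing (relax f g ab h)) m
    relax-step (a , b) h {m} R with join a b
    ... | nothing = R
    ... | just c  =
      -- A sum with infinite terms can reach 2n + 2, but a sum is stored only if it beats an entry
      -- of at most n + 1, which fits into a word.
      (λ nz → subst (_≤ w) (sym sum≡) (≤-trans (<⇒≤ (<-≤-trans (smaller nz) (bounded c))) n<w) ,
              state≤w a , state≤w b , record
        { bounded = λ s → ≤-trans (put-≤ f g c x (a , b) h s) (bounded s)
        ; scratch = scratch′ (smaller nz)
        ; choices = choices′ (smaller nz)
        ; ftable  = ftable ; gtable = gtable ; child≡ = child≡ ; parent≡ = parent≡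
        ; others  = λ i out → let ne₁ = λ eq → out c (trans (sym addr₁) eq) ; ne₂ = λ eq → out c (trans (sym addr₂) eq)
                    in trans (write-other ne₁) (proj₁ (others i out)) , trans (write-other ne₂) (proj₂ (others i out))
        }) ,
      (λ z → record
        { bounded = λ s → ≤-trans (put-≤ f g c x (a , b) h s) (bounded s)
        ; scratch = λ s → trans (scratch s) (cong proj₁ (sym (kept z s)))
        ; choices = λ s e → choices s (trans (cong proj₂ (sym (kept z s))) e)
        ; ftable = ftable ; gtable = gtable ; child≡ = child≡ ; parent≡ = parent≡ ; others = others })
      where
      open Relaxing R
      x : ℕ
      x = f a + g b
      sum≡ : ⟦ 10 ! slot parent a ⊕ 10 ! slot child b ⟧ m ≡ x
      sum≡ = cong₂ _+_
        (trans (cong (m 10) (trans (slot-value parent a m) (cong (λ j → K * j + toℕ a) parent≡))) (ftable a))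
        (trans (cong (m 10) (trans (slot-value child b m) (cong (λ j → K * j + toℕ b) child≡))) (gtable b))
      m₁ m₂ : Memory
      m₁ = m [ 11 , toℕ c ↦ ⟦ 10 ! slot parent a ⊕ 10 ! slot child b ⟧ m ]
      m₂ = m₁ [ 12 , ⟦ slot child c ⟧ m₁ ↦ toℕ a ]
      addr₁ : ⟦ slot child c ⟧ m₁ ≡ K * toℕ v + toℕ c
      addr₁ = trans (slot-value child c m₁) (cong (λ j → K * j + toℕ c) child≡)
      addr₂ : ⟦ slot child c ⟧ m₂ ≡ K * toℕ v + toℕ c
      addr₂ = trans (slot-value child c m₂) (cong (λ j → K * j + toℕ c) child≡)
      smaller : ⟦ 11 ! lit (toℕ c) ⊖ (10 ! slot parent a ⊕ 10 ! slot child b) ⟧ m ≢ 0 → x < proj₁ (h c)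
      smaller nz = subst₂ _<_ sum≡ (scratch c) (m∸n≢0⇒n<m nz)
      kept : ⟦ 11 ! lit (toℕ c) ⊖ (10 ! slot parent a ⊕ 10 ! slot child b) ⟧ m ≡ 0 →
             ∀ s → put c x (a , b) h s ≡ h s
      kept z s with c ≟ s | x <? proj₁ (h c)
      ... | yes _ | yes lt = contradiction lt (≤⇒≯ (subst₂ _≤_ (scratch c) sum≡ (m∸n≡0⇒m≤n z)))
      ... | yes _ | no _   = refl
      ... | no _  | _      = refl
      m₃ : Memory
      m₃ = m₂ [ 13 , ⟦ slot child c ⟧ m₂ ↦ toℕ b ]
      scratch′ : x < proj₁ (h c) → ∀ s → m₃ 11 (toℕ s) ≡ proj₁ (put c x (a , b) h s)
      scratch′ lt s with c ≟ s | x <? proj₁ (h c)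
      ... | yes refl | yes _ = trans (write-same {toℕ c} refl) sum≡
      ... | yes refl | no ≮  = contradiction lt ≮
      ... | no c≢s   | _     = trans (write-other λ eq → c≢s (toℕ-injective eq)) (scratch s)
      choices′ : x < proj₁ (h c) → ∀ s {a′ b′} → proj₂ (put c x (a , b) h s) ≡ just (a′ , b′) →
                 m₃ 12 (K * toℕ v + toℕ s) ≡ toℕ a′ × m₃ 13 (K * toℕ v + toℕ s) ≡ toℕ b′
      choices′ lt s e with c ≟ s | x <? proj₁ (h c)
      choices′ lt s refl | yes refl | yes _ = write-same addr₁ , write-same addr₂
      ... | yes refl | no ≮ = contradiction lt ≮
      ... | no c≢s   | _    =
        trans (write-other λ eq → c≢s (proj₂ (slot-injective {x = v} {v} (trans (sym addr₁) eq)))) (proj₁ (choices s e)) ,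
        trans (write-other λ eq → c≢s (proj₂ (slot-injective {x = v} {v} (trans (sym addr₂) eq)))) (proj₂ (choices s e))

    wp-sweep : ∀ l h {m} → Relaxing h m → wp w (each relaxₚ l) (Relaxing (sweep f g l h)) m
    wp-sweep []       h R = R
    wp-sweep (ab ∷ l) h R = wp-mono w (relaxₚ ab) (wp-sweep l _) (relax-step ab h R)

  -- The row of `v` is written only in the pass that grafts `v`, so it keeps describing the forests
  -- of that moment.
  Chosen : List (V × V) → Memory → Set
  Chosen []            m = ⊤
  Chosen ((p , v) ∷ r) m =
    (∀ s {a b} → choice (forest r p) (forest r v) s ≡ just (a , b) →
       m 12 (K * toℕ v + toℕ s) ≡ toℕ a × m 13 (K * toℕ v + toℕ s) ≡ toℕ b) × Chosen r m

  chosen-resp : ∀ r {m m′} →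
    (∀ {p v} → (p , v) ∈ r → ∀ (s : S) → m′ 12 (K * toℕ v + toℕ s) ≡ m 12 (K * toℕ v + toℕ s) ×
      m′ 13 (K * toℕ v + toℕ s) ≡ m 13 (K * toℕ v + toℕ s)) →
    Chosen r m → Chosen r m′
  chosen-resp []            eq ch       = tt
  chosen-resp ((p , v) ∷ r) eq (c , ch) =
    (λ s e → trans (proj₁ (eq (here refl) s)) (proj₁ (c s e)) , trans (proj₂ (eq (here refl) s)) (proj₂ (c s e))) ,
    chosen-resp r (λ e → eq (there e)) ch

  module Passes {Adj : V → V → Set} (H : List (V × V)) (grown : Grown zero Adj H) (H<n : length H < n) where

    record Ordered (m : Memory) : Set where
      field
        size  : m 0 0 ≡ n
        tail≡ : m 7 0 ≡ suc (length H)
        queue : ∀ {i q x} → At zero H i (q , x) → m 4 i ≡ toℕ x × m 5 i ≡ q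
    open Ordered

    ordered-resp : ∀ {m m′} → (∀ i → m′ 0 i ≡ m 0 i) → (∀ i → m′ 4 i ≡ m 4 i) → (∀ i → m′ 5 i ≡ m 5 i) →
                   (∀ i → m′ 7 i ≡ m 7 i) → Ordered m → Ordered m′
    ordered-resp e₀ e₄ e₅ e₇ o = record
      { size = trans (e₀ 0) (size o) ; tail≡ = trans (e₇ 0) (tail≡ o)
      ; queue = λ a → trans (e₄ _) (proj₁ (queue o a)) , trans (e₅ _) (proj₂ (queue o a)) }

    newest : ∀ {r p v h} → r ʳ++ ((p , v) ∷ h) ≡ H → At zero H (suc (length h)) (toℕ p , v)
    newest {r} refl = At-ʳ++ r last

    length-suffix : ∀ r {h} → r ʳ++ h ≡ H → length h ≤ length H
    length-suffix r {h} eq = go r (subst (λ l → length l ≤ length H) (sym eq) ≤-refl)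
      where
      go : ∀ r {h : List (V × V)} → length (r ʳ++ h) ≤ length H → length h ≤ length H
      go []      le = le
      go (e ∷ r) le = ≤-trans (n≤1+n _) (go r le)

    -- The pairs of r have been grafted, those of h have not.
    record Grafting (μ : ℕ) (m : Memory) : Set where
      field
        r h     : List (V × V)
        zipper  : r ʳ++ h ≡ H
        measure : length h ≡ μ
        index≡  : m 9 0 ≡ suc (length h)
        ordered : Ordered m
        tables  : Tables (forest r) m
        chosen  : Chosen r m

    graft-step : ∀ {μ m} → Grafting μ m → ⟦ index ⊖ lit 1 ⟧ m ≢ 0 →
                 wp w graft-body (λ m′ → Σ[ j ∈ ℕ ] j < μ × Grafting j m′) m
    graft-step {m = m} record { h = [] ; index≡ = index≡ } nz = contradiction (cong (_∸ 1) index≡) nz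
    graft-step {μ} {m} record { r = r ; h = (p , v) ∷ h ; zipper = zipper ; measure = measure ; index≡ = index≡
                              ; ordered = ordered ; tables = tables ; chosen = chosen } nz =
      subst (_≤ w) (sym index-1≡) (≤-trans (≤-trans (length-suffix r zipper) (<⇒≤ H<n)) (<⇒≤ n<w)) ,
      wp-mono w (each reset (allFin K)) relaxing
        (wp-frame w (each reset (allFin K)) (wp-fill w 11 (λ s → lit (toℕ s)) (λ _ → ∞ₑ) m₁ toℕ (λ _ → suc n)
          toℕ-injective (λ _ → n<w)
          (λ same s → refl , trans (cong (_+ 1) (trans (same 0 refl 0) (size ordered))) (+-comm n 1))
          (allFin K)))
      where
      Next : Memory → Set
      Next m′ = Σ[ j ∈ ℕ ] j < μ × Grafting j m′

      index-1≡ : m 9 0 ∸ 1 ≡ suc (length h)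
      index-1≡ = cong (_∸ 1) index≡

      m₁ : Memory
      m₁ = m [ 9 , 0 ↦ m 9 0 ∸ 1 ]

      entry : At zero H (suc (length h)) (toℕ p , v)
      entry = newest {r} zipper

      v∉ : v ∉ verts zero h
      v∉ with grown-suffix r (subst (Grown zero Adj) (sym zipper) grown)
      ... | add _ _ v∉ _ = v∉

      f g : S → ℕ
      f = value (forest r p)
      g = value (forest r v)

      saving : ∀ {m₂} → Relaxing f g p v m (optimum f g) m₂ → Ordered m₂ → m₂ 9 0 ≡ suc (length h) →
               Tables (forest r) m₂ → wp w (each save (allFin K)) Next m₂
      saving {m₂} R ord idx tab =
        wp-mono w (each save (allFin K)) finish
          (wp-frame w (each save (allFin K)) (wp-fill w 10 (slot parent) (λ s → 11 ! lit (toℕ s)) m₂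
            (λ s → K * toℕ p + toℕ s) (λ s → proj₁ (optimum f g s))
            (λ {s} {t} eq → proj₂ (slot-injective {x = p} {p} {s} {t} eq))
            (λ s → ≤-trans (bounded s) n<w)
            (λ {m′} same s →
              trans (slot-value parent s m′) (cong (λ j → K * j + toℕ s)
                (trans (same 5 refl _) (trans (cong (m₂ 5) (same 9 refl 0)) parent≡))) ,
              trans (same 11 refl _) (scratch s))
            (allFin K)))
        where
        open Relaxing R
        finish : ∀ {m′} → ((∀ {s} → s ∈ allFin K → m′ 10 (K * toℕ p + toℕ s) ≡ proj₁ (optimum f g s)) ×
                   (∀ j → m′ 10 j ≡ m₂ 10 j ⊎ Σ[ s ∈ S ] K * toℕ p + toℕ s ≡ j × m′ 10 j ≡ proj₁ (optimum f g s))) ×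
                   (∀ a → Keeps a (each save (allFin K)) → ∀ j → m′ a j ≡ m₂ a j) → Next m′
        finish {m′} ((hit , rest) , same) = length h , ≤-reflexive measure , record
          { r = (p , v) ∷ r ; h = h ; zipper = zipper ; measure = refl
          ; index≡ = trans (same 9 (keep 9 refl) 0) idx
          ; ordered = ordered-resp (same 0 (keep 0 refl)) (same 4 (keep 4 refl)) (same 5 (keep 5 refl)) (same 7 (keep 7 refl)) ord
          ; tables = tables′
          ; chosen = (λ s e → trans (same 12 (keep 12 refl) _) (proj₁ (choices s e)) ,
                              trans (same 13 (keep 13 refl) _) (proj₂ (choices s e))) ,
              chosen-resp r (λ e s → let out = λ t eq → older≢ e (proj₁ (slot-injective {x = v} {s = t} {s} eq)) in
                trans (same 12 (keep 12 refl) _) (proj₁ (others _ out)) ,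
                trans (same 13 (keep 13 refl) _) (proj₂ (others _ out))) chosen
          }
          where
          keep : ∀ a → (10 ≡ᵇ a) ≡ false → Keeps a (each save (allFin K))
          keep a k₁₀ = Keeps-each a save (λ _ → k₁₀) (allFin K)
          older≢ : ∀ {p′ v′} → (p′ , v′) ∈ r → v ≢ v′
          older≢ e refl = child-fresh r (subst (Grown zero Adj) (sym zipper) grown) e (here refl)
          tables′ : Tables (forest ((p , v) ∷ r)) m′
          tables′ x s with x ≟ p
          ... | yes refl = hit (∈-allFin s)
          ... | no x≢p with rest (K * toℕ x + toℕ s)
          ...   | inj₁ eq = trans eq (tab x s)
          ...   | inj₂ (t , eq , _) = contradiction (sym (proj₁ (slot-injective {x = p} {x} {t} {s} eq))) x≢p

      relaxing : ∀ {m₂} → ((∀ {s} → s ∈ allFin K → m₂ 11 (toℕ s) ≡ suc n) ×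
                   (∀ j → m₂ 11 j ≡ m₁ 11 j ⊎ Σ[ s ∈ S ] toℕ s ≡ j × m₂ 11 j ≡ suc n)) ×
                   (∀ a → Keeps a (each reset (allFin K)) → ∀ j → m₂ a j ≡ m₁ a j) →
                 wp w (each relaxₚ (pairs K) ⨟ each save (allFin K)) Next m₂
      relaxing {m₂} ((hit , _) , same) = wp-mono w (each relaxₚ (pairs K))
        (λ {m₃} (R , same′) → saving R
          (ordered-resp (same′ 0 (keep 0 refl refl refl)) (same′ 4 (keep 4 refl refl refl))
            (same′ 5 (keep 5 refl refl refl)) (same′ 7 (keep 7 refl refl refl)) ord)
          (trans (same′ 9 (keep 9 refl refl refl) 0) idx)
          (λ x s → trans (same′ 10 (keep 10 refl refl refl) _) (tab x s)))
        (wp-frame w (each relaxₚ (pairs K)) (wp-sweep f g p v m (pairs K) fresh record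
          { bounded = λ _ → ≤-refl
          ; scratch = λ s → hit (∈-allFin s)
          ; choices = λ s ()
          ; ftable = tab p ; gtable = tab v
          ; child≡ = trans (cong (m₂ 4) idx) (proj₁ (queue ord entry))
          ; parent≡ = trans (cong (m₂ 5) idx) (proj₂ (queue ord entry))
          ; others = λ i _ → same 12 (keep′ 12 refl) i , same 13 (keep′ 13 refl) i
          }))
        where
        keep′ : ∀ a → (11 ≡ᵇ a) ≡ false → Keeps a (each reset (allFin K))
        keep′ a k₁₁ = Keeps-each a reset (λ _ → k₁₁) (allFin K)
        keep : ∀ a → (11 ≡ᵇ a) ≡ false → (12 ≡ᵇ a) ≡ false → (13 ≡ᵇ a) ≡ false → Keeps a (each relaxₚ (pairs K))
        keep a k₁₁ k₁₂ k₁₃ = Keeps-each a relaxₚ (keeps-relax a k₁₁ k₁₂ k₁₃) (pairs K)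
        ord : Ordered m₂
        ord = ordered-resp (same 0 (keep′ 0 refl)) (same 4 (keep′ 4 refl)) (same 5 (keep′ 5 refl)) (same 7 (keep′ 7 refl)) ordered
        idx : m₂ 9 0 ≡ suc (length h)
        idx = trans (same 9 (keep′ 9 refl) 0) index-1≡
        tab : Tables (forest r) m₂
        tab x s = trans (same 10 (keep′ 10 refl) _) (tables x s)

    record Grafted (m : Memory) : Set where
      field
        full    : List (V × V)
        zipper  : full ʳ++ [] ≡ H
        ordered : Ordered m
        tables  : Tables (forest full) m
        chosen  : Chosen full m

    graft-time : ℕ
    graft-time = duration (9 ! lit 0 ≔ tail) + loop-time (index ⊖ lit 1) graft-body n

    graft-runs : ∀ {m} → Ordered m → Tables leaf m → Runs w graft-all m graft-time Grafted
    graft-runs {m} ord tab = runs-mono w ≤-refl finish (runs-seq w {Q = Grafting (length H)}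
      (wp-sound w (9 ! lit 0 ≔ tail) (subst (_≤ w) (sym (tail≡ ord)) (≤-trans H<n (<⇒≤ n<w)) , record
        { r = [] ; h = H ; zipper = refl ; measure = refl ; index≡ = tail≡ ord
        ; ordered = ordered-resp (λ _ → refl) (λ _ → refl) (λ _ → refl) (λ _ → refl) ord ; tables = tab ; chosen = tt }))
      (while-rule w Grafting graft-step n (length H) (<⇒≤ H<n)))
      where
      finish : ∀ {m′} → Σ[ j ∈ ℕ ] Grafting j m′ × ⟦ index ⊖ lit 1 ⟧ m′ ≡ 0 → Grafted m′
      finish (_ , record { r = r ; h = [] ; zipper = z ; ordered = o ; tables = t ; chosen = c } , _) =
        record { full = r ; zipper = z ; ordered = o ; tables = t ; chosen = c }
      finish (_ , record { h = e ∷ h ; index≡ = i≡ } , eq) =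
        contradiction (trans (sym (cong (_∸ 1) i≡)) eq) λ ()

  module _ (f : S → ℕ) (f≤ : ∀ s → f s ≤ suc n) where

    record Selecting (m : Memory) : Set where
      field
        table   : ∀ s → m 10 (K * 0 + toℕ s) ≡ f s
        bounded : m 11 0 ≤ suc n
        found   : m 11 0 < suc n → Σ[ s ∈ S ] accept s ≡ true × m 3 0 ≡ toℕ s × f s ≡ m 11 0

    Improves : List S → Memory → Memory → Set
    Improves xs m m′ = Selecting m′ × m′ 11 0 ≤ m 11 0 × (∀ {s} → s ∈ xs → accept s ≡ true → m′ 11 0 ≤ f s)

    select-step : ∀ s {m} → Selecting m →
      wp w (selectₚ s) (λ m′ → Selecting m′ × m′ 11 0 ≤ m 11 0 × (accept s ≡ true → m′ 11 0 ≤ f s)) m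
    select-step s {m} I with accept s in acc
    ... | false = I , ≤-refl , λ ()
    ... | true  =
      (λ nz → subst (_≤ w) (sym value≡) (≤-trans (f≤ s) n<w) , state≤w s , record
        { table = table ; bounded = subst (_≤ suc n) (sym value≡) (f≤ s)
        ; found = λ _ → s , acc , refl , sym value≡ } ,
        <⇒≤ (m∸n≢0⇒n<m nz) , λ _ → ≤-reflexive value≡) ,
      (λ z → I , ≤-refl , λ _ → subst (m 11 0 ≤_) value≡ (m∸n≡0⇒m≤n z))
      where
      open Selecting I
      value≡ : ⟦ 10 ! slot (lit 0) s ⟧ m ≡ f s
      value≡ = trans (cong (m 10) (slot-value (lit 0) s m)) (table s)

    wp-select : ∀ xs {m} → Selecting m → wp w (each selectₚ xs) (Improves xs m) m
    wp-select []       I = I , ≤-refl , λ ()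
    wp-select (s ∷ xs) I = wp-mono w (selectₚ s)
      (λ (I′ , le , hit) → wp-mono w (each selectₚ xs)
        (λ (I″ , le′ , hits) → I″ , ≤-trans le′ le ,
          λ { (here refl) acc → ≤-trans le′ (hit acc) ; (there s∈) acc → hits s∈ acc })
        (wp-select xs I′))
      (select-step s I)

    -- A finite accepting state forces a strict improvement on the initial n + 1, hence a write to
    -- cell 0 of array 3.
    select-runs : ∀ {m} → m 0 0 ≡ n → (∀ s → m 10 (K * 0 + toℕ s) ≡ f s) →
      (Σ[ s ∈ S ] accept s ≡ true × f s < suc n) →
      Runs w select m (duration select) (λ m′ → Σ[ s ∈ S ] accept s ≡ true × m′ 3 0 ≡ toℕ s ×
        f s < suc n × (∀ s′ → accept s′ ≡ true → f s ≤ f s′))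
    select-runs {m} size tab (s₁ , acc₁ , lt₁) = wp-sound w select
      (subst (_≤ w) (sym ∞≡) n<w , wp-mono w (each selectₚ (allFin K)) finish (wp-select (allFin K) record
        { table = tab ; bounded = ≤-reflexive ∞≡ ; found = λ lt → contradiction lt (<-irrefl ∞≡) }))
      where
      ∞≡ : m 0 0 + 1 ≡ suc n
      ∞≡ = trans (cong (_+ 1) size) (+-comm n 1)
      finish : ∀ {m′} → Improves (allFin K) (m [ 11 , 0 ↦ m 0 0 + 1 ]) m′ → Σ[ s ∈ S ] accept s ≡ true ×
        m′ 3 0 ≡ toℕ s × f s < suc n × (∀ s′ → accept s′ ≡ true → f s ≤ f s′)
      finish {m′} (I , _ , hits) with Selecting.found I (≤-<-trans (hits (∈-allFin s₁) acc₁) lt₁)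
      ... | s , acc , m3 , fs = s , acc , m3 ,
        subst (_< suc n) (sym fs) (≤-<-trans (hits (∈-allFin s₁) acc₁) lt₁) ,
        λ s′ acc′ → subst (_≤ f s′) (sym fs) (hits (∈-allFin s′) acc′)

  -- Tracing the choices back

  module Tracing {Adj : V → V → Set} (H : List (V × V)) (grown : Grown zero Adj H) (H<n : length H < n)
                 (full : List (V × V)) (s₀ : S) where
    open Passes H grown H<n
    open Ordered

    -- The tree has been cut into the trees of the vertices of `h`, and `σ` is the state demanded of
    -- each. `traces` acts as a continuation: a labelling that meets all demands is traced from
    -- `s₀`. Finiteness ensures that the next cut finds a recorded choice.
    record Traces (μ : ℕ) (m : Memory) : Set where
      field
        r h     : List (V × V)
        σ       : V → S
        zipper  : r ʳ++ h ≡ H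
        measure : length r ≡ μ
        index≡  : m 9 0 ≡ suc (length h)
        ordered : Ordered m
        chosen  : Chosen r m
        states  : ∀ {x} → x ∈ verts zero h → m 3 (toℕ x) ≡ toℕ (σ x)
        finite  : ∀ {x} → x ∈ verts zero h → value (forest r x) (σ x) < suc n
        traces  : ∀ L → (∀ {x} → x ∈ verts zero h → Traced (forest r x) (σ x) L) →
                  Traced (forest full zero) s₀ L

    trace-step : ∀ {μ m} → Traces μ m → ⟦ tail ⊖ index ⟧ m ≢ 0 →
                 wp w trace-body (λ m′ → Σ[ j ∈ ℕ ] j < μ × Traces j m′) m
    trace-step record { r = [] ; h = h ; zipper = refl ; index≡ = index≡ ; ordered = ordered } nz =
      contradiction (trans (cong₂ _∸_ (tail≡ ordered) index≡) (n∸n≡0 (suc (length h)))) nz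
    trace-step {μ} {m} record { r = (p , v) ∷ r ; h = h ; σ = σ ; zipper = zipper ; measure = measure ; index≡ = index≡
                              ; ordered = ordered ; chosen = chosen , chosens ; states = states ; finite = finite
                              ; traces = traces } nz
      with grown-suffix r (subst (Grown zero Adj) (sym zipper) grown)
    ... | add _ p∈ v∉ _
      with Justified.found (optimum-justified (value (forest r p)) (value (forest r v))) (σ p)
             (subst (λ t → value t (σ p) < suc n) (forest-parent p v r) (finite p∈))
    ...   | a , b , ch =
      subst (_≤ w) (sym b≡) (state≤w b) , subst (_≤ w) (sym a≡) (state≤w a) ,
      subst (_≤ w) (sym index+1≡) (≤-trans (≤-trans (s≤s (length-suffix r zipper)) H<n) (<⇒≤ n<w)) ,
      length r , ≤-reflexive measure , record
        { r = r ; h = (p , v) ∷ h ; σ = σ′ ; zipper = zipper ; measure = refl ; index≡ = index+1≡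
        ; ordered = ordered-resp (λ _ → refl) (λ _ → refl) (λ _ → refl) (λ _ → refl) ordered
        ; chosen = chosen-resp r {m} (λ _ _ → refl , refl) chosens
        ; states = states′ ; finite = finite′ ; traces = traces′ }
      where
      entry : At zero H (suc (length h)) (toℕ p , v)
      entry = newest {r} zipper
      child≡ : m 4 (m 9 0) ≡ toℕ v
      child≡ = trans (cong (m 4) index≡) (proj₁ (queue ordered entry))
      parent≡ : m 5 (m 9 0) ≡ toℕ p
      parent≡ = trans (cong (m 5) index≡) (proj₂ (queue ordered entry))
      p≢v : p ≢ v
      p≢v refl = v∉ p∈
      addressₑ : Expr
      addressₑ = times K child ⊕ 3 ! parent
      located : ∀ {m′} → m′ 4 (m′ 9 0) ≡ toℕ v → m′ 3 (m′ 5 (m′ 9 0)) ≡ toℕ (σ p) →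
                 ⟦ addressₑ ⟧ m′ ≡ K * toℕ v + toℕ (σ p)
      located {m′} c≡ s≡ = cong₂ _+_ (trans (⟦times⟧ K child m′) (cong (K *_) c≡)) s≡
      state≡ : m 3 (m 5 (m 9 0)) ≡ toℕ (σ p)
      state≡ = trans (cong (m 3) parent≡) (states p∈)
      b≡ : ⟦ 13 ! addressₑ ⟧ m ≡ toℕ b
      b≡ = trans (cong (m 13) (located {m} child≡ state≡)) (proj₂ (chosen (σ p) ch))
      m₁ m₂ : Memory
      m₁ = m [ 3 , m 4 (m 9 0) ↦ ⟦ 13 ! addressₑ ⟧ m ]
      m₂ = m₁ [ 3 , m 5 (m 9 0) ↦ ⟦ 12 ! addressₑ ⟧ m₁ ]
      child≢parent : m 4 (m 9 0) ≢ m 5 (m 9 0)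
      child≢parent eq = p≢v (toℕ-injective (trans (sym parent≡) (trans (sym eq) child≡)))
      a≡ : ⟦ 12 ! addressₑ ⟧ m₁ ≡ toℕ a
      a≡ = trans (cong (m 12) (located {m₁} child≡ (trans (write-other child≢parent) state≡))) (proj₁ (chosen (σ p) ch))
      index+1≡ : m 9 0 + 1 ≡ suc (suc (length h))
      index+1≡ = trans (+-comm _ 1) (cong suc index≡)
      σ′ : V → S
      σ′ x with x ≟ v | x ≟ p
      ... | yes _ | _     = b
      ... | no _  | yes _ = a
      ... | no _  | no _  = σ x
      σ′v : σ′ v ≡ b
      σ′v with v ≟ v
      ... | yes _ = refl
      ... | no ≢  = contradiction refl ≢
      σ′p : σ′ p ≡ a
      σ′p with p ≟ v | p ≟ p
      ... | yes e | _     = contradiction e p≢v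
      ... | no _  | yes _ = refl
      ... | no _  | no ≢  = contradiction refl ≢
      σ′x : ∀ {x} → x ∈ verts zero h → x ≢ p → σ′ x ≡ σ x
      σ′x {x} x∈ x≢p with x ≟ v | x ≟ p
      ... | yes refl | _     = contradiction x∈ v∉
      ... | no _     | yes e = contradiction e x≢p
      ... | no _     | no _  = refl
      split : ∀ (P : V → Set) → P v → P p → (∀ {x} → x ∈ verts zero h → x ≢ p → x ≢ v → P x) →
              ∀ {x} → x ∈ verts zero ((p , v) ∷ h) → P x
      split P Pv Pp Px {x} (here refl) = Pv
      split P Pv Pp Px {x} (there x∈) with x ≟ p
      ... | yes refl = Pp
      ... | no x≢p   = Px x∈ x≢p λ { refl → v∉ x∈ }
      states′ : ∀ {x} → x ∈ verts zero ((p , v) ∷ h) → m₂ 3 (toℕ x) ≡ toℕ (σ′ x)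
      states′ = split (λ x → m₂ 3 (toℕ x) ≡ toℕ (σ′ x))
        (trans (write-other λ eq → p≢v (toℕ-injective (trans (sym parent≡) eq)))
          (trans (write-same child≡) (trans b≡ (cong toℕ (sym σ′v)))))
        (trans (write-same parent≡) (trans a≡ (cong toℕ (sym σ′p))))
        (λ x∈ x≢p x≢v → trans (write-other λ eq → x≢p (toℕ-injective (trans (sym eq) parent≡)))
          (trans (write-other λ eq → x≢v (toℕ-injective (trans (sym eq) child≡)))
            (trans (states x∈) (cong toℕ (sym (σ′x x∈ x≢p))))))
      sum<∞ : value (forest r p) a + value (forest r v) b < suc n
      sum<∞ = subst (_< suc n) (proj₂ (Justified.sound (optimum-justified (value (forest r p)) (value (forest r v))) _ ch))
        (subst (λ t → value t (σ p) < suc n) (forest-parent p v r) (finite p∈))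
      finite′ : ∀ {x} → x ∈ verts zero ((p , v) ∷ h) → value (forest r x) (σ′ x) < suc n
      finite′ = split (λ x → value (forest r x) (σ′ x) < suc n)
        (subst (λ s → value (forest r v) s < suc n) (sym σ′v) (≤-<-trans (m≤n+m _ _) sum<∞))
        (subst (λ s → value (forest r p) s < suc n) (sym σ′p) (≤-<-trans (m≤m+n _ _) sum<∞))
        (λ x∈ x≢p _ → subst₂ (λ t s → value t s < suc n) (forest-other r x≢p) (sym (σ′x x∈ x≢p)) (finite x∈))
      traces′ : ∀ L → (∀ {x} → x ∈ verts zero ((p , v) ∷ h) → Traced (forest r x) (σ′ x) L) →
                Traced (forest full zero) s₀ L
      traces′ L tr = traces L old
        where
        old : ∀ {x} → x ∈ verts zero h → Traced (forest ((p , v) ∷ r) x) (σ x) L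
        old {x} x∈ with x ≟ p
        ... | yes refl = a , b , ch , subst (λ s → Traced (forest r p) s L) σ′p (tr (there p∈)) ,
                         subst (λ s → Traced (forest r v) s L) σ′v (tr (here refl))
        ... | no x≢p   = subst (λ s → Traced (forest r x) s L) (σ′x x∈ x≢p) (tr (there x∈))

    trace-time : ℕ
    trace-time = duration (9 ! lit 0 ≔ lit 1) + loop-time (tail ⊖ index) trace-body n

    length-history : ∀ r {h : List (V × V)} → length (r ʳ++ h) ≡ length r + length h
    length-history []      = refl
    length-history (e ∷ r) = trans (length-history r) (+-suc (length r) _)

    trace-runs : ini true ≢ ini false → (∀ x → x ∈ verts zero H) → full ʳ++ [] ≡ H →
      ∀ {m} → Ordered m → Chosen full m → m 3 0 ≡ toℕ s₀ → value (forest full zero) s₀ < suc n →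
      Runs w trace-all m trace-time (λ m′ → Σ[ L ∈ (V → Bool) ]
        (∀ x → m′ 3 (toℕ x) ≡ toℕ (ini (L x))) × Traced (forest full zero) s₀ L)
    trace-runs ini≢ complete zip {m} ord ch m3 fin = runs-mono w ≤-refl finish (runs-seq w {Q = Traces (length full)}
      (wp-sound w (9 ! lit 0 ≔ lit 1) (≤-trans (s≤s z≤n) n<w , record
        { r = full ; h = [] ; σ = λ _ → s₀ ; zipper = zip ; measure = refl ; index≡ = refl
        ; ordered = ordered-resp (λ _ → refl) (λ _ → refl) (λ _ → refl) (λ _ → refl) ord
        ; chosen = chosen-resp full {m} (λ _ _ → refl , refl) ch
        ; states = λ { (here refl) → m3 } ; finite = λ { (here refl) → fin }
        ; traces = λ L tr → tr (here refl) }))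
      (while-rule w Traces trace-step n (length full) length≤))
      where
      length≤ : length full ≤ n
      length≤ = ≤-trans (≤-trans (m≤m+n _ 0) (≤-reflexive (trans (sym (length-history full)) (cong length zip)))) (<⇒≤ H<n)
      finish : ∀ {m′} → Σ[ j ∈ ℕ ] Traces j m′ × ⟦ tail ⊖ index ⟧ m′ ≡ 0 → Σ[ L ∈ (V → Bool) ]
        (∀ x → m′ 3 (toℕ x) ≡ toℕ (ini (L x))) × Traced (forest full zero) s₀ L
      finish (_ , record { r = e ∷ r ; h = h ; zipper = refl ; index≡ = index≡ ; ordered = o } , z) =
        contradiction (subst₂ _≤_ (tail≡ o) index≡ (m∸n≡0⇒m≤n z))
          (<⇒≱ (s≤s (≤-trans (s≤s (m≤n+m (length h) (length r)))
            (≤-reflexive (sym (length-history (e ∷ r)))))))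
      finish {m′} (_ , record { r = [] ; σ = σ ; zipper = refl ; states = states ; finite = finite ; traces = traces } , _) =
        (λ x → proj₁ (label x)) ,
        (λ x → trans (states (complete x)) (cong toℕ (proj₂ (label x)))) ,
        traces (λ x → proj₁ (label x)) (λ {x} _ → proj₂ (label x))
        where
        -- When no graft is left, every tree is a single vertex, and a finite value there leaves
        -- only the two initial states.
        label : ∀ x → Σ[ b ∈ Bool ] σ x ≡ ini b
        label x = leaf-value<∞ ini≢ (σ x) (finite (complete x))

  module _ (ini-code : ∀ b → toℕ (ini b) ≡ ⟨ b ⟩)
           (G : Graph n) (tree : IsTree G) (adj : Vec (List V) n) (lists : IsAdjacencyLists G adj) where
    open Graph G using (Adj)

    private
      ini≢ : ini true ≢ ini false
      ini≢ eq = contradiction (trans (sym (ini-code true)) (trans (cong toℕ eq) (ini-code false))) λ ()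

    record Solved (m : Memory) : Set where
      field
        H        : List (V × V)
        full     : List (V × V)
        zipper   : full ʳ++ [] ≡ H
        grown    : Grown zero Adj H
        complete : ∀ x → x ∈ verts zero H
        L        : V → Bool
        output   : ∀ x → m 3 (toℕ x) ≡ ⟨ L x ⟩
        accepted : Accepted full L
        optimal  : ∀ L′ → Accepted full L′ → weight (forest full zero) L ≤ weight (forest full zero) L′

    total-time : ℕ
    total-time = init-time + (bfs-time G tree adj lists w n<w + (duration (9 ! lit 0 ≔ tail) +
      loop-time (index ⊖ lit 1) graft-body n + (duration select +
      (duration (9 ! lit 0 ≔ lit 1) + loop-time (tail ⊖ index) trace-body n))))

    -- Feasibility is supplied for every order of discovery, because the actual one is known only
    -- after the search.
    program-runs :
      (∀ full → Grown zero Adj (full ʳ++ []) → (∀ x → x ∈ verts zero (full ʳ++ [])) →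
        Σ[ L ∈ (V → Bool) ] Accepted full L × weight (forest full zero) L ≤ n) →
      Runs w program (input adj) total-time Solved
    program-runs feasible =
      runs-seq w (runs-frame w (init-runs refl)) λ (tab , kept₁) →
      runs-seq w (runs-frame w (bfs-runs G tree adj lists w n<w (record
        { size = kept₁ 0 (keeps-init 0 refl refl) 0
        ; offsets = kept₁ 1 (keeps-init 1 refl refl)
        ; neighbours = kept₁ 2 (keeps-init 2 refl refl) }))) λ {m₂} (searched , kept₂) →
      afterwards searched
        (trans (kept₂ 0 bfs-keeps₀ 0) (kept₁ 0 (keeps-init 0 refl refl) 0))
        (λ x s → trans (kept₂ 10 bfs-keeps₁₀ _) (tab x s))
      where
      bfs-keeps₀ : Keeps 0 bfs
      bfs-keeps₀ = (refl , refl , refl , refl , refl) , (((refl , refl , refl) , tt) , refl) , refl , refl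
      bfs-keeps₁₀ : Keeps 10 bfs
      bfs-keeps₁₀ = (refl , refl , refl , refl , refl) , (((refl , refl , refl) , tt) , refl) , refl , refl
      afterwards : ∀ {m} → Searched G tree adj lists w n<w m → m 0 0 ≡ n → Tables leaf m →
        Runs w (graft-all ⨟ select ⨟ trace-all) m (duration (9 ! lit 0 ≔ tail) +
          loop-time (index ⊖ lit 1) graft-body n + (duration select +
          (duration (9 ! lit 0 ≔ lit 1) + loop-time (tail ⊖ index) trace-body n))) Solved
      afterwards {m} record { h = H ; grown = grown ; queue = queue ; tail≡ = tail≡ ; complete = complete } size tab =
        runs-seq w (graft-runs (record { size = size ; tail≡ = tail≡ ; queue = queue }) tab) after-graft
        where
        H<n : length H < n
        H<n = grown-length G tree adj lists w n<w grown
        open Passes H grown H<n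
        after-graft : ∀ {m₃} → Grafted m₃ → Runs w (select ⨟ trace-all) m₃ _ Solved
        after-graft {m₃} record { full = full ; zipper = refl ; ordered = ord ; tables = tab′ ; chosen = ch } =
          runs-seq w (runs-frame w (select-runs (value t) (value-≤∞ t) (Ordered.size ord) (tab′ zero)
            (witness (feasible full grown complete)))) λ {m₄} ((s , acc , m3 , fin , least) , kept) →
          let open Tracing H grown H<n full s
              keep = λ a k₃ k₁₁ → kept a (keeps-select a k₃ k₁₁)
          in runs-mono w ≤-refl (finish s acc least)
            (trace-runs ini≢ complete refl
              (ordered-resp (keep 0 refl refl) (keep 4 refl refl) (keep 5 refl refl) (keep 7 refl refl) ord)
              (chosen-resp full (λ _ _ → keep 12 refl refl _ , keep 13 refl refl _) ch)
              m3 fin)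
          where
          t : Tree n
          t = forest full zero
          witness : Σ[ L ∈ (V → Bool) ] Accepted full L × weight t L ≤ n →
                    Σ[ s ∈ S ] accept s ≡ true × value t s < suc n
          witness (L , (s , st , acc) , le) = s , acc , s≤s (≤-trans (value-≤ ini≢ t L st) le)
          finish : ∀ s → accept s ≡ true → (∀ s′ → accept s′ ≡ true → value t s ≤ value t s′) → ∀ {m′} →
            Σ[ L ∈ (V → Bool) ] (∀ x → m′ 3 (toℕ x) ≡ toℕ (ini (L x))) × Traced t s L → Solved m′
          finish s acc least (L , out , tr) = record
            { H = H ; full = full ; zipper = refl ; grown = grown ; complete = complete ; L = L
            ; output = λ x → trans (out x) (ini-code (L x))
            ; accepted = s , proj₁ (traced ini≢ t L tr) , acc
            ; optimal = λ L′ (s′ , st′ , acc′) → ≤-trans (≤-reflexive (proj₂ (traced ini≢ t L tr)))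
                (≤-trans (least s′ acc′) (value-≤ ini≢ t L′ st′)) }

-- The states

-- What matters about a vertex whose children ws are known, C being the
-- number of children in L: membership in L, C, the least C w, the least
-- C w + C w′ over pairs, and the least C w + C x over grandchildren x. No
-- constraint asks for more than 3, so 3 stands for an empty minimum.
record Info : Set where
  constructor info
  field
    own   : Bool
    count : ℕ
    one   : ℕ
    two   : ℕ
    deep  : ℕ
open Info

-- The constraints centred at a vertex, a being the contribution of its parent.
Ok : ℕ → Info → Set
Ok a i = 2 ≤ a + (⟨ own i ⟩ + count i) + one i ×
         3 ≤ a + (⟨ own i ⟩ + count i) + two i ×
         3 ≤ a + (⟨ own i ⟩ + count i) + deep i

ok? : ∀ a i → Dec (Ok a i)
ok? a i = (_ ≤? _) ×-dec (_ ≤? _) ×-dec (_ ≤? _)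

-- The root of `j` becomes a further child: its `count` is the new C w, and its `one` is the least C
-- x over the grandchildren that come with it.
merge : Info → Info → Info
merge i j = info (own i) (⟨ own j ⟩ + count i) (count j ⊓ one i)
                 (two i ⊓ (one i + count j)) ((count j + one j) ⊓ deep i)

iniᴵ : Bool → Info
iniᴵ b = info b 0 3 3 3

-- The lower root has all its children by now and has just met its parent, so the constraints
-- centred at it are complete; the parent contributes only its own membership.
joinᴵ : Info → Info → Maybe Info
joinᴵ i j with ok? ⟨ own i ⟩ j
... | yes _ = just (merge i j)
... | no  _ = nothing

joinᴵ-yes : ∀ i j → Ok ⟨ own i ⟩ j → joinᴵ i j ≡ just (merge i j)
joinᴵ-yes i j ok with ok? ⟨ own i ⟩ j
... | yes _  = refl
... | no ¬ok = contradiction ok ¬ok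

joinᴵ-ok : ∀ i j {s} → joinᴵ i j ≡ just s → Ok ⟨ own i ⟩ j
joinᴵ-ok i j eq with ok? ⟨ own i ⟩ j
... | yes ok = ok

least : ∀ {A : Set} → (A → ℕ) → List A → ℕ
least f []       = 3
least f (x ∷ xs) = f x ⊓ least f xs

least-two : ∀ {A : Set} → (A → ℕ) → List A → ℕ
least-two f []       = 3
least-two f (x ∷ xs) = least-two f xs ⊓ (least f xs + f x)

≤+⊓⁻ : ∀ {k} s a b → k ≤ s + (a ⊓ b) → k ≤ s + a × k ≤ s + b
≤+⊓⁻ s a b le = ≤-trans le (+-monoʳ-≤ s (m⊓n≤m a b)) , ≤-trans le (+-monoʳ-≤ s (m⊓n≤n a b))

≤+⊓⁺ : ∀ {k} s a b → k ≤ s + a → k ≤ s + b → k ≤ s + (a ⊓ b)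
≤+⊓⁺ s a b p q = subst (_ ≤_) (sym (+-distribˡ-⊓ s a b)) (⊓-glb p q)

module _ {A : Set} (f : A → ℕ) {k : ℕ} where

  least⁻ : ∀ s xs → k ≤ s + least f xs → All (λ x → k ≤ s + f x) xs
  least⁻ s []       le = []
  least⁻ s (x ∷ xs) le with ≤+⊓⁻ s (f x) _ le
  ... | p , q = p ∷ least⁻ s xs q

  least⁺ : k ≤ 3 → ∀ s xs → All (λ x → k ≤ s + f x) xs → k ≤ s + least f xs
  least⁺ k≤3 s []       []       = ≤-trans k≤3 (m≤n+m 3 s)
  least⁺ k≤3 s (x ∷ xs) (p ∷ ps) = ≤+⊓⁺ s (f x) _ p (least⁺ k≤3 s xs ps)

  least-two⁻ : ∀ s xs → k ≤ s + least-two f xs → AllPairs (λ x y → k ≤ s + (f x + f y)) xs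
  least-two⁻ s []       le = []
  least-two⁻ s (x ∷ xs) le with ≤+⊓⁻ s (least-two f xs) _ le
  ... | p , q = All.map (λ {y} → subst (k ≤_) (+-assoc s (f x) (f y)))
                  (least⁻ (s + f x) xs (subst (k ≤_) (trans (cong (s +_) (+-comm _ (f x))) (sym (+-assoc s (f x) _))) q))
              ∷ least-two⁻ s xs p

  least-two⁺ : k ≤ 3 → ∀ s xs → AllPairs (λ x y → k ≤ s + (f x + f y)) xs → k ≤ s + least-two f xs
  least-two⁺ k≤3 s []       []       = ≤-trans k≤3 (m≤n+m 3 s)
  least-two⁺ k≤3 s (x ∷ xs) (p ∷ ps) = ≤+⊓⁺ s (least-two f xs) _ (least-two⁺ k≤3 s xs ps)
    (subst (k ≤_) (trans (+-assoc s (f x) _) (cong (s +_) (+-comm (f x) _)))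
      (least⁺ k≤3 (s + f x) xs (All.map (λ {y} → subst (k ≤_) (sym (+-assoc s (f x) (f y)))) p)))

module _ {n : ℕ} where

  private
    V : Set
    V = Fin n

  children : List (V × V) → V → List V
  children []            x = []
  children ((p , v) ∷ r) x with x ≟ p
  ... | yes _ = v ∷ children r x
  ... | no  _ = children r x

  children⁺ : ∀ r {x v} → (x , v) ∈ r → v ∈ children r x
  children⁺ ((p , u) ∷ r) {x} (here refl) with x ≟ x
  ... | yes _ = here refl
  ... | no ≢  = contradiction refl ≢
  children⁺ ((p , u) ∷ r) {x} (there e) with x ≟ p
  ... | yes _ = there (children⁺ r e)
  ... | no _  = children⁺ r e

  children⁻ : ∀ r {x v} → v ∈ children r x → (x , v) ∈ r
  children⁻ ((p , u) ∷ r) {x} v∈ with x ≟ p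
  children⁻ ((p , u) ∷ r) (here refl) | yes refl = here refl
  children⁻ ((p , u) ∷ r) (there v∈)  | yes refl = there (children⁻ r v∈)
  ... | no _  = there (children⁻ r v∈)

  children-skip : ∀ {p v x} r → x ≢ p → children ((p , v) ∷ r) x ≡ children r x
  children-skip {p} {v} {x} r x≢p with x ≟ p
  ... | yes e = contradiction e x≢p
  ... | no _  = refl

  module _ {root : V} {Adj : V → V → Set} where

    children-later : ∀ {h x} → Grown root Adj h → x ∉ verts root h → ∀ s →
                     children (h ʳ++ s) x ≡ children s x
    children-later []              x∉ s = refl
    children-later (add {p} {v} pv p∈ v∉ g) x∉ s =
      trans (children-later g (λ x∈ → x∉ (there x∈)) _) (children-skip s λ { refl → x∉ (there p∈) })

    module _ (L : V → Bool) (full : List (V × V)) where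

      -- `ws` may be only those children that have been grafted so far, whereas `C` counts in the
      -- whole tree: a child is complete when it is grafted.
      summary : V → List V → Info
      summary x ws = info (L x) (tally L ws) (least C ws) (least-two C ws)
                          (least (λ w → C w + least C (children full w)) ws)
        where
        C : V → ℕ
        C w = tally L (children full w)

      Fine : List (V × V) → Set
      Fine r = ∀ {p v} → (p , v) ∈ r → Ok ⟨ L p ⟩ (summary v (children full v))

      -- Children are discovered after their parent and hence grafted before it.
      children-known : ∀ {p v} h r → Grown root Adj (((p , v) ∷ r) ʳ++ h) → h ʳ++ ((p , v) ∷ r) ≡ full →
                       children full v ≡ children r v
      children-known h r g refl with grown-suffix r g
      ... | add _ p∈ v∉ g′ = trans (children-later g′ v∉ _) (children-skip r λ { refl → v∉ p∈ })

      fine⇒state : ∀ r {h} → Grown root Adj (r ʳ++ h) → h ʳ++ r ≡ full → Fine r →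
                   ∀ x → state iniᴵ joinᴵ (forest r x) L ≡ just (summary x (children r x))
      fine⇒state []            g eq fine x = refl
      fine⇒state ((p , v) ∷ r) g eq fine x with x ≟ p
      ... | no _ = fine⇒state r g eq (λ e → fine (there e)) x
      ... | yes refl = graft⁺ iniᴵ joinᴵ (forest r x) (forest r v) L
        (fine⇒state r g eq (λ e → fine (there e)) x)
        (subst (λ ws → state iniᴵ joinᴵ (forest r v) L ≡ just (summary v ws)) (sym (children-known _ r g eq))
          (fine⇒state r g eq (λ e → fine (there e)) v))
        (joinᴵ-yes (summary x (children r x)) (summary v (children full v)) (fine (here refl)))

      -- The induction carries a state for every current root; undoing a graft hands states to both
      -- parts. Once the older grafts are known to be fine, `fine⇒state` identifies these states as
      -- summaries.
      state⇒fine : ∀ r {h} → Grown root Adj (r ʳ++ h) → h ʳ++ r ≡ full →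
                   (∀ {x} → x ∈ verts root h → Σ[ i ∈ Info ] state iniᴵ joinᴵ (forest r x) L ≡ just i) → Fine r
      state⇒fine ((p , v) ∷ r) {h} g eq live with grown-suffix r g
      ... | add _ p∈ v∉ _ with live p∈
      ...   | i , st with graft⁻ iniᴵ joinᴵ (forest r p) (forest r v) L
                            (trans (cong (λ t → state iniᴵ joinᴵ t L) (sym (forest-parent p v r))) st)
      ...     | a , b , sp , sv , ab = λ { (here refl) → ok ; (there e) → rest e }
        where
        live′ : ∀ {x} → x ∈ verts root ((p , v) ∷ h) → Σ[ i ∈ Info ] state iniᴵ joinᴵ (forest r x) L ≡ just i
        live′ (here refl) = b , sv
        live′ {x} (there x∈) with x ≟ p
        ... | yes refl = a , sp
        ... | no x≢p with live x∈
        ...   | j , sx = j , trans (cong (λ t → state iniᴵ joinᴵ t L) (sym (forest-other r x≢p))) sx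
        rest : Fine r
        rest = state⇒fine r g eq live′
        known : ∀ {x a} → state iniᴵ joinᴵ (forest r x) L ≡ just a → a ≡ summary x (children r x)
        known {x} sx with trans (sym sx) (fine⇒state r g eq rest x)
        ... | refl = refl
        ok : Ok ⟨ L p ⟩ (summary v (children full v))
        ok with known sp | known sv
        ... | refl | refl = subst (λ ws → Ok ⟨ L p ⟩ (summary v ws)) (sym (children-known _ r g eq))
          (joinᴵ-ok (summary p (children r p)) _ ab)

-- Saturating at 3 leaves 2 · 4 ^ 4 states.
reduce : Info → Info
reduce (info b c m t d) = info b (c ⊓ 3) (m ⊓ 3) (t ⊓ 3) (d ⊓ 3)

infix 4 _≈_

-- Equality after saturation: a congruence for sums and minima that respects lower bounds up to 3,
-- which covers all that `merge` and `Ok` do with numbers.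
_≈_ : ℕ → ℕ → Set
a ≈ b = a ⊓ 3 ≡ b ⊓ 3

≈-reduce : ∀ a → a ⊓ 3 ≈ a
≈-reduce a = trans (⊓-assoc a 3 3) refl

≈-+ˡ : ∀ a b → (a ⊓ 3) + b ≈ a + b
≈-+ˡ 0 b = refl
≈-+ˡ 1 b = refl
≈-+ˡ 2 b = refl
≈-+ˡ (suc (suc (suc a))) b = cong (3 +_) (trans (⊓-zeroʳ ((a ⊓ 0) + b)) (sym (⊓-zeroʳ (a + b))))

≈-+ʳ : ∀ a b → a + (b ⊓ 3) ≈ a + b
≈-+ʳ a b = trans (cong (_⊓ 3) (+-comm a (b ⊓ 3))) (trans (≈-+ˡ b a) (cong (_⊓ 3) (+-comm b a)))

≈-⊓ : ∀ {a a′ b b′} → a ≈ a′ → b ≈ b′ → a ⊓ b ≈ a′ ⊓ b′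
≈-⊓ {a} {a′} {b} {b′} p q = trans (split a b) (trans (cong₂ _⊓_ p q) (sym (split a′ b′)))
  where
  split : ∀ a b → a ⊓ b ⊓ 3 ≡ (a ⊓ 3) ⊓ (b ⊓ 3)
  split a b = begin
    a ⊓ b ⊓ 3             ≡⟨ ⊓-assoc a b 3 ⟩
    a ⊓ (b ⊓ 3)           ≡⟨ cong (a ⊓_) (trans (⊓-comm b 3) (cong (_⊓ b) (sym (⊓-idem 3)))) ⟩
    a ⊓ (3 ⊓ 3 ⊓ b)       ≡⟨ cong (a ⊓_) (trans (⊓-assoc 3 3 b) (cong (3 ⊓_) (⊓-comm 3 b))) ⟩
    a ⊓ (3 ⊓ (b ⊓ 3))     ≡⟨ sym (⊓-assoc a 3 _) ⟩
    (a ⊓ 3) ⊓ (b ⊓ 3)     ∎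
    where open ≡-Reasoning

≈-≤ : ∀ {k a b} → k ≤ 3 → a ≈ b → k ≤ a → k ≤ b
≈-≤ {k} {a} {b} k≤3 eq k≤a = ≤-trans (subst (k ≤_) eq (⊓-glb k≤a k≤3)) (m⊓n≤m b 3)

sum₃-≈ : ∀ a b c d → a + (b + (c ⊓ 3)) + (d ⊓ 3) ≈ a + (b + c) + d
sum₃-≈ a b c d = begin
  (a + (b + (c ⊓ 3)) + (d ⊓ 3)) ⊓ 3   ≡⟨ ≈-+ʳ (a + (b + (c ⊓ 3))) d ⟩
  (a + (b + (c ⊓ 3)) + d) ⊓ 3         ≡⟨ cong (_⊓ 3) (swap (c ⊓ 3)) ⟩
  (a + b + d + (c ⊓ 3)) ⊓ 3           ≡⟨ ≈-+ʳ (a + b + d) c ⟩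
  (a + b + d + c) ⊓ 3                 ≡⟨ cong (_⊓ 3) (sym (swap c)) ⟩
  (a + (b + c) + d) ⊓ 3               ∎
  where
  open ≡-Reasoning
  swap : ∀ x → a + (b + x) + d ≡ a + b + d + x
  swap x = trans (cong (_+ d) (sym (+-assoc a b x)))
    (trans (+-assoc (a + b) x d) (trans (cong (a + b +_) (+-comm x d)) (sym (+-assoc (a + b) d x))))

ok-reduce⁺ : ∀ a i → Ok a i → Ok a (reduce i)
ok-reduce⁺ a (info b c m t d) (p , q , r) =
  ≈-≤ (s≤s (s≤s z≤n)) (sym (sum₃-≈ a ⟨ b ⟩ c m)) p ,
  ≈-≤ ≤-refl (sym (sum₃-≈ a ⟨ b ⟩ c t)) q , ≈-≤ ≤-refl (sym (sum₃-≈ a ⟨ b ⟩ c d)) r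

ok-reduce⁻ : ∀ a i → Ok a (reduce i) → Ok a i
ok-reduce⁻ a (info b c m t d) (p , q , r) =
  ≈-≤ (s≤s (s≤s z≤n)) (sum₃-≈ a ⟨ b ⟩ c m) p ,
  ≈-≤ ≤-refl (sum₃-≈ a ⟨ b ⟩ c t) q , ≈-≤ ≤-refl (sum₃-≈ a ⟨ b ⟩ c d) r

merge-reduce : ∀ i j → reduce (merge (reduce i) (reduce j)) ≡ reduce (merge i j)
merge-reduce (info b c m t d) (info b′ c′ m′ t′ d′)
  rewrite ≈-+ʳ ⟨ b′ ⟩ c | ≈-⊓ {c′ ⊓ 3} {c′} {m ⊓ 3} {m} (≈-reduce c′) (≈-reduce m)
        | ≈-⊓ {t ⊓ 3} {t} {(m ⊓ 3) + (c′ ⊓ 3)} {m + c′} (≈-reduce t) (trans (≈-+ʳ (m ⊓ 3) c′) (≈-+ˡ m c′))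
        | ≈-⊓ {(c′ ⊓ 3) + (m′ ⊓ 3)} {c′ + m′} {d ⊓ 3} {d} (trans (≈-+ʳ (c′ ⊓ 3) m′) (≈-+ˡ c′ m′)) (≈-reduce d) = refl

-- `f` will be `encode`, which cannot tell a state from its saturation.
joinᴵ-reduce : ∀ {S : Set} (f : Info → S) → (∀ i → f (reduce i) ≡ f i) → ∀ i j →
               Maybe.map f (joinᴵ (reduce i) (reduce j)) ≡ Maybe.map f (joinᴵ i j)
joinᴵ-reduce f f-reduce i j with ok? ⟨ own i ⟩ (reduce j) | ok? ⟨ own i ⟩ j
... | yes _  | yes _  = cong just (begin
  f (merge (reduce i) (reduce j))           ≡⟨ sym (f-reduce _) ⟩
  f (reduce (merge (reduce i) (reduce j)))  ≡⟨ cong f (merge-reduce i j) ⟩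
  f (reduce (merge i j))                    ≡⟨ f-reduce _ ⟩
  f (merge i j)                             ∎)
  where open ≡-Reasoning
... | yes ok | no ¬ok = contradiction (ok-reduce⁻ ⟨ own i ⟩ j ok) ¬ok
... | no ¬ok | yes ok = contradiction (ok-reduce⁺ ⟨ own i ⟩ j ok) ¬ok
... | no _   | no _   = refl

saturate : ℕ → Fin 4
saturate 0 = zero
saturate 1 = suc zero
saturate 2 = suc (suc zero)
saturate (suc (suc (suc _))) = suc (suc (suc zero))

toℕ-saturate : ∀ a → toℕ (saturate a) ≡ a ⊓ 3
toℕ-saturate 0 = refl
toℕ-saturate 1 = refl
toℕ-saturate 2 = refl
toℕ-saturate (suc (suc (suc a))) = cong (3 +_) (sym (⊓-zeroʳ a))

saturate-⊓ : ∀ a → saturate (a ⊓ 3) ≡ saturate a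
saturate-⊓ 0 = refl
saturate-⊓ 1 = refl
saturate-⊓ 2 = refl
saturate-⊓ (suc (suc (suc a))) = refl

bit : Bool → Fin 2
bit false = zero
bit true  = suc zero

unbit : Fin 2 → Bool
unbit zero       = false
unbit (suc zero) = true

unbit-bit : ∀ b → unbit (bit b) ≡ b
unbit-bit false = refl
unbit-bit true  = refl

module _ {q : ℕ} where

  -- Mixed radix with membership as the lowest digit: if all other digits vanish, the code is the
  -- membership bit.
  pack : Fin q → Fin q → Fin q → Fin q → Fin 2 → Fin (q * q * q * q * 2)
  pack c m t d b = combine (combine (combine (combine c m) t) d) b

  unpack₂ : Fin (q * q) → Fin q × Fin q
  unpack₂ = remQuot q

  unpack₃ : Fin (q * q * q) → (Fin q × Fin q) × Fin q
  unpack₃ s = Product.map₁ unpack₂ (remQuot q s)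

  unpack₄ : Fin (q * q * q * q) → ((Fin q × Fin q) × Fin q) × Fin q
  unpack₄ s = Product.map₁ unpack₃ (remQuot q s)

  unpack : Fin (q * q * q * q * 2) → (((Fin q × Fin q) × Fin q) × Fin q) × Fin 2
  unpack s = Product.map₁ unpack₄ (remQuot 2 s)

  unpack-pack : ∀ c m t d b → unpack (pack c m t d b) ≡ ((((c , m) , t) , d) , b)
  unpack-pack c m t d b =
    trans (cong (Product.map₁ unpack₄) (remQuot-combine {k = 2} (combine (combine (combine c m) t) d) b)) (cong (_, b)
    (trans (cong (Product.map₁ unpack₃) (remQuot-combine {k = q} (combine (combine c m) t) d)) (cong (_, d)
    (trans (cong (Product.map₁ unpack₂) (remQuot-combine {k = q} (combine c m) t)) (cong (_, t)
    (remQuot-combine {k = q} c m))))))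

-- Opaque so that nothing enumerates the 512 states.
opaque
  States : ℕ
  States = 4 * 4 * 4 * 4 * 2

  -- The minima are stored upside down, so that the two initial states get the
  -- codes 0 and 1 and the table of final states is the output.
  encode : Info → Fin States
  encode (info b c m t d) =
    pack (saturate c) (opposite (saturate m)) (opposite (saturate t)) (opposite (saturate d)) (bit b)

  unfold : (((Fin 4 × Fin 4) × Fin 4) × Fin 4) × Fin 2 → Info
  unfold ((((c , m) , t) , d) , b) = info (unbit b) (toℕ c) (toℕ (opposite m)) (toℕ (opposite t)) (toℕ (opposite d))

  decode : Fin States → Info
  decode s = unfold (unpack {4} s)

  decode-encode : ∀ i → decode (encode i) ≡ reduce i
  decode-encode (info b c m t d) = trans
    (cong unfold (unpack-pack {4} (saturate c) (opposite (saturate m)) (opposite (saturate t)) (opposite (saturate d)) (bit b)))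
    same
    where
    same : unfold ((((saturate c , opposite (saturate m)) , opposite (saturate t)) , opposite (saturate d)) , bit b)
           ≡ reduce (info b c m t d)
    same rewrite opposite-involutive (saturate m) | opposite-involutive (saturate t) | opposite-involutive (saturate d)
          | toℕ-saturate c | toℕ-saturate m | toℕ-saturate t | toℕ-saturate d | unbit-bit b = refl

  encode-reduce : ∀ i → encode (reduce i) ≡ encode i
  encode-reduce (info b c m t d)
    rewrite saturate-⊓ c | saturate-⊓ m | saturate-⊓ t | saturate-⊓ d = refl

  iniꟳ : Bool → Fin States
  iniꟳ b = encode (iniᴵ b)

  joinꟳ : Fin States → Fin States → Maybe (Fin States)
  joinꟳ a b = Maybe.map encode (joinᴵ (decode a) (decode b))

  acceptꟳ : Fin States → Bool
  acceptꟳ s = does (ok? 0 (decode s))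

  accept⁺ : ∀ i → Ok 0 i → acceptꟳ (encode i) ≡ true
  accept⁺ i ok = dec-true (ok? 0 (decode (encode i))) (subst (Ok 0) (sym (decode-encode i)) (ok-reduce⁺ 0 i ok))

  accept⁻ : ∀ i → acceptꟳ (encode i) ≡ true → Ok 0 i
  accept⁻ i acc = ok-reduce⁻ 0 i (subst (Ok 0) (decode-encode i) (witness (ok? 0 (decode (encode i))) acc))
    where
    witness : ∀ {A : Set} (A? : Dec A) → does A? ≡ true → A
    witness (yes a) _ = a

  joinꟳ-encode : ∀ i j → joinꟳ (encode i) (encode j) ≡ Maybe.map encode (joinᴵ i j)
  joinꟳ-encode i j = trans
    (cong₂ (λ a b → Maybe.map encode (joinᴵ a b)) (decode-encode i) (decode-encode j))
    (joinᴵ-reduce encode encode-reduce i j)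

  state-encode : ∀ {n} (t : Tree n) L → state iniꟳ joinꟳ t L ≡ Maybe.map encode (state iniᴵ joinᴵ t L)
  state-encode = state-map iniᴵ joinᴵ joinꟳ encode joinꟳ-encode

  ini-code : ∀ b → toℕ (iniꟳ b) ≡ ⟨ b ⟩
  ini-code false = refl
  ini-code true  = refl

-- Domination in rooted trees

tally-++ : ∀ {n} (L : Fin n → Bool) xs ys → tally L (xs ++ ys) ≡ tally L xs + tally L ys
tally-++ L xs ys = trans (cong sum (map-++ _ xs ys)) (sum-++ (map _ xs) _)

two-members : ∀ {n} (p : Subset n) → 2 ≤ ∣ p ∣ → Σ[ a ∈ Fin n ] Σ[ b ∈ Fin n ] a ≢ b × a ∈ₛ p × b ∈ₛ p
two-members {n} p 2≤ = a , b , (λ a≡b → x∉p-x p a (subst (_∈ₛ (p - a)) (sym a≡b) b∈)) , a∈ , p─q⊆p p _ b∈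
  where
  member : ∀ (q : Subset n) → 1 ≤ ∣ q ∣ → Σ[ a ∈ Fin n ] a ∈ₛ q
  member q 1≤ with nonempty? q
  ... | yes ne = ne
  ... | no  em = contradiction (subst (1 ≤_) (trans (cong ∣_∣ (Empty-unique em)) (∣⊥∣≡0 n)) 1≤) λ ()
  first-member = member p (≤-trans (s≤s z≤n) 2≤)
  a = proj₁ first-member
  a∈ = proj₂ first-member
  second-member = member (p - a) (s≤s⁻¹ (≤-trans 2≤ (∣p∣≤1+∣p-x∣ p a)))
  b = proj₁ second-member
  b∈ = proj₂ second-member

⊆∧∣∣≥⇒⊇ : ∀ {n} {p q : Subset n} → p ⊆ q → ∣ q ∣ ≤ ∣ p ∣ → q ⊆ p
⊆∧∣∣≥⇒⊇ {p = p} p⊆q le {x} x∈q with x ∈? p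
... | yes x∈p = x∈p
... | no  x∉p = contradiction (p⊂q⇒∣p∣<∣q∣ (p⊆q , x , x∈q , x∉p)) (≤⇒≯ le)

allPairs-lookup : ∀ {A : Set} {R : A → A → Set} → (∀ {x y} → R x y → R y x) →
                  ∀ {xs x y} → AllPairs R xs → x ∈ xs → y ∈ xs → x ≢ y → R x y
allPairs-lookup s (r ∷ rs) (here refl) (here refl) x≢y = contradiction refl x≢y
allPairs-lookup s (r ∷ rs) (here refl) (there y∈)  x≢y = All.lookup r y∈
allPairs-lookup s (r ∷ rs) (there x∈)  (here refl) x≢y = s (All.lookup r x∈)
allPairs-lookup s (r ∷ rs) (there x∈)  (there y∈)  x≢y = allPairs-lookup s rs x∈ y∈ x≢y

allPairs-tabulate : ∀ {A : Set} {R : A → A → Set} {xs} → Unique xs →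
                    (∀ {x y} → x ∈ xs → y ∈ xs → x ≢ y → R x y) → AllPairs R xs
allPairs-tabulate []       f = []
allPairs-tabulate (x∉ ∷ u) f =
  All.tabulate (λ y∈ → f (here refl) (there y∈) (All.lookup x∉ y∈)) ∷
  allPairs-tabulate u (λ x∈ y∈ → f (there x∈) (there y∈))

module _ {n : ℕ} where

  private
    V : Set
    V = Fin n

  -- A list of at most one entry, so that the root, which has none, fits the same counting formulas.
  parents : List (V × V) → V → List V
  parents []            x = []
  parents ((p , v) ∷ r) x with x ≟ v
  ... | yes _ = p ∷ []
  ... | no  _ = parents r x

  parents⁺ : ∀ r {p v} → (p , v) ∈ r → Σ[ q ∈ V ] parents r v ≡ q ∷ [] × (q , v) ∈ r
  parents⁺ ((q , u) ∷ r) {v = v} e with v ≟ u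
  parents⁺ ((q , u) ∷ r) e           | yes refl = q , refl , here refl
  parents⁺ ((q , u) ∷ r) (here refl) | no ≢     = contradiction refl ≢
  parents⁺ ((q , u) ∷ r) (there e)   | no _ with parents⁺ r e
  ...   | q′ , eq , e′ = q′ , eq , there e′

  parents⁻ : ∀ r {p v} → p ∈ parents r v → (p , v) ∈ r
  parents⁻ ((q , u) ∷ r) {v = v} p∈ with v ≟ u
  parents⁻ ((q , u) ∷ r) (here refl) | yes refl = here refl
  ... | no _ = there (parents⁻ r p∈)

  parents-unique : ∀ r v → Unique (parents r v)
  parents-unique []            v = []
  parents-unique ((q , u) ∷ r) v with v ≟ u
  ... | yes _ = [] ∷ []
  ... | no _  = parents-unique r v

  module _ {root : V} {Adj : V → V → Set} where

    -- The time of discovery. Parents come strictly before children, which is how the pieces of a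
    -- neighbourhood are shown not to overlap.
    rank : List (V × V) → V → ℕ
    rank []            x = 0
    rank ((p , v) ∷ h) x with x ≟ v
    ... | yes _ = suc (length h)
    ... | no _  = rank h x

    rank≤ : ∀ h x → rank h x ≤ length h
    rank≤ []            x = z≤n
    rank≤ ((p , v) ∷ h) x with x ≟ v
    ... | yes _ = ≤-refl
    ... | no _  = m≤n⇒m≤1+n (rank≤ h x)

    rank-mono : ∀ {h p v} → Grown root Adj h → (p , v) ∈ h → rank h p < rank h v
    rank-mono {(p , v) ∷ h} (add _ p∈ v∉ g) (here refl) with p ≟ v | v ≟ v
    ... | yes refl | _     = contradiction p∈ v∉
    ... | no _     | yes _ = s≤s (rank≤ h p)
    ... | no _     | no ≢  = contradiction refl ≢
    rank-mono {(q , u) ∷ h} {p} {v} (add _ _ u∉ g) (there e) with p ≟ u | v ≟ u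
    ... | yes refl | _        = contradiction (edge⇒parent∈ root Adj g e) u∉
    ... | no _     | yes refl = contradiction (edge⇒∈ root h e) u∉
    ... | no _     | no _     = rank-mono g e

    parent-unique : ∀ {h p q v} → Grown root Adj h → (p , v) ∈ h → (q , v) ∈ h → p ≡ q
    parent-unique {h} g e e′ with edge⇒At root h e | edge⇒At root h e′
    ... | _ , a | _ , b = toℕ-injective (proj₂ (At-functional root Adj g a b))

    root-parentless : ∀ {h p} → Grown root Adj h → (p , root) ∉ h
    root-parentless {h} {p} g e with edge⇒At root h e
    ... | _ , a = <-irrefl (proj₂ (At-functional root Adj g a (start h))) (toℕ<n p)
      where
      start : ∀ h → At root h 0 (n , root)
      start []      = first
      start (e ∷ h) = older (start h)

    ∈verts⇒ : ∀ h {x} → x ∈ verts root h → x ≡ root ⊎ Σ[ p ∈ V ] (p , x) ∈ h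
    ∈verts⇒ []            (here refl) = inj₁ refl
    ∈verts⇒ ((p , v) ∷ h) (here refl) = inj₂ (p , here refl)
    ∈verts⇒ (e ∷ h)       (there x∈) with ∈verts⇒ h x∈
    ... | inj₁ eq       = inj₁ eq
    ... | inj₂ (p , e′) = inj₂ (p , there e′)

    children-unique : ∀ s {h} x → Grown root Adj (s ʳ++ h) → Unique (children s x)
    children-unique []            x g = []
    children-unique ((p , v) ∷ s) x g with x ≟ p
    ... | no _  = children-unique s x g
    ... | yes _ = ¬Any⇒All¬ _ (λ v∈ → child-fresh s g (children⁻ s v∈) (here refl)) ∷ children-unique s x g

    -- The trees rooted at the vertices of h partition the vertices.
    weights : List (V × V) → List (V × V) → (V → Bool) → ℕ
    weights h r L = sum (map (λ x → weight (forest r x) L) (verts root h))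

    sum-update : ∀ (f g : V → ℕ) {p c} xs → Unique xs → p ∈ xs → f p ≡ g p + c →
                 (∀ {x} → x ≢ p → f x ≡ g x) → sum (map f xs) ≡ c + sum (map g xs)
    sum-update f g {p} {c} (x ∷ xs) (x∉ ∷ u) (here refl) fp fx = begin
      f p + sum (map f xs)        ≡⟨ cong₂ _+_ (trans fp (+-comm _ c)) (same xs λ y∈ y≡p → All.lookup x∉ y∈ (sym y≡p)) ⟩
      c + g p + sum (map g xs)    ≡⟨ +-assoc c _ _ ⟩
      c + (g p + sum (map g xs))  ∎
      where
      open ≡-Reasoning
      same : ∀ ys → (∀ {y} → y ∈ ys → y ≢ p) → sum (map f ys) ≡ sum (map g ys)
      same []       ne = refl
      same (y ∷ ys) ne = cong₂ _+_ (fx (ne (here refl))) (same ys (λ y∈ → ne (there y∈)))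
    sum-update f g {p} {c} (x ∷ xs) (x∉ ∷ u) (there p∈) fp fx = begin
      f x + sum (map f xs)        ≡⟨ cong₂ _+_ (fx (All.lookup x∉ p∈)) (sum-update f g xs u p∈ fp fx) ⟩
      g x + (c + sum (map g xs))  ≡⟨ sym (+-assoc (g x) c _) ⟩
      g x + c + sum (map g xs)    ≡⟨ cong (_+ sum (map g xs)) (+-comm (g x) c) ⟩
      c + g x + sum (map g xs)    ≡⟨ +-assoc c _ _ ⟩
      c + (g x + sum (map g xs))  ∎
      where open ≡-Reasoning

    -- Undoing a graft takes the weight of `v` out of the tree of `p` and lists `v` as a root of its
    -- own, so the total stays the same until only single vertices are left.
    weights≡ : ∀ r h L → Grown root Adj (r ʳ++ h) → weights h r L ≡ tally L (verts root (r ʳ++ h))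
    weights≡ []            h L g = refl
    weights≡ ((p , v) ∷ r) h L g with grown-suffix r g
    ... | add _ p∈ v∉ g′ = trans
      (sum-update (λ x → weight (forest ((p , v) ∷ r) x) L) (λ x → weight (forest r x) L) (verts root h)
        (grown-unique root Adj g′) p∈ (cong (λ t → weight t L) (forest-parent p v r))
        (λ x≢p → cong (λ t → weight t L) (forest-other r x≢p)))
      (weights≡ r ((p , v) ∷ h) L g)

-- Domination as constraints on parents and children

module Constraints {k : ℕ} (G : Graph (suc k)) (acyclic : Acyclic G) (full : List (Fin (suc k) × Fin (suc k)))
  (grown : Grown zero (Graph.Adj G) (full ʳ++ [])) (complete : ∀ x → x ∈ verts zero (full ʳ++ [])) where
  open Graph G using (Adj; adj?; irrefl) renaming (sym to adj-sym)

  private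
    n : ℕ
    n = suc k
    V : Set
    V = Fin n
    ρ : V → ℕ
    ρ = rank {root = zero} {Adj} (full ʳ++ [])

  Child : V → V → Set
  Child v w = (v , w) ∈ full

  toH : ∀ {e} → e ∈ full → e ∈ full ʳ++ []
  toH = reverse⁺

  fromH : ∀ {e} → e ∈ full ʳ++ [] → e ∈ full
  fromH = reverse⁻ {xs = full}

  same-parent : ∀ {p q v} → Child p v → Child q v → p ≡ q
  same-parent e e′ = parent-unique grown (toH e) (toH e′)

  ρ-mono : ∀ {v w} → Child v w → ρ v < ρ w
  ρ-mono e = rank-mono grown (toH e)

  child-adj : ∀ {v w} → Child v w → Adj v w
  child-adj e = edge⇒adj zero Adj grown (toH e)

  adj-child : ∀ {v w} → Adj v w → Child v w ⊎ Child w v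
  adj-child vw with adj⇒edge G zero acyclic grown (complete _) (complete _) vw
  ... | inj₁ e = inj₁ (fromH e)
  ... | inj₂ e = inj₂ (fromH e)

  up down ball : V → List V
  up     = parents full
  down   = children full
  ball v = up v ++ v ∷ down v

  ball-split : ∀ {u v} → u ∈ ball v → Child u v ⊎ u ≡ v ⊎ Child v u
  ball-split {v = v} u∈ with ∈-++⁻ (up v) u∈
  ... | inj₁ u∈up         = inj₁ (parents⁻ full u∈up)
  ... | inj₂ (here refl)  = inj₂ (inj₁ refl)
  ... | inj₂ (there u∈ch) = inj₂ (inj₂ (children⁻ full u∈ch))

  up-∈ : ∀ {u v} → Child u v → up v ≡ u ∷ []
  up-∈ e with parents⁺ full e
  ... | q , eq , e′ with same-parent e e′
  ...   | refl = eq

  ball⁺ : ∀ {u v} → Child u v ⊎ u ≡ v ⊎ Child v u → u ∈ ball v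
  ball⁺ {u} {v} (inj₁ e)       = ∈-++⁺ˡ (subst (u ∈_) (sym (up-∈ e)) (here refl))
  ball⁺ {v = v} (inj₂ (inj₁ refl)) = ∈-++⁺ʳ (up v) (here refl)
  ball⁺ {v = v} (inj₂ (inj₂ e)) = ∈-++⁺ʳ (up v) (there (children⁺ full e))

  N⇒ball : ∀ {u v} → u ∈ₛ N[_] G v → u ∈ ball v
  N⇒ball {u} {v} u∈ with x∈p∪q⁻ (N⟨_⟩ G v) ⁅ v ⁆ u∈
  ... | inj₂ u∈v = ball⁺ (inj₂ (inj₁ (x∈⁅y⁆⇒x≡y v u∈v)))
  ... | inj₁ u∈N with adj? u v | trans (sym (lookup∘tabulate (λ u → does (adj? u v)) u)) ([]=⇒lookup u∈N)
  ...   | yes uv | _ = ball⁺ ([ inj₁ , (λ e → inj₂ (inj₂ e)) ]′ (adj-child uv))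

  adj⇒N : ∀ {u v} → Adj u v → u ∈ₛ N⟨_⟩ G v
  adj⇒N {u} {v} uv = lookup⇒[]= u _ (trans (lookup∘tabulate (λ u → does (adj? u v)) u) (dec-true (adj? u v) uv))

  ball⇒N : ∀ {u v} → u ∈ ball v → u ∈ₛ N[_] G v
  ball⇒N {u} {v} u∈ with ball-split u∈
  ... | inj₁ e           = x∈p∪q⁺ (inj₁ (adj⇒N (child-adj e)))
  ... | inj₂ (inj₁ refl) = x∈p∪q⁺ (inj₂ (x∈⁅x⁆ v))
  ... | inj₂ (inj₂ e)    = x∈p∪q⁺ (inj₁ (adj⇒N (adj-sym (child-adj e))))

  -- The parent of `w` is `v`, and `w` is itself a child of `v`; beyond `ball v` the edge reaches
  -- only the children of `w`.
  edge⁻ : ∀ {u v w} → Child v w → u ∈ ball v ⊎ u ∈ ball w → u ∈ ball v ++ down w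
  edge⁻ e (inj₁ u∈) = ∈-++⁺ˡ u∈
  edge⁻ {v = v} e (inj₂ u∈) with ball-split u∈
  ... | inj₁ e′ with same-parent e e′
  ...   | refl             = ∈-++⁺ˡ (ball⁺ (inj₂ (inj₁ refl)))
  edge⁻ {v = v} e (inj₂ u∈) | inj₂ (inj₁ refl) = ∈-++⁺ˡ (ball⁺ (inj₂ (inj₂ e)))
  edge⁻ {v = v} e (inj₂ u∈) | inj₂ (inj₂ e′)   = ∈-++⁺ʳ (ball v) (children⁺ full e′)

  edge⁺ : ∀ {u v w} → u ∈ ball v ++ down w → u ∈ ball v ⊎ u ∈ ball w
  edge⁺ {v = v} u∈ with ∈-++⁻ (ball v) u∈
  ... | inj₁ u∈v = inj₁ u∈v
  ... | inj₂ u∈w = inj₂ (ball⁺ (inj₂ (inj₂ (children⁻ full u∈w))))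

  -- Every edge is read from parent to child; `oriented` retains how its source and target were
  -- given, for the comparison by `SameEdge`.
  record Ends (e : Edge G) : Set where
    field
      v w      : V
      child    : Child v w
      to       : ∀ {u} → u ∈ₛ Nₑ[_] G e → u ∈ ball v ++ down w
      from     : ∀ {u} → u ∈ ball v ++ down w → u ∈ₛ Nₑ[_] G e
      oriented : (Edge.source e ≡ v × Edge.target e ≡ w) ⊎ (Edge.source e ≡ w × Edge.target e ≡ v)

  ends : ∀ e → Ends e
  ends (edge x y xy) with adj-child xy
  ... | inj₁ e = record
    { v = x ; w = y ; child = e
    ; to = λ u∈ → edge⁻ e ([ (λ p → inj₁ (N⇒ball p)) , (λ p → inj₂ (N⇒ball p)) ]′ (x∈p∪q⁻ (N[_] G x) (N[_] G y) u∈))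
    ; from = λ u∈ → x∈p∪q⁺ ([ (λ p → inj₁ (ball⇒N p)) , (λ p → inj₂ (ball⇒N p)) ]′ (edge⁺ {v = x} {y} u∈))
    ; oriented = inj₁ (refl , refl) }
  ... | inj₂ e = record
    { v = y ; w = x ; child = e
    ; to = λ u∈ → edge⁻ e ([ (λ p → inj₂ (N⇒ball p)) , (λ p → inj₁ (N⇒ball p)) ]′ (x∈p∪q⁻ (N[_] G x) (N[_] G y) u∈))
    ; from = λ u∈ → x∈p∪q⁺ ([ (λ p → inj₂ (ball⇒N p)) , (λ p → inj₁ (ball⇒N p)) ]′ (edge⁺ {v = y} {x} u∈))
    ; oriented = inj₂ (refl , refl) }

  down-unique : ∀ v → Unique (down v)
  down-unique v = children-unique full v grown

  down-disjoint : ∀ {v w} → v ≢ w → Disjoint (down v) (down w)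
  down-disjoint v≢w (a , b) = v≢w (same-parent (children⁻ full a) (children⁻ full b))

  ball-unique : ∀ v → Unique (ball v)
  ball-unique v = Unique.++⁺ (parents-unique full v)
    (¬Any⇒All¬ _ (λ v∈ → <-irrefl refl (ρ-mono (children⁻ full v∈))) ∷ down-unique v)
    λ { (a , here refl) → <-irrefl refl (ρ-mono (parents⁻ full a))
      ; (a , there b)   → <-asym (ρ-mono (parents⁻ full a)) (ρ-mono (children⁻ full b)) }

  -- The vertex `v` and its parent are too early to be children of `w`, and a common child would
  -- make `v` and `w` equal.
  ball-disjoint : ∀ {v w} → ρ v < ρ w → Disjoint (ball v) (down w)
  ball-disjoint v<w (a , b) with ball-split a
  ... | inj₁ e           = <-asym (<-trans (ρ-mono e) v<w) (ρ-mono (children⁻ full b))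
  ... | inj₂ (inj₁ refl) = <-asym v<w (ρ-mono (children⁻ full b))
  ... | inj₂ (inj₂ e)    = <-irrefl (cong ρ (same-parent e (children⁻ full b))) v<w

  one-unique : ∀ {v w} → ρ v < ρ w → Unique (ball v ++ down w)
  one-unique {v} {w} v<w = Unique.++⁺ (ball-unique v) (down-unique w) (ball-disjoint v<w)

  two-unique : ∀ {v w y} → ρ v < ρ w → ρ v < ρ y → w ≢ y → Unique (ball v ++ down w ++ down y)
  two-unique {v} {w} {y} v<w v<y w≢y = Unique.++⁺ (ball-unique v)
    (Unique.++⁺ (down-unique w) (down-unique y) (down-disjoint w≢y))
    λ (a , b) → [ (λ b → ball-disjoint v<w (a , b)) , (λ b → ball-disjoint v<y (a , b)) ]′ (∈-++⁻ (down w) b)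

  module _ (L : V → Bool) where

    C S : V → ℕ
    C w = tally L (down w)
    S v = tally L (up v) + (⟨ L v ⟩ + C v)

    -- `siblings` and `chain` are the two ways in which distinct edges of a rooted tree can share an
    -- end. So the bound 3 is imposed on adjacent edges only; for all other pairs it has to be
    -- derived.
    record Local : Set where
      field
        single   : ∀ {v w} → Child v w → 2 ≤ S v + C w
        siblings : ∀ {v w y} → Child v w → Child v y → w ≢ y → 3 ≤ S v + (C w + C y)
        chain    : ∀ {v w y} → Child v w → Child w y → 3 ≤ S v + (C w + C y)

    AllOk : Set
    AllOk = Fine {root = zero} {Adj} L full full × Ok 0 (summary {root = zero} {Adj} L full zero (down zero))

    no-up : tally L (up zero) ≡ 0
    no-up with up zero in eq
    ... | []    = refl
    ... | p ∷ _ = contradiction (toH (parents⁻ full (subst (p ∈_) (sym eq) (here refl)))) (root-parentless grown)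

    allOk⇒ok : AllOk → ∀ v → Ok (tally L (up v)) (summary {root = zero} {Adj} L full v (down v))
    allOk⇒ok (fine , ok₀) v with ∈verts⇒ {Adj = Adj} (full ʳ++ []) (complete v)
    ... | inj₂ (p , e) rewrite up-∈ (fromH e) =
      subst (λ a → Ok a (summary {root = zero} {Adj} L full v (down v))) (sym (+-identityʳ ⟨ L p ⟩)) (fine (fromH e))
    ... | inj₁ refl = subst (λ a → Ok a (summary {root = zero} {Adj} L full zero (down zero))) (sym no-up) ok₀

    ok⇒allOk : (∀ v → Ok (tally L (up v)) (summary {root = zero} {Adj} L full v (down v))) → AllOk
    ok⇒allOk ok = (λ {p} {v} e → subst (λ a → Ok a (summary {root = zero} {Adj} L full v (down v)))
                     (trans (cong (tally L) (up-∈ e)) (+-identityʳ ⟨ L p ⟩)) (ok v)) ,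
      subst (λ a → Ok a (summary {root = zero} {Adj} L full zero (down zero))) no-up (ok zero)

    allOk⇒local : AllOk → Local
    allOk⇒local all = record
      { single   = λ {v} {w} e → All.lookup (least⁻ C (S v) (down v) (proj₁ (allOk⇒ok all v))) (children⁺ full e)
      ; siblings = λ {v} {w} {y} e e′ w≢y → allPairs-lookup
          (λ {w} {y} → subst (λ s → 3 ≤ S v + s) (+-comm (C w) (C y)))
          (least-two⁻ C (S v) (down v) (proj₁ (proj₂ (allOk⇒ok all v)))) (children⁺ full e) (children⁺ full e′) w≢y
      ; chain    = λ {v} {w} {y} e e′ → subst (3 ≤_) (+-assoc (S v) (C w) (C y))
          (All.lookup (least⁻ C (S v + C w) (down w) (subst (3 ≤_) (sym (+-assoc (S v) (C w) _))
            (All.lookup (least⁻ (λ w → C w + least C (down w)) (S v) (down v) (proj₂ (proj₂ (allOk⇒ok all v)))) (children⁺ full e))))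
            (children⁺ full e′))
      }

    local⇒allOk : Local → AllOk
    local⇒allOk l = ok⇒allOk λ v →
      least⁺ C (s≤s (s≤s z≤n)) (S v) (down v) (All.tabulate λ w∈ → single (children⁻ full w∈)) ,
      least-two⁺ C ≤-refl (S v) (down v) (allPairs-tabulate (down-unique v)
        λ w∈ y∈ → siblings (children⁻ full w∈) (children⁻ full y∈)) ,
      least⁺ (λ w → C w + least C (down w)) ≤-refl (S v) (down v) (All.tabulate λ {w} w∈ →
        subst (3 ≤_) (+-assoc (S v) (C w) _) (least⁺ C ≤-refl (S v + C w) (down w) (All.tabulate λ {y} y∈ →
          subst (3 ≤_) (sym (+-assoc (S v) (C w) (C y))) (chain (children⁻ full w∈) (children⁻ full y∈)))))
      where open Local l

    tally-ball : ∀ v ws → tally L (ball v ++ ws) ≡ S v + tally L ws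
    tally-ball v ws = trans (tally-++ L (ball v) ws) (cong (_+ tally L ws) (tally-++ L (up v) (v ∷ down v)))

    tally-two : ∀ v w y → tally L (ball v ++ down w ++ down y) ≡ S v + (C w + C y)
    tally-two v w y = trans (tally-ball v _) (cong (S v +_) (tally-++ L (down w) (down y)))

  -- A common vertex of the edges (v , w) and (v′ , w′), written parent first,
  -- which are not within distance one: it is the parent of v or of v′, and
  -- if it is not both, that end is strictly deeper than the other one.
  Common : V → V → V → Set
  Common v v′ a = (Child a v × Child a v′) ⊎ (Child a v′ × ρ v < ρ v′) ⊎ (Child a v × ρ v′ < ρ v)

  common-unique : ∀ {v v′ a b} → Common v v′ a → Common v v′ b → a ≡ b
  common-unique (inj₁ (p , _))        (inj₁ (q , _))        = same-parent p q
  common-unique (inj₁ (_ , p))        (inj₂ (inj₁ (q , _))) = same-parent p q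
  common-unique (inj₁ (p , _))        (inj₂ (inj₂ (q , _))) = same-parent p q
  common-unique (inj₂ (inj₁ (p , _))) (inj₁ (_ , q))        = same-parent p q
  common-unique (inj₂ (inj₁ (p , _))) (inj₂ (inj₁ (q , _))) = same-parent p q
  common-unique (inj₂ (inj₁ (_ , l))) (inj₂ (inj₂ (_ , g))) = contradiction g (<-asym l)
  common-unique (inj₂ (inj₂ (p , _))) (inj₁ (q , _))        = same-parent p q
  common-unique (inj₂ (inj₂ (_ , g))) (inj₂ (inj₁ (_ , l))) = contradiction g (<-asym l)
  common-unique (inj₂ (inj₂ (p , _))) (inj₂ (inj₂ (q , _))) = same-parent p q

  edge-split : ∀ {u v w} → u ∈ ball v ++ down w → Child u v ⊎ u ≡ v ⊎ Child v u ⊎ Child w u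
  edge-split {v = v} u∈ with ∈-++⁻ (ball v) u∈
  ... | inj₂ u∈w = inj₂ (inj₂ (inj₂ (children⁻ full u∈w)))
  ... | inj₁ u∈v with ball-split u∈v
  ...   | inj₁ e        = inj₁ e
  ...   | inj₂ (inj₁ e) = inj₂ (inj₁ e)
  ...   | inj₂ (inj₂ e) = inj₂ (inj₂ (inj₁ e))

  child? : ∀ v w → Dec (Child v w)
  child? v w with adj? v w
  ... | no ¬vw = no λ e → ¬vw (child-adj e)
  ... | yes vw with adj-child vw
  ...   | inj₁ e = yes e
  ...   | inj₂ e = no λ e′ → <-asym (ρ-mono e) (ρ-mono e′)

  -- The positions of a second edge whose upper end lies on the first edge or is a child of one of
  -- its ends; the mirrored positions arise by exchanging the edges.
  Close : V → V → V → V → Set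
  Close v w v′ w′ = v ≡ v′ ⊎ v′ ≡ w ⊎ Child v v′ ⊎ Child w v′

  close? : ∀ v w v′ w′ → Dec (Close v w v′ w′)
  close? v w v′ w′ = (v ≟ v′) ⊎-dec (v′ ≟ w) ⊎-dec child? v v′ ⊎-dec child? w v′

  -- If `a` is `v` or `v′`, or is the parent of neither, then the edges are close or have the same
  -- lower end. In the remaining cases a required rank inequality is read off the path through `a`.
  common : ∀ {v w v′ w′ a} → Child v w → Child v′ w′ → w ≢ w′ →
           ¬ Close v w v′ w′ → ¬ Close v′ w′ v w →
           a ∈ ball v ++ down w → a ∈ ball v′ ++ down w′ → Common v v′ a
  common vw vw′ w≢w′ far far′ a∈ a∈′ with edge-split a∈ | edge-split a∈′
  ... | inj₁ p                       | inj₁ q                      = inj₁ (p , q)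
  ... | inj₁ p                       | inj₂ (inj₁ refl)            = contradiction (inj₂ (inj₂ (inj₁ p))) far′
  ... | inj₁ p                       | inj₂ (inj₂ (inj₁ q))        = inj₂ (inj₂ (p , <-trans (ρ-mono q) (ρ-mono p)))
  ... | inj₁ p                       | inj₂ (inj₂ (inj₂ q))        =
    inj₂ (inj₂ (p , <-trans (ρ-mono vw′) (<-trans (ρ-mono q) (ρ-mono p))))
  ... | inj₂ (inj₁ refl)             | inj₁ q                      = contradiction (inj₂ (inj₂ (inj₁ q))) far
  ... | inj₂ (inj₁ refl)             | inj₂ (inj₁ refl)            = contradiction (inj₁ refl) far
  ... | inj₂ (inj₁ refl)             | inj₂ (inj₂ (inj₁ q))        = contradiction (inj₂ (inj₂ (inj₁ q))) far′
  ... | inj₂ (inj₁ refl)             | inj₂ (inj₂ (inj₂ q))        = contradiction (inj₂ (inj₂ (inj₂ q))) far′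
  ... | inj₂ (inj₂ (inj₁ p))         | inj₁ q                      = inj₂ (inj₁ (q , <-trans (ρ-mono p) (ρ-mono q)))
  ... | inj₂ (inj₂ (inj₁ p))         | inj₂ (inj₁ refl)            = contradiction (inj₂ (inj₂ (inj₁ p))) far
  ... | inj₂ (inj₂ (inj₁ p))         | inj₂ (inj₂ (inj₁ q))        = contradiction (inj₁ (same-parent p q)) far
  ... | inj₂ (inj₂ (inj₁ p))         | inj₂ (inj₂ (inj₂ q))        = contradiction (inj₂ (inj₁ (same-parent p q))) far′
  ... | inj₂ (inj₂ (inj₂ p))         | inj₁ q                      =
    inj₂ (inj₁ (q , <-trans (ρ-mono vw) (<-trans (ρ-mono p) (ρ-mono q))))
  ... | inj₂ (inj₂ (inj₂ p))         | inj₂ (inj₁ refl)            = contradiction (inj₂ (inj₂ (inj₂ p))) far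
  ... | inj₂ (inj₂ (inj₂ p))         | inj₂ (inj₂ (inj₁ q))        = contradiction (inj₂ (inj₁ (sym (same-parent p q)))) far
  ... | inj₂ (inj₂ (inj₂ p))         | inj₂ (inj₂ (inj₂ q))        = contradiction (same-parent p q) w≢w′

  module _ (L : V → Bool) (X : Subset n) (X⇒L : ∀ {u} → u ∈ₛ X → L u ≡ true) (L⇒X : ∀ {u} → L u ≡ true → u ∈ₛ X) where
    private
      N₂ : Edge G → Subset n
      N₂ = Nₑ[_] G

    enough : ∀ {k} xs (p : Subset n) → Unique xs → (∀ {u} → u ∈ xs → u ∈ₛ p) → k ≤ tally L xs → k ≤ ∣ p ∩ X ∣
    enough xs p u xs⊆ le = ≤-trans le (tally≤∣∣ L (p ∩ X) u λ u∈ Lu → x∈p∩q⁺ (xs⊆ u∈ , L⇒X Lu))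

    at-most : ∀ {k} xs (p : Subset n) → (∀ {u} → u ∈ₛ p → u ∈ xs) → k ≤ ∣ p ∩ X ∣ → k ≤ tally L xs
    at-most xs p p⊆ le = ≤-trans le (∣∣≤tally L (p ∩ X) xs λ u∈ →
      let u∈p , u∈X = x∈p∩q⁻ p X u∈ in p⊆ u∈p , X⇒L u∈X)

    local⇒dominating : Local L → IsLiarsVEDominating G X
    local⇒dominating l = record { double = double ; triple = triple }
      where
      open Local l
      double : ∀ e → 2 ≤ ∣ N₂ e ∩ X ∣
      double e = enough (ball v ++ down w) (N₂ e) (one-unique (ρ-mono child)) from
        (subst (2 ≤_) (sym (tally-ball L v (down w))) (single child))
        where open Ends (ends e)
      close : ∀ e e′ → ¬ SameEdge G e e′ → let open Ends in
              Close (v (ends e)) (w (ends e)) (v (ends e′)) (w (ends e′)) → 3 ≤ ∣ (N₂ e ∪ N₂ e′) ∩ X ∣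
      close e e′ diff cl = by cl
        where
        open Ends (ends e)
        open Ends (ends e′) renaming (v to v′; w to w′; child to child′; to to to′; from to from′; oriented to oriented′)
        cover : ∀ y → (∀ {u} → u ∈ down y → u ∈ₛ N₂ e′) → ∀ {u} → u ∈ ball v ++ down w ++ down y → u ∈ₛ N₂ e ∪ N₂ e′
        cover y y⊆ u∈ with ∈-++⁻ (ball v) u∈
        ... | inj₁ u∈v = x∈p∪q⁺ (inj₁ (from (∈-++⁺ˡ u∈v)))
        ... | inj₂ u∈′ with ∈-++⁻ (down w) u∈′
        ...   | inj₁ u∈w = x∈p∪q⁺ (inj₁ (from (∈-++⁺ʳ (ball v) u∈w)))
        ...   | inj₂ u∈y = x∈p∪q⁺ (inj₂ (y⊆ u∈y))
        conclude : ∀ y → ρ v < ρ y → w ≢ y → (∀ {u} → u ∈ down y → u ∈ₛ N₂ e′) → 3 ≤ S L v + (C L w + C L y) →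
                   3 ≤ ∣ (N₂ e ∪ N₂ e′) ∩ X ∣
        conclude y v<y w≢y y⊆ le = enough (ball v ++ down w ++ down y) (N₂ e ∪ N₂ e′)
          (two-unique (ρ-mono child) v<y w≢y) (cover y y⊆) (subst (3 ≤_) (sym (tally-two L v w y)) le)
        lower : ∀ {u} → u ∈ down w′ → u ∈ₛ N₂ e′
        lower u∈ = from′ (∈-++⁺ʳ (ball v′) u∈)
        upper : ∀ {u} → u ∈ down v′ → u ∈ₛ N₂ e′
        upper u∈ = from′ (∈-++⁺ˡ (ball⁺ (inj₂ (inj₂ (children⁻ full u∈)))))
        same-edge : v ≡ v′ → w ≡ w′ → SameEdge G e e′
        same-edge vv ww with oriented | oriented′
        ... | inj₁ (a , b) | inj₁ (c , d) = inj₁ (trans a (trans vv (sym c)) , trans b (trans ww (sym d)))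
        ... | inj₁ (a , b) | inj₂ (c , d) = inj₂ (trans a (trans vv (sym d)) , trans b (trans ww (sym c)))
        ... | inj₂ (a , b) | inj₁ (c , d) = inj₂ (trans a (trans ww (sym d)) , trans b (trans vv (sym c)))
        ... | inj₂ (a , b) | inj₂ (c , d) = inj₁ (trans a (trans ww (sym c)) , trans b (trans vv (sym d)))
        distinct : w ≢ w′
        distinct ww = diff (same-edge (same-parent child (subst (Child v′) (sym ww) child′)) ww)
        by : Close v w v′ w′ → 3 ≤ ∣ (N₂ e ∪ N₂ e′) ∩ X ∣
        by (inj₁ v≡v′) = conclude w′ (ρ-mono vw′) distinct lower (siblings child vw′ distinct)
          where vw′ = subst (λ x → Child x w′) (sym v≡v′) child′
        by (inj₂ (inj₁ v′≡w)) = conclude w′ (<-trans (ρ-mono child) (ρ-mono ww′)) distinct lower (chain child ww′)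
          where ww′ = subst (λ x → Child x w′) v′≡w child′
        -- The edge from `v` to `v′` is a sibling of the first edge, and the children of `v′` belong
        -- to the neighbourhood of the second, so the constraint on these siblings already yields
        -- three elements.
        by (inj₂ (inj₂ (inj₁ vv′))) with w ≟ v′
        ... | yes w≡v′ = by (inj₂ (inj₁ (sym w≡v′)))
        ... | no w≢v′  = conclude v′ (ρ-mono vv′) w≢v′ upper (siblings child vv′ w≢v′)
        by (inj₂ (inj₂ (inj₂ wv′))) = conclude v′ (<-trans (ρ-mono child) (ρ-mono wv′))
          (λ w≡v′ → <-irrefl (cong ρ w≡v′) (ρ-mono wv′)) upper (chain child wv′)
      triple : ∀ e e′ → ¬ SameEdge G e e′ → 3 ≤ ∣ (N₂ e ∪ N₂ e′) ∩ X ∣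
      triple e e′ diff = decide (close? v w v′ w′) (close? v′ w′ v w) (3 ≤? ∣ (N₂ e ∪ N₂ e′) ∩ X ∣)
        where
        open Ends (ends e)
        open Ends (ends e′) renaming (v to v′; w to w′; child to child′; to to to′; from to from′; oriented to oriented′)
        ∩-mono : ∀ {p q} → p ⊆ q → p ∩ X ⊆ q ∩ X
        ∩-mono {p} {q} p⊆q x∈ = let x∈p , x∈X = x∈p∩q⁻ p X x∈ in x∈p∩q⁺ (p⊆q x∈p , x∈X)
        -- If the union has at most two elements of `X`, then the two that `double` finds near `e′`
        -- exhaust it.
        shared : ¬ 3 ≤ ∣ (N₂ e ∪ N₂ e′) ∩ X ∣ → N₂ e ∩ X ⊆ N₂ e′ ∩ X
        shared few x∈ = ⊆∧∣∣≥⇒⊇ (∩-mono {N₂ e′} {N₂ e ∪ N₂ e′} (λ y∈ → x∈p∪q⁺ (inj₂ y∈)))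
          (≤-trans (s≤s⁻¹ (≰⇒> few)) (double e′)) (∩-mono {N₂ e} {N₂ e ∪ N₂ e′} (λ y∈ → x∈p∪q⁺ (inj₁ y∈)) x∈)
        decide : Dec (Close v w v′ w′) → Dec (Close v′ w′ v w) → Dec (3 ≤ ∣ (N₂ e ∪ N₂ e′) ∩ X ∣) →
                 3 ≤ ∣ (N₂ e ∪ N₂ e′) ∩ X ∣
        decide (yes cl) _        _        = close e e′ diff cl
        decide _        (yes cl) _        = subst (λ p → 3 ≤ ∣ p ∩ X ∣) (∪-comm (N₂ e′) (N₂ e))
          (close e′ e (λ { (inj₁ (a , b)) → diff (inj₁ (sym a , sym b)) ; (inj₂ (a , b)) → diff (inj₂ (sym b , sym a)) }) cl)
        decide _        _        (yes le) = le
        decide (no far) (no far′) (no few) =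
          let a , b , a≢b , a∈ , b∈ = two-members (N₂ e ∩ X) (double e)
          in contradiction (common-unique (at a∈) (at b∈)) a≢b
          where
          at : ∀ {x} → x ∈ₛ N₂ e ∩ X → Common v v′ x
          at x∈ = common child child′
            (λ ww → far (inj₁ (same-parent child (subst (Child v′) (sym ww) child′)))) far far′
            (to (proj₁ (x∈p∩q⁻ (N₂ e) X x∈))) (to′ (proj₁ (x∈p∩q⁻ (N₂ e′) X (shared few x∈))))

    dominating⇒local : IsLiarsVEDominating G X → Local L
    dominating⇒local dom = record { single = single ; siblings = siblings ; chain = chain }
      where
      open IsLiarsVEDominating dom
      the : ∀ {v w} → Child v w → Edge G
      the {v} {w} e = edge v w (child-adj e)
      inside : ∀ {v w u} (e : Child v w) → u ∈ₛ N₂ (the e) → u ∈ ball v ++ down w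
      inside {v} {w} e u∈ = edge⁻ e ([ (λ p → inj₁ (N⇒ball p)) , (λ p → inj₂ (N⇒ball p)) ]′ (x∈p∪q⁻ (N[_] G v) (N[_] G w) u∈))
      single : ∀ {v w} → Child v w → 2 ≤ S L v + C L w
      single {v} {w} e = subst (2 ≤_) (tally-ball L v (down w))
        (at-most (ball v ++ down w) (N₂ (the e)) (inside e) (double (the e)))
      siblings : ∀ {v w y} → Child v w → Child v y → w ≢ y → 3 ≤ S L v + (C L w + C L y)
      siblings {v} {w} {y} e e′ w≢y = subst (3 ≤_) (tally-two L v w y)
        (at-most (ball v ++ down w ++ down y) (N₂ (the e) ∪ N₂ (the e′)) cover
          (triple (the e) (the e′) λ { (inj₁ (_ , eq)) → w≢y eq ; (inj₂ (refl , refl)) → <-irrefl refl (ρ-mono e) }))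
        where
        cover : ∀ {u} → u ∈ₛ N₂ (the e) ∪ N₂ (the e′) → u ∈ ball v ++ down w ++ down y
        cover u∈ with x∈p∪q⁻ (N₂ (the e)) (N₂ (the e′)) u∈
        ... | inj₁ u∈e = [ ∈-++⁺ˡ , (λ u∈w → ∈-++⁺ʳ (ball v) (∈-++⁺ˡ u∈w)) ]′ (∈-++⁻ (ball v) (inside e u∈e))
        ... | inj₂ u∈e = [ ∈-++⁺ˡ , (λ u∈y → ∈-++⁺ʳ (ball v) (∈-++⁺ʳ (down w) u∈y)) ]′ (∈-++⁻ (ball v) (inside e′ u∈e))
      chain : ∀ {v w y} → Child v w → Child w y → 3 ≤ S L v + (C L w + C L y)
      chain {v} {w} {y} e e′ = subst (3 ≤_) (tally-two L v w y)
        (at-most (ball v ++ down w ++ down y) (N₂ (the e) ∪ N₂ (the e′)) cover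
          (triple (the e) (the e′) λ { (inj₁ (refl , _)) → <-irrefl refl (ρ-mono e)
                                     ; (inj₂ (refl , _)) → <-asym (ρ-mono e) (ρ-mono e′) }))
        where
        cover : ∀ {u} → u ∈ₛ N₂ (the e) ∪ N₂ (the e′) → u ∈ ball v ++ down w ++ down y
        cover u∈ with x∈p∪q⁻ (N₂ (the e)) (N₂ (the e′)) u∈
        ... | inj₁ u∈e = [ ∈-++⁺ˡ , (λ u∈w → ∈-++⁺ʳ (ball v) (∈-++⁺ˡ u∈w)) ]′ (∈-++⁻ (ball v) (inside e u∈e))
        -- Apart from the children of `y`, the lower edge sees `v`, `w` and the children of `w`, all
        -- of which are listed already.
        ... | inj₂ u∈e with edge-split (inside e′ u∈e)
        ...   | inj₁ p                = ∈-++⁺ˡ (ball⁺ (inj₂ (inj₁ (sym (same-parent e p)))))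
        ...   | inj₂ (inj₁ refl)      = ∈-++⁺ˡ (ball⁺ (inj₂ (inj₂ e)))
        ...   | inj₂ (inj₂ (inj₁ p))  = ∈-++⁺ʳ (ball v) (∈-++⁺ˡ (children⁺ full p))
        ...   | inj₂ (inj₂ (inj₂ p))  = ∈-++⁺ʳ (ball v) (∈-++⁺ʳ (down w) (children⁺ full p))

  everything : V → Bool
  everything _ = true

  -- This is what makes the optimum finite: `v` and its child `w` give two elements, and the other
  -- child or the grandchild `y` gives the third.
  everything-local : Local everything
  everything-local = record
    { single   = λ {v} {w} e → ≤-trans (s≤s (1≤ (children⁺ full e))) (≤-trans (m≤n+m _ (tally everything (up v))) (m≤m+n _ (C everything w)))
    ; siblings = λ {v} {w} {y} e e′ w≢y → ≤-trans (s≤s (2≤ (children⁺ full e) (children⁺ full e′) w≢y))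
                   (≤-trans (m≤n+m _ (tally everything (up v))) (m≤m+n _ (C everything w + C everything y)))
    ; chain    = λ {v} {w} {y} e e′ → +-mono-≤ {2} {S everything v} {1}
                   (≤-trans (s≤s (1≤ (children⁺ full e))) (m≤n+m _ (tally everything (up v))))
                   (≤-trans (1≤ (children⁺ full e′)) (m≤m+n _ (C everything y))) }
    where
    1≤ : ∀ {x xs} → x ∈ xs → 1 ≤ tally everything xs
    1≤ (here refl) = s≤s z≤n
    1≤ (there _)   = s≤s z≤n
    2≤ : ∀ {x y xs} → x ∈ xs → y ∈ xs → x ≢ y → 2 ≤ tally everything xs
    2≤ (here refl) (here refl) x≢y = contradiction refl x≢y
    2≤ (here refl) (there y∈)  x≢y = s≤s (1≤ y∈)
    2≤ (there x∈)  _           x≢y = s≤s (1≤ x∈)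

-- The algorithm

module _ {k : ℕ} (full : List (Fin (suc k) × Fin (suc k))) {Adj : Fin (suc k) → Fin (suc k) → Set}
         (grown : Grown zero Adj (full ʳ++ [])) (complete : ∀ x → x ∈ verts zero (full ʳ++ [])) where

  weight≡∣∣ : ∀ (L : Fin (suc k) → Bool) (X : Subset (suc k)) → (∀ {u} → u ∈ₛ X → L u ≡ true) →
              (∀ {u} → L u ≡ true → u ∈ₛ X) → weight (forest full zero) L ≡ ∣ X ∣
  weight≡∣∣ L X X⇒L L⇒X = begin
    weight (forest full zero) L     ≡⟨ sym (+-identityʳ _) ⟩
    weights {root = zero} {Adj} [] full L   ≡⟨ weights≡ full [] L grown ⟩
    tally L (verts zero (full ʳ++ [])) ≡⟨ ≤-antisym
        (tally≤∣∣ L X (grown-unique zero Adj grown) (λ _ → L⇒X))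
        (∣∣≤tally L X _ (λ {u} u∈ → complete u , X⇒L u∈)) ⟩
    ∣ X ∣                           ∎
    where
    open ≡-Reasoning

-- Linear bounds on the time and the words

module Assembly {K : ℕ} (ini : Bool → Fin K) (join : Fin K → Fin K → Maybe (Fin K)) (accept : Fin K → Bool) where
  open Program ini join accept

  -- The 4 comes from the search, whose 3n passes and final test make 3n + 1 rounds, at most 4n for
  -- positive n; the other loops need fewer.
  loop-rate : Expr → Stmt → ℕ
  loop-rate e p = 4 * (1 + (cost e + duration p))

  rate : ℕ
  rate = (duration (9 ! lit 0 ≔ lit 0) + loop-rate (#n ⊖ index) init-body) +
    ((duration bfs-init + loop-rate (tail ⊖ head) bfs-body) +
    ((duration (9 ! lit 0 ≔ tail) + loop-rate (index ⊖ lit 1) graft-body) +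
    (duration select +
    (duration (9 ! lit 0 ≔ lit 1) + loop-rate (tail ⊖ index) trace-body))))

  -- One constant bounds both time and words. The summand K + 2 makes `factor * n` at least K, so
  -- that the codes of states fit, and at least 2n, so that the infinite weight n + 1 fits.
  factor : ℕ
  factor = rate + (K + 2)

  module _ (k : ℕ) where
    private
      n : ℕ
      n = suc k

    n<word : n < factor * n
    n<word = begin-strict
      n                <⟨ m<m+n n (s≤s z≤n) ⟩
      n + n            ≡⟨ cong (n +_) (sym (+-identityʳ n)) ⟩
      2 * n            ≤⟨ *-monoˡ-≤ n (≤-trans (m≤n+m 2 K) (m≤n+m (K + 2) rate)) ⟩
      factor * n       ∎
      where open ≤-Reasoning

    K≤word : K ≤ factor * n
    K≤word = ≤-trans (≤-trans (m≤m+n K 2) (m≤n+m (K + 2) rate)) (m≤m*n factor n)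

    constant≤ : ∀ a → a ≤ a * n
    constant≤ a = m≤m*n a n

    loop≤ : ∀ e p b → suc b ≤ 4 * n → loop-time e p b ≤ loop-rate e p * n
    loop≤ e p b le = begin
      suc b * B    ≤⟨ *-monoˡ-≤ B le ⟩
      4 * n * B    ≡⟨ trans (*-assoc 4 n B) (trans (cong (4 *_) (*-comm n B)) (sym (*-assoc 4 B n))) ⟩
      4 * B * n    ∎
      where
      open ≤-Reasoning
      B = 1 + (cost e + duration p)

    plus≤ : ∀ {a b} x y → a ≤ x * n → b ≤ y * n → a + b ≤ (x + y) * n
    plus≤ x y p q = ≤-trans (+-mono-≤ p q) (≤-reflexive (sym (*-distribʳ-+ n x y)))

    3n+1≤4n : suc (n + (n + n)) ≤ 4 * n
    3n+1≤4n = begin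
      suc (n + (n + n))      ≤⟨ +-monoˡ-≤ (n + (n + n)) (s≤s z≤n) ⟩
      n + (n + (n + n))      ≡⟨ cong (λ x → n + (n + (n + x))) (sym (+-identityʳ n)) ⟩
      4 * n                  ∎
      where open ≤-Reasoning

    n+1≤4n : suc n ≤ 4 * n
    n+1≤4n = ≤-trans (s≤s (m≤m+n n (n + n))) 3n+1≤4n

  module _ {k : ℕ} (G : Graph (suc k)) (tree : IsTree G) (adj : Vec (List (Fin (suc k))) (suc k))
           (lists : IsAdjacencyLists G adj) (ini-code : ∀ b → toℕ (ini b) ≡ ⟨ b ⟩) where
    open Correct {K} {k} ini join accept (factor * suc k) (n<word k) (K≤word k)

    total-time≤ : total-time ini-code G tree adj lists ≤ factor * suc k
    total-time≤ = ≤-trans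
      (plus≤ k (duration (9 ! lit 0 ≔ lit 0) + loop-rate (#n ⊖ index) init-body) _
        (plus≤ k (duration (9 ! lit 0 ≔ lit 0)) _ (constant≤ k (duration (9 ! lit 0 ≔ lit 0))) (loop≤ k (#n ⊖ index) init-body (suc k) (n+1≤4n k)))
      (plus≤ k (duration bfs-init + loop-rate (tail ⊖ head) bfs-body) _
        (plus≤ k (duration bfs-init) _ (constant≤ k (duration bfs-init)) (loop≤ k (tail ⊖ head) bfs-body (suc k + (suc k + suc k)) (3n+1≤4n k)))
      (plus≤ k (duration (9 ! lit 0 ≔ tail) + loop-rate (index ⊖ lit 1) graft-body) _
        (plus≤ k (duration (9 ! lit 0 ≔ tail)) _ (constant≤ k (duration (9 ! lit 0 ≔ tail))) (loop≤ k (index ⊖ lit 1) graft-body (suc k) (n+1≤4n k)))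
      (plus≤ k (duration select) _ (constant≤ k (duration select))
        (plus≤ k (duration (9 ! lit 0 ≔ lit 1)) (loop-rate (tail ⊖ index) trace-body) (constant≤ k (duration (9 ! lit 0 ≔ lit 1))) (loop≤ k (tail ⊖ index) trace-body (suc k) (n+1≤4n k)))))))
      (*-monoˡ-≤ (suc k) (m≤m+n rate (K + 2)))

  Characterises : Set₁
  Characterises = ∀ {k} (G : Graph (suc k)) → Acyclic G → ∀ full → Grown zero (Graph.Adj G) (full ʳ++ []) →
    (∀ x → x ∈ verts zero (full ʳ++ [])) → ∀ L X → (∀ {u} → u ∈ₛ X → L u ≡ true) → (∀ {u} → L u ≡ true → u ∈ₛ X) →
    (Accepted full L → IsLiarsVEDominating G X) × (IsLiarsVEDominating G X → Accepted full L)

  Satisfiable : Set₁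
  Satisfiable = ∀ {k} (G : Graph (suc k)) → Acyclic G → ∀ full → Grown zero (Graph.Adj G) (full ʳ++ []) →
    (∀ x → x ∈ verts zero (full ʳ++ [])) → Accepted full (λ _ → true)

  solve : (∀ b → toℕ (ini b) ≡ ⟨ b ⟩) → Characterises → Satisfiable →
    Σ[ p ∈ Stmt ] Σ[ c ∈ ℕ ]
      (∀ (n : ℕ) (G : Graph n) → IsTree G →
       ∀ (adj : Vec (List (Fin n)) n) → IsAdjacencyLists G adj →
       Σ[ m ∈ Memory ] Σ[ t ∈ ℕ ] Σ[ L ∈ Subset n ]
         ((c * n ⊢ p , input adj ⇓ m , t) × t ≤ c * n ×
          Outputs m L × IsMinimumLiarsVEDominating G L))
  solve ini-code characterises satisfiable = program , factor , λ
    { zero    G tree adj lists → contradiction (IsTree.nonempty tree) λ ()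
    ; (suc k) G tree adj lists → run G tree adj lists }
    where
    run : ∀ {k} (G : Graph (suc k)) → IsTree G → ∀ adj → IsAdjacencyLists G adj →
      Σ[ m ∈ Memory ] Σ[ t ∈ ℕ ] Σ[ X ∈ Subset (suc k) ]
        ((factor * suc k ⊢ program , input adj ⇓ m , t) × t ≤ factor * suc k ×
         Outputs m X × IsMinimumLiarsVEDominating G X)
    run {k} G tree adj lists = extract (program-runs ini-code G tree adj lists feasible)
      where
      open Correct {K} {k} ini join accept (factor * suc k) (n<word k) (K≤word k)
      feasible : ∀ full → Grown zero (Graph.Adj G) (full ʳ++ []) → (∀ x → x ∈ verts zero (full ʳ++ [])) →
        Σ[ L ∈ (Fin (suc k) → Bool) ] Accepted full L × weight (forest full zero) L ≤ suc k
      feasible full grown complete = (λ _ → true) , satisfiable G (IsTree.acyclic tree) full grown complete ,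
        ≤-reflexive (trans (weight≡∣∣ full grown complete _ ⊤ₛ (λ _ → refl) (λ _ → ∈⊤)) (∣⊤∣≡n (suc k)))
      extract : Runs (factor * suc k) program (input adj) (total-time ini-code G tree adj lists) (Solved ini-code G tree adj lists) →
        Σ[ m ∈ Memory ] Σ[ t ∈ ℕ ] Σ[ X ∈ Subset (suc k) ]
          ((factor * suc k ⊢ program , input adj ⇓ m , t) × t ≤ factor * suc k ×
           Outputs m X × IsMinimumLiarsVEDominating G X)
      extract (runs {m} {t} exec bound record { full = full ; zipper = refl ; grown = grown ; complete = complete ; L = L
                                          ; output = output ; accepted = accepted ; optimal = optimal }) =
        m , t , X , exec , ≤-trans bound (total-time≤ G tree adj lists ini-code) ,
        (λ v → trans (output v) (cong ⟨_⟩ (sym (lookup∘tabulate L v)))) , record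
          { dominating = proj₁ (characterises G acyclic full grown complete L X X⇒L L⇒X) accepted
          ; minimum = λ X′ dom → subst₂ _≤_ (weight≡∣∣ full grown complete L X X⇒L L⇒X)
              (weight≡∣∣ full grown complete (lookup X′) X′ []=⇒lookup (lookup⇒[]= _ X′))
              (optimal (lookup X′) (proj₂ (characterises G acyclic full grown complete (lookup X′) X′ []=⇒lookup (lookup⇒[]= _ X′)) dom)) }
        where
        open IsTree tree using (acyclic)
        X : Subset (suc k)
        X = tabulate L
        X⇒L : ∀ {u} → u ∈ₛ X → L u ≡ true
        X⇒L {u} u∈ = trans (sym (lookup∘tabulate L u)) ([]=⇒lookup u∈)
        L⇒X : ∀ {u} → L u ≡ true → u ∈ₛ X
        L⇒X {u} Lu = lookup⇒[]= u X (trans (lookup∘tabulate L u) Lu)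

module _ {k : ℕ} (G : Graph (suc k)) (acyclic : Acyclic G) (full : List (Fin (suc k) × Fin (suc k)))
  (grown : Grown zero (Graph.Adj G) (full ʳ++ [])) (complete : ∀ x → x ∈ verts zero (full ʳ++ [])) where
  open Constraints G acyclic full grown complete
  open Program iniꟳ joinꟳ acceptꟳ using (Accepted)

  allOk⇒accepted : ∀ L → AllOk L → Accepted full L
  allOk⇒accepted L (fine , ok) = encode root-info ,
    trans (state-encode (forest full zero) L) (cong (Maybe.map encode) (fine⇒state L full full grown refl fine zero)) ,
    accept⁺ root-info ok
    where
    root-info : Info
    root-info = summary {root = zero} {Graph.Adj G} L full zero (down zero)

  accepted⇒allOk : ∀ L → Accepted full L → AllOk L
  accepted⇒allOk L (s , st , acc) = from-root (state iniᴵ joinᴵ (forest full zero) L) refl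
    where
    root-info : Info
    root-info = summary {root = zero} {Graph.Adj G} L full zero (down zero)
    from-root : ∀ x → state iniᴵ joinᴵ (forest full zero) L ≡ x → AllOk L
    from-root nothing eq = contradiction (trans (sym st) (trans (state-encode (forest full zero) L) (cong (Maybe.map encode) eq))) λ ()
    from-root (just i) eq = fine , accept⁻ root-info (subst (λ s → acceptꟳ s ≡ true) s≡ acc)
      where
      fine : Fine {root = zero} {Graph.Adj G} L full full
      fine = state⇒fine L full full grown refl λ { (here refl) → i , eq }
      s≡ : s ≡ encode root-info
      s≡ = just-injective (trans (sym st) (trans (state-encode (forest full zero) L)
        (cong (Maybe.map encode) (fine⇒state L full full grown refl fine zero))))

theorem7 : Σ[ p ∈ Stmt ] Σ[ c ∈ ℕ ]
    (∀ (n : ℕ) (G : Graph n) → IsTree G →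
    ∀ (adj : Vec (List (Fin n)) n) → IsAdjacencyLists G adj →
    Σ[ m ∈ Memory ] Σ[ t ∈ ℕ ] Σ[ L ∈ Subset n ]
    ((c * n ⊢ p , input adj ⇓ m , t) × t ≤ c * n ×
    Outputs m L × IsMinimumLiarsVEDominating G L))
theorem7 = Assembly.solve iniꟳ joinꟳ acceptꟳ ini-code
  (λ G acyclic full grown complete L X X⇒L L⇒X →
    let open Constraints G acyclic full grown complete in
    (λ acc → local⇒dominating L X X⇒L L⇒X (allOk⇒local L (accepted⇒allOk G acyclic full grown complete L acc))) ,
    (λ dom → allOk⇒accepted G acyclic full grown complete L (local⇒allOk L (dominating⇒local L X X⇒L L⇒X dom))))
  (λ G acyclic full grown complete →
    let open Constraints G acyclic full grown complete in
    allOk⇒accepted G acyclic full grown complete everything (local⇒allOk everything everything-local))
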